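{- For every integer $n\geq1$, the homotopical reduction $$\Sigma^{\mathrm{row,red}}(n):=R_{\Gamma^{(2)}(n)}\bigl(\Sigma^{\mathrm{row,N}}(n)\bigr)$$ is a finite coherent presentation of the stylic monoid $\mathrm{Styl}_n$. Its generating cells in dimensions $2$ and $3$ are $$\Sigma^{\mathrm{row,red}}_2(n)=\Sigma^{\mathrm{row}}_2(n)\setminus\mathcal B_n^{\mathrm{acyc}},\qquad \Sigma^{\mathrm{row,red}}_3(n)=\bigl\{\mathcal X_\tau\mid\tau\in\mathfrak T_n^{(1)}\setminus\{\tau_\beta\mid\beta\in\mathcal B_n^{\mathrm{acyc}}\}\bigr\},$$ where the boundaries of the surviving generating $3$-cells are reduced by $R_{\Gamma^{(2)}(n)}$.
   Context: **Rows and $N$-tableaux.** Fix $n\geq1$, $[n]=\{1<2<\cdots<n\}$. For a word $w$ over $[n]$, $\ell(w)$ is its length and $\mathrm{supp}(w)$ its set of letters. A row is a nonempty strictly increasing word over $[n]$, identified with its support; $\mathcal R_n$ is the set of rows. For rows $u,v$, $u\triangleleft v$ means $\mathrm{supp}(u)\subseteq\mathrm{supp}(v)$ and $\min(v)<\min(u)$. An $N$-tableau $T$ is a finite sequence of rows $u_k,\dots,u_1$ (top to bottom) with $u_{i+1}\triangleleft u_i$ for all $i$; $\mathcal R(T):=r_{u_k}\cdots r_{u_1}$. Right $N$-insertion of a letter $x$: insert $x$ in the bottom row $u_1$, i.e. replace $u_1$ by the row with support $\mathrm{supp}(u_1)\cup\{x\}$; if $u_1$ has a letter $>x$, the smallest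 such letter $y$ is bumped (it also stays in the row) and is inserted in the same way into the next row above, and so on; a letter bumped from the top row creates a new top row consisting of that letter. $N(w)$ is obtained by inserting the letters of $w$ from left to right starting from the empty tableau. For rows $u,v$, $N(uv)$ has at most two rows. $\mathrm{Styl}_n$ is the monoid generated by $[n]$ subject to $xx=x$, $zxy=xzy$ ($x\leq y<z$), $yzx=yxz$ ($x<y\leq z$). **Polygraphs.** A $2$-polygraph $\Sigma=(\Sigma_1,\Sigma_2)$ is a set $\Sigma_1$ with a set $\Sigma_2$ of $2$-cells between words of $\Sigma_1^*$; it presents the quotient of $\Sigma_1^*$ by the congruence generated by $\Sigma_2$. $\Sigma_2^\top$ is the free $(2,1)$-category on $\Sigma$. A $(3,1)$-polygraph adds a set $\Sigma_3$ of generating $3$-cells $A\colon f\Rrightarrow g$ between parallel $2$-cells of $\Sigma_2^\top$. $0$-composition is juxtaposition; $\star_1$ is $1$-composition. It is a coherent presentation of $M$ if the $2$-polygraph presents $M$ and every pair of parallel $2$-cells $(f,g)$ of $\Sigma_2^\top$ is filled by a $3$-cell of the free $(3,1)$-category it generates; finite if all generating sets are finite. **Row cells and confluences.** $\Sigma^{\mathrm{row}}(n)$ has $1$-cells $r_u$ ($u\in\mathcal R_n$) and $2$-cells $\alpha_{u,v}\colon r_ur_v\Rightarrow\mathcal R(N(uv))$ for $u\not\triangleleft v$. It is known to be convergent and to present $\mathrm{Styl}_n$. $\Lambda_w\colon w\Rightarrow\widehat w$ is the leftmost normalization path of a word $w$ in the $r_u$. $\mathfrak C_n=\{(u,v,t)\in\mathcal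 R_n^3\mid u\not\triangleleft v,\ v\not\triangleleft t\}$. For a row $u$ of length $\ge2$, $\partial u$ is $u$ with its first letter removed; $\mathfrak S_n=\{(u,v,t)\in\mathfrak C_n\mid\ell(u)\geq2,\ \partial u\not\triangleleft v\}$; $\mathfrak T_n^{(1)}=\mathfrak C_n\setminus\mathfrak S_n$. For $\tau=(u,v,t)\in\mathfrak T_n^{(1)}$ let $\mathcal X_\tau\colon L_\tau\Rrightarrow R_\tau$ be a generating $3$-cell with $L_\tau=(\alpha_{u,v}1_{r_t})\star_1\Lambda_{\mathcal R(N(uv))r_t}$, $R_\tau=(1_{r_u}\alpha_{v,t})\star_1\Lambda_{r_u\mathcal R(N(vt))}$. $\Sigma^{\mathrm{row,scoh}}(n)$ is the $(3,1)$-polygraph over $\Sigma^{\mathrm{row}}(n)$ with generating $3$-cells $\mathcal X_\tau$, $\tau\in\mathfrak T_n^{(1)}$. **Selected row cells.** A pair $(\tau,\beta)$, $\tau\in\mathfrak T_n^{(1)}$, $\beta=\alpha_{p,q}$, is eligible if $\beta$ occurs in $L_\tau$ or $R_\tau$ as a rewriting step with source exactly $r_pr_q$ (empty context), and this is the only occurrence of $\beta$ in $L_\tau$ and $R_\tau$ together (occurrences in any context counted). For an eligible pair, let $U$ be the one of $L_\tau,R_\tau$ containing $\beta$, $V$ the other, write $U=f\star_1\beta\star_1g$ and put $S_{\tau,\beta}=f^{ -1}\star_1V\star_1g^{ -1}$. A dependency of $(\tau,\beta)$ is a generating row $2$-cell occurring, itself or its inverse, in the expression $S_{\tau,\beta}$.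 Order the cells $\alpha_{u,v}$ lexicographically by $(\ell(u)+\ell(v),\ell(u),u,v)$ (rows compared lexicographically, a proper prefix being smaller), triples lexicographically by their three rows, and eligible pairs lexicographically by $(\beta,\tau)$. Scan the eligible pairs in increasing order, keeping $(\tau,\beta)$ iff neither $\tau$ nor $\beta$ occurs in an already kept pair. $\mathcal B_n^{\mathrm{match}}$ is the set of $\beta$ in kept pairs, $\tau_\beta$ the triple kept with $\beta$, $S_\beta=S_{\tau_\beta,\beta}$. Let $G$ be the directed graph on $\mathcal B_n^{\mathrm{match}}$ with an edge $\beta'\to\beta$ iff $\beta'$ is a dependency of $(\tau_\beta,\beta)$. Scan $\mathcal B_n^{\mathrm{match}}$ in increasing order, keeping $\beta$ iff the subgraph of $G$ induced by the already kept vertices and $\beta$ is acyclic; the kept set is $\mathcal B_n^{\mathrm{acyc}}$. **The reduction.** $\Sigma^{\mathrm{row,N}}(n)$ is obtained from $\Sigma^{\mathrm{row,scoh}}(n)$ by replacing, for each $\beta\in\mathcal B_n^{\mathrm{acyc}}$, the generating $3$-cell $\mathcal X_{\tau_\beta}$ by a generating $3$-cell $A_\beta\colon S_\beta\Rrightarrow\beta$. $\Gamma^{(2)}(n)=(\varnothing,\{A_\beta\mid\beta\in\mathcal B_n^{\mathrm{acyc}}\},\varnothing)$. The homotopical reduction $R_{\Gamma^{(2)}(n)}$ removes every $A_\beta$ and its target $\beta$ ($\beta\in\mathcal B_n^{\mathrm{acyc}}$); the boundaries of the remaining $3$-cells are transformed by the $2$-functor fixing all $1$-cells and all surviving $2$-cells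 and sending $\beta\in\mathcal B_n^{\mathrm{acyc}}$ recursively to the image of $S_\beta$ (the recursion terminates by acyclicity). -}

module Defs where

open import Algebra.Bundles using (Monoid)
open import Algebra.Morphism.Structures using (module MonoidMorphisms)
open import Data.Bool.Base using (Bool; true; false; if_then_else_)
open import Data.Empty using (⊥-elim)
open import Data.Fin.Base using (Fin; zero; suc; _<_; _≤_)
open import Data.Fin.Induction using (spo-wellFounded)
open import Data.Fin.Properties as Fin using (<-cmp; _<?_; _≟_; <-trans; <-irrefl; ≤-refl; ≤-antisym; ≤-trans)
open import Data.Irrelevant using ([_])
open import Data.List.Base using (List; []; _∷_; _++_; _∷ʳ_; _ʳ++_; allFin; cartesianProduct; concatMap; filter; foldl; fromMaybe; head; length; lookup; map; mapMaybe; reverse)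
open import Data.List.Membership.Propositional using (_∈_; _∉_)
import Data.List.Membership.DecPropositional as DecMembership
open import Data.List.Membership.Propositional.Properties using (∈-lookup)
open import Data.List.Properties as List using (++-assoc; ++-identityʳ; concatMap-++; filter-accept; filter-reject; foldl-++; length-++; reverse-involutive; unfold-reverse)
open import Data.List.Relation.Binary.Lex.Strict using () renaming (<-strictTotalOrder to Lex-strictTotalOrder)
open import Data.List.Relation.Binary.Subset.Propositional using (_⊆_)
import Data.List.Relation.Binary.Subset.DecPropositional as DecSubset
open import Data.List.Relation.Unary.All as All using (All; []; _∷_; all?)
open import Data.List.Relation.Unary.AllPairs using (AllPairs; []; _∷_)
open import Data.List.Relation.Unary.Any using (Any; any?; here; there)
open import Data.List.Relation.Unary.Linked as Linked using (Linked; []; [-]; _∷_; linked?)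
open import Data.List.Relation.Unary.Linked.Properties using (Linked⇒AllPairs)
import Data.List.Sort as Sort
open import Data.Maybe.Base as Maybe using (Maybe; just; nothing; maybe′)
open import Data.Nat.Base as ℕ using (ℕ)
import Data.Nat.Induction as ℕ
import Data.Nat.Properties as ℕ
open import Data.Product.Base using (Σ-syntax; ∃; _×_; _,_; proj₁; proj₂)
open import Data.Product.Properties using (≡-dec)
open import Data.Product.Relation.Binary.Lex.Strict using (×-Lex; ×-wellFounded; ×-strictTotalOrder)
open import Data.Refinement using (Refinement; Refinement-syntax; value; _,_)
import Data.Refinement.Properties as Refinement
open import Data.Sum.Base using (_⊎_; inj₁; inj₂)
open import Function.Base using (_∘_; flip; id)
open import Function.Bundles using (_↔_; mk⇔)
open import Induction.WellFounded using (WellFounded; Acc; acc; module Subrelation)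
open import Level using (0ℓ)
open import Relation.Binary.Bundles using (StrictTotalOrder; DecTotalOrder)
open import Relation.Binary.Construct.Closure.Equivalence as Eq using (EqClosure)
open import Relation.Binary.Construct.Closure.ReflexiveTransitive as Star using (Star; ε; _◅_; _◅◅_)
open import Relation.Binary.Construct.Closure.Symmetric using (fwd; bwd)
open import Relation.Binary.Construct.Closure.Transitive as Plus using (TransClosure)
import Relation.Binary.Construct.On as On
open import Relation.Binary.Core using (Rel)
open import Relation.Binary.Definitions using (DecidableEquality; tri<; tri≈; tri>)
import Relation.Binary.Properties.StrictTotalOrder as StrictTotal
open import Relation.Binary.PropositionalEquality
open import Relation.Binary.Structures using (IsStrictPartialOrder)
open import Relation.Nullary using (¬_; Dec; yes; no; recompute; ¬?; _×-dec_; _⊎-dec_; does)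
open import Relation.Nullary.Decidable using (map′; dec⇒maybe; dec-true; dec-false; does-⇔)
import Relation.Unary as Unary
record Polygraph₂ : Set₁ where
  field
    Gen     : Set
    Cell    : Set
    src tgt : Cell → List Gen

  Word : Set
  Word = List Gen

module _ (P : Polygraph₂) where
  open Polygraph₂ P

  -- A rewriting step  a · α · b  : a (src α) b ⇒ a (tgt α) b.  The endpoints are
  -- given by equations so that whiskering a step is again a step.
  data Step : Word → Word → Set where
    step : ∀ a α b {w w′} → w ≡ a ++ src α ++ b → w′ ≡ a ++ tgt α ++ b → Step w w′

  Path : Word → Word → Set
  Path = Star Step

  -- Expressions for 2-cells of the free (2,1)-category: 1-composites of
  -- whiskered generators and their inverses.
  Zigzag : Word → Word → Set
  Zigzag = EqClosure Step

module _ {P : Polygraph₂} where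
  open Polygraph₂ P

  whisker-≡ : ∀ (a b x s y : Word) → a ++ (x ++ s ++ y) ++ b ≡ (a ++ x) ++ s ++ (y ++ b)
  whisker-≡ a b x s y = begin
    a ++ (x ++ s ++ y) ++ b     ≡⟨ cong (a ++_) (++-assoc x (s ++ y) b) ⟩
    a ++ x ++ (s ++ y) ++ b     ≡⟨ cong (λ z → a ++ x ++ z) (++-assoc s y b) ⟩
    a ++ x ++ s ++ y ++ b       ≡⟨ ++-assoc a x _ ⟨
    (a ++ x) ++ s ++ (y ++ b)   ∎
    where open ≡-Reasoning

  whiskerStep : ∀ a b {w w′} → Step P w w′ → Step P (a ++ w ++ b) (a ++ w′ ++ b)
  whiskerStep a b (step x α y refl refl) =
    step (a ++ x) α (y ++ b) (whisker-≡ a b x (src α) y) (whisker-≡ a b x (tgt α) y)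

  whisker : ∀ a b {w w′} → Zigzag P w w′ → Zigzag P (a ++ w ++ b) (a ++ w′ ++ b)
  whisker a b = Eq.gmap (λ w → a ++ w ++ b) (whiskerStep a b)

  embed : ∀ {w w′} → Path P w w′ → Zigzag P w w′
  embed = Star.map fwd

  inverse : ∀ {w w′} → Zigzag P w w′ → Zigzag P w′ w
  inverse = Eq.symmetric (Step P)

  generator : ∀ α → Step P (src α) (tgt α)
  generator α = step [] α [] (sym (++-identityʳ (src α))) (sym (++-identityʳ (tgt α)))

  cells : ∀ {w w′} → Zigzag P w w′ → List Cell
  cells ε                             = []
  cells (fwd (step _ α _ _ _) ◅ z) = α ∷ cells z
  cells (bwd (step _ α _ _ _) ◅ z) = α ∷ cells z

  infix 4 _≈_

  -- Equality of 2-cells in the free (2,1)-category.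
  data _≈_ : ∀ {w w′} → Zigzag P w w′ → Zigzag P w w′ → Set where
    ≈-refl   : ∀ {w w′} {f : Zigzag P w w′} → f ≈ f
    ≈-sym    : ∀ {w w′} {f g : Zigzag P w w′} → f ≈ g → g ≈ f
    ≈-trans  : ∀ {w w′} {f g h : Zigzag P w w′} → f ≈ g → g ≈ h → f ≈ h
    ≈-cong   : ∀ {w w′ w″} {f f′ : Zigzag P w w′} {g g′ : Zigzag P w′ w″} →
               f ≈ f′ → g ≈ g′ → f ◅◅ g ≈ f′ ◅◅ g′
    inverseʳ : ∀ {w w′} (s : Step P w w′) → fwd s ◅ bwd s ◅ ε ≈ ε
    inverseˡ : ∀ {w w′} (s : Step P w w′) → bwd s ◅ fwd s ◅ ε ≈ ε
    exchange : ∀ a α b β c {w x y w′} →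
               (e₁ : w ≡ a ++ src α ++ (b ++ src β ++ c)) (e₂ : x  ≡ a ++ tgt α ++ (b ++ src β ++ c))
               (e₃ : x ≡ (a ++ tgt α ++ b) ++ src β ++ c) (e₄ : w′ ≡ (a ++ tgt α ++ b) ++ tgt β ++ c)
               (e₅ : w ≡ (a ++ src α ++ b) ++ src β ++ c) (e₆ : y  ≡ (a ++ src α ++ b) ++ tgt β ++ c)
               (e₇ : y ≡ a ++ src α ++ (b ++ tgt β ++ c)) (e₈ : w′ ≡ a ++ tgt α ++ (b ++ tgt β ++ c)) →
               fwd (step a α (b ++ src β ++ c) e₁ e₂) ◅ fwd (step (a ++ tgt α ++ b) β c e₃ e₄) ◅ ε
               ≈ fwd (step (a ++ src α ++ b) β c e₅ e₆) ◅ fwd (step a α (b ++ tgt β ++ c) e₇ e₈) ◅ ε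

-- The quotient of the free monoid on Gen by the congruence generated by Cell.
presented : Polygraph₂ → Monoid 0ℓ 0ℓ
presented P = record
  { Carrier  = Word
  ; _≈_      = Zigzag P
  ; _∙_      = _++_
  ; ε        = []
  ; isMonoid = record
    { isSemigroup = record
      { isMagma = record
        { isEquivalence = Eq.isEquivalence (Step P)
        ; ∙-cong        = λ {x} {y} {u} {v} → ∙-cong {x} {y} {u} {v}
        }
      ; assoc = λ x y z → reflexive (++-assoc x y z)
      }
    ; identity = (λ _ → ε) , (λ x → reflexive (++-identityʳ x))
    }
  }
  where
  open Polygraph₂ P
  reflexive : ∀ {x y} → x ≡ y → Zigzag P x y
  reflexive refl = ε
  ∙-cong : ∀ {x y u v} → Zigzag P x y → Zigzag P u v → Zigzag P (x ++ u) (y ++ v)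
  ∙-cong {x} {y} {u} {v} f g =
    whisker [] u f ◅◅ subst₂ (λ r s → Zigzag P (y ++ r) (y ++ s))
                             (++-identityʳ u) (++-identityʳ v) (whisker y [] g)

Presents : Polygraph₂ → Monoid 0ℓ 0ℓ → Set
Presents P M = ∃ λ f → MonoidMorphisms.IsMonoidIsomorphism (Monoid.rawMonoid (presented P)) (Monoid.rawMonoid M) f

record Sphere (P : Polygraph₂) : Set where
  constructor sphere
  field
    {start end}   : Polygraph₂.Word P
    source target : Zigzag P start end

record Polygraph₃ : Set₁ where
  field
    base  : Polygraph₂
    Cell₃ : Set
    ∂     : Cell₃ → Sphere base
  open Polygraph₂ base public

module _ (P : Polygraph₃) where
  open Polygraph₃ P

  infix 4 _⇛_

  -- 3-cells of the free (3,1)-category.  Equations between 3-cells are not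
  -- imposed, since only the existence of fillers matters below.
  data _⇛_ : ∀ {w w′} → Zigzag base w w′ → Zigzag base w w′ → Set where
    gen   : ∀ A → Sphere.source (∂ A) ⇛ Sphere.target (∂ A)
    ident : ∀ {w w′} {f g : Zigzag base w w′} → f ≈ g → f ⇛ g
    inv   : ∀ {w w′} {f g : Zigzag base w w′} → f ⇛ g → g ⇛ f
    _⋆₂_  : ∀ {w w′} {f g h : Zigzag base w w′} → f ⇛ g → g ⇛ h → f ⇛ h
    _⋆₁_  : ∀ {w w′ w″} {f f′ : Zigzag base w w′} {g g′ : Zigzag base w′ w″} →
            f ⇛ f′ → g ⇛ g′ → f ◅◅ g ⇛ f′ ◅◅ g′
    whisk : ∀ a b {w w′} {f g : Zigzag base w w′} →
            f ⇛ g → whisker a b f ⇛ whisker a b g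

  record IsCoherentPresentation (M : Monoid 0ℓ 0ℓ) : Set where
    field
      presents : Presents base M
      fills    : ∀ {w w′} (f g : Zigzag base w w′) → f ⇛ g

Finite : Set → Set
Finite A = ∃ λ k → A ↔ Fin k

record IsFinite (P : Polygraph₃) : Set where
  open Polygraph₃ P
  field
    gen-finite   : Finite Gen
    cell-finite  : Finite Cell
    cell₃-finite : Finite Cell₃

-- Γ indexes the generating 3-cells  A i : S i ⇛ β i  to be removed along with the
-- generating 2-cells β i.
record CollapsiblePart (P : Polygraph₃) : Set₁ where
  open Polygraph₃ P
  field
    Γ           : Set
    A           : Γ → Cell₃
    β           : Γ → Cell
    S           : ∀ i → Zigzag base (src (β i)) (tgt (β i))
    ∂A          : ∀ i → ∂ (A i) ≡ sphere (S i) (fwd (generator (β i)) ◅ ε)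
    removed?    : ∀ α → Dec (∃ λ i → β i ≡ α)
    wellFounded : WellFounded (λ j i → β j ∈ cells (S i))

module HomotopicalReduction (P : Polygraph₃) (C : CollapsiblePart P) where
  open Polygraph₃ P
  open CollapsiblePart C

  reducedBase : Polygraph₂
  reducedBase = record
    { Gen  = Gen
    ; Cell = [ α ∈ Cell ∣ ¬ (∃ λ i → β i ≡ α) ]
    ; src  = src ∘ value
    ; tgt  = tgt ∘ value
    }

  mapStep : ∀ {w w′} (s : Step base w w′) →
            (∀ α → α ∈ cells (fwd s ◅ ε) → Zigzag reducedBase (src α) (tgt α)) →
            Zigzag reducedBase w w′
  mapStep (step a α b refl refl) φ = whisker a b (φ α (here refl))

  extend : ∀ {w w′} (z : Zigzag base w w′) →
           (∀ α → α ∈ cells z → Zigzag reducedBase (src α) (tgt α)) → Zigzag reducedBase w w′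
  extend ε                               φ = ε
  extend (fwd s@(step _ _ _ _ _) ◅ z) φ =
    mapStep s (λ { α (here p) → φ α (here p) }) ◅◅ extend z (λ α → φ α ∘ there)
  extend (bwd s@(step _ _ _ _ _) ◅ z) φ =
    inverse (mapStep s (λ { α (here p) → φ α (here p) })) ◅◅ extend z (λ α → φ α ∘ there)

  onCollapsed : ∀ i → Acc (λ j i → β j ∈ cells (S i)) i → Zigzag reducedBase (src (β i)) (tgt (β i))
  onCollapsed i (acc rs) = extend (S i) onCell
    where
    onCell : ∀ α → α ∈ cells (S i) → Zigzag reducedBase (src α) (tgt α)
    onCell α α∈S with removed? α
    ... | yes (j , refl) = onCollapsed j (rs α∈S)
    ... | no ¬removed    = fwd (generator (α , [ ¬removed ])) ◅ ε

  -- The 2-functor fixing surviving generators and sending β i to the image of S i.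
  reduce : ∀ {w w′} → Zigzag base w w′ → Zigzag reducedBase w w′
  reduce z = extend z λ α _ → onCell α
    where
    onCell : ∀ α → Zigzag reducedBase (src α) (tgt α)
    onCell α with removed? α
    ... | yes (j , refl) = onCollapsed j (wellFounded j)
    ... | no ¬removed    = fwd (generator (α , [ ¬removed ])) ◅ ε

  reducedSphere : Sphere base → Sphere reducedBase
  reducedSphere (sphere f g) = sphere (reduce f) (reduce g)

  reduction : Polygraph₃
  reduction = record
    { base  = reducedBase
    ; Cell₃ = [ B ∈ Cell₃ ∣ ¬ (∃ λ i → A i ≡ B) ]
    ; ∂     = reducedSphere ∘ ∂ ∘ value
    }

data StylicCell (n : ℕ) : Set where
  xx  : Fin n → StylicCell n
  zxy : (x y z : Fin n) → x ≤ y → y < z → StylicCell n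
  yzx : (x y z : Fin n) → x < y → y ≤ z → StylicCell n

stylic : ℕ → Polygraph₂
stylic n = record { Gen = Fin n ; Cell = StylicCell n ; src = src ; tgt = tgt }
  where
  src tgt : StylicCell n → List (Fin n)
  src (xx x)          = x ∷ x ∷ []
  src (zxy x y z _ _) = z ∷ x ∷ y ∷ []
  src (yzx x y z _ _) = y ∷ z ∷ x ∷ []
  tgt (xx x)          = x ∷ []
  tgt (zxy x y z _ _) = x ∷ z ∷ y ∷ []
  tgt (yzx x y z _ _) = y ∷ x ∷ z ∷ []

Styl : ℕ → Monoid 0ℓ 0ℓ
Styl n = presented (stylic n)

private module Order {n : ℕ} where
  <⇒≤ : ∀ {x y : Fin n} → x < y → x ≤ y
  <⇒≤ = ℕ.<⇒≤
  ≮⇒≥ : ∀ {x y : Fin n} → ¬ x < y → y ≤ x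
  ≮⇒≥ = ℕ.≮⇒≥
  <-≤-trans : ∀ {x y z : Fin n} → x < y → y ≤ z → x < z
  <-≤-trans = ℕ.<-≤-trans
  ≤-<-trans : ∀ {x y z : Fin n} → x ≤ y → y < z → x < z
  ≤-<-trans = ℕ.≤-<-trans
  <⇒≱ : ∀ {x y : Fin n} → x < y → ¬ y ≤ x
  <⇒≱ = ℕ.<⇒≱

-- A row is given by its first letter, which is its minimum, and the remaining word.
record Row (n : ℕ) : Set where
  constructor row
  field
    min         : Fin n
    rest        : List (Fin n)
    .increasing : Linked _<_ (min ∷ rest)

  word : List (Fin n)
  word = min ∷ rest

open Row public using (min; rest; word)

-- N-tableaux, with the bottom row at the head of the list.  The condition
-- uᵢ₊₁ ◁ uᵢ is not part of the type; insertion makes sense for any stack of rows.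
Rows : ℕ → Set
Rows n = List (Row n)

module _ {n : ℕ} where
  open Order {n}

  infix 4 _◁_

  _◁_ : Row n → Row n → Set
  u ◁ v = word u ⊆ word v × min v < min u

  add : Fin n → List (Fin n) → List (Fin n)
  add x [] = x ∷ []
  add x (y ∷ ys) with <-cmp x y
  ... | tri< _ _ _ = x ∷ y ∷ ys
  ... | tri≈ _ _ _ = y ∷ ys
  ... | tri> _ _ _ = y ∷ add x ys

  add-linked : ∀ {x y ys} → y < x → Linked _<_ (y ∷ ys) → Linked _<_ (y ∷ add x ys)
  add-linked {ys = []} y<x _ = y<x ∷ [-]
  add-linked {x} {ys = z ∷ zs} y<x (y<z ∷ zs↗) with <-cmp x z
  ... | tri< x<z _ _ = y<x ∷ x<z ∷ zs↗
  ... | tri≈ _ _ _   = y<z ∷ zs↗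
  ... | tri> _ _ z<x = y<z ∷ add-linked z<x zs↗

  addLetter : Fin n → Row n → Row n
  addLetter x (row y ys ys↗) with <-cmp x y
  ... | tri< x<y _ _ = row x (y ∷ ys) (x<y ∷ ys↗)
  ... | tri≈ _ _ _   = row y ys ys↗
  ... | tri> _ _ y<x = row y (add x ys) (add-linked y<x ys↗)

  bump : Fin n → Row n → Maybe (Fin n)
  bump x u = head (filter (x <?_) (word u))

  insert : Fin n → Rows n → Rows n
  insert x []      = row x [] [-] ∷ []
  insert x (u ∷ T) = addLetter x u ∷ maybe′ (λ y → insert y T) T (bump x u)

  insertAll : Rows n → List (Fin n) → Rows n
  insertAll = foldl (flip insert)

  N : List (Fin n) → Rows n
  N = insertAll []

  𝓡 : Rows n → List (Row n)
  𝓡 = reverse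

  read : List (Row n) → List (Fin n)
  read = concatMap word

  -- The lemmas from here to normal-form show that a word w of rows can only have
  -- the normal form 𝓡 (N (read w)).  Together with the termination proof below,
  -- this makes Λ total and the two sides of every generating 3-cell parallel.

  increasing : (u : Row n) → AllPairs _<_ (word u)
  increasing (row x xs xs↗) = Linked⇒AllPairs (λ {x} → <-trans {i = x}) (recompute (linked? _<?_ (x ∷ xs)) xs↗)

  word-injective : {u v : Row n} → word u ≡ word v → u ≡ v
  word-injective {row _ _ _} {row _ _ _} refl = refl

  sorted-ext : ∀ {xs ys : List (Fin n)} → AllPairs _<_ xs → AllPairs _<_ ys →
               xs ⊆ ys → ys ⊆ xs → xs ≡ ys
  sorted-ext [] [] _ _ = refl
  sorted-ext [] (_ ∷ _) _ q with q (here refl)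
  ... | ()
  sorted-ext (_ ∷ _) [] p _ with p (here refl)
  ... | ()
  sorted-ext {x ∷ xs} {y ∷ ys} (x< ∷ xs↗) (y< ∷ ys↗) p q = cong₂ _∷_ x≡y (sorted-ext xs↗ ys↗ p′ q′)
    where
    x≡y : x ≡ y
    x≡y with p (here refl) | q (here refl)
    ... | here e  | _       = e
    ... | there _ | here e  = sym e
    ... | there i | there j = ⊥-elim (<⇒≱ (All.lookup y< i) (<⇒≤ (All.lookup x< j)))
    p′ : xs ⊆ ys
    p′ i with p (there i)
    ... | here e  = ⊥-elim (<-irrefl (trans x≡y (sym e)) (All.lookup x< i))
    ... | there j = j
    q′ : ys ⊆ xs
    q′ i with q (there i)
    ... | here e  = ⊥-elim (<-irrefl (trans (sym x≡y) (sym e)) (All.lookup y< i))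
    ... | there j = j

  row-ext : {u v : Row n} → word u ⊆ word v → word v ⊆ word u → u ≡ v
  row-ext {u} {v} p q = word-injective (sorted-ext (increasing u) (increasing v) p q)

  min-≤ : (u : Row n) → ∀ {z} → z ∈ word u → min u ≤ z
  min-≤ u (here refl) = ≤-refl {x = min u}
  min-≤ u (there i) with increasing u
  ... | p ∷ _ = <⇒≤ (All.lookup p i)

  word-addLetter : ∀ x u → word (addLetter x u) ≡ add x (word u)
  word-addLetter x (row y ys _) with <-cmp x y
  ... | tri< _ _ _ = refl
  ... | tri≈ _ _ _ = refl
  ... | tri> _ _ _ = refl

  add-∈ˡ : ∀ x ys → x ∈ add x ys
  add-∈ˡ x [] = here refl
  add-∈ˡ x (y ∷ ys) with <-cmp x y
  ... | tri< _ _ _ = here refl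
  ... | tri≈ _ e _ = here e
  ... | tri> _ _ _ = there (add-∈ˡ x ys)

  add-∈ʳ : ∀ x ys → ys ⊆ add x ys
  add-∈ʳ x (y ∷ ys) i with <-cmp x y
  ... | tri< _ _ _ = there i
  ... | tri≈ _ _ _ = i
  add-∈ʳ x (y ∷ ys) (here e)  | tri> _ _ _ = here e
  add-∈ʳ x (y ∷ ys) (there i) | tri> _ _ _ = there (add-∈ʳ x ys i)

  add-∈⁻ : ∀ x ys {z} → z ∈ add x ys → z ≡ x ⊎ z ∈ ys
  add-∈⁻ x [] (here e) = inj₁ e
  add-∈⁻ x (y ∷ ys) i with <-cmp x y
  add-∈⁻ x (y ∷ ys) (here e)  | tri< _ _ _ = inj₁ e
  add-∈⁻ x (y ∷ ys) (there i) | tri< _ _ _ = inj₂ i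
  add-∈⁻ x (y ∷ ys) i         | tri≈ _ _ _ = inj₂ i
  add-∈⁻ x (y ∷ ys) (here e)  | tri> _ _ _ = inj₂ (here e)
  add-∈⁻ x (y ∷ ys) (there i) | tri> _ _ _ with add-∈⁻ x ys i
  ... | inj₁ e = inj₁ e
  ... | inj₂ j = inj₂ (there j)

  addLetter-∈ˡ : ∀ x u → x ∈ word (addLetter x u)
  addLetter-∈ˡ x u = subst (x ∈_) (sym (word-addLetter x u)) (add-∈ˡ x (word u))

  addLetter-∈ʳ : ∀ x u → word u ⊆ word (addLetter x u)
  addLetter-∈ʳ x u i = subst (_ ∈_) (sym (word-addLetter x u)) (add-∈ʳ x (word u) i)

  addLetter-∈⁻ : ∀ x u {z} → z ∈ word (addLetter x u) → z ≡ x ⊎ z ∈ word u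
  addLetter-∈⁻ x u i = add-∈⁻ x (word u) (subst (_ ∈_) (word-addLetter x u) i)

  addLetter-absorb : ∀ x u → x ∈ word u → addLetter x u ≡ u
  addLetter-absorb x u x∈u = row-ext p (addLetter-∈ʳ x u)
    where
    p : word (addLetter x u) ⊆ word u
    p i with addLetter-∈⁻ x u i
    ... | inj₁ refl = x∈u
    ... | inj₂ j    = j

  addLetter-comm : ∀ x y u → addLetter x (addLetter y u) ≡ addLetter y (addLetter x u)
  addLetter-comm x y u = row-ext (p x y) (p y x)
    where
    p : ∀ x y → word (addLetter x (addLetter y u)) ⊆ word (addLetter y (addLetter x u))
    p x y i with addLetter-∈⁻ x (addLetter y u) i
    ... | inj₁ refl = addLetter-∈ʳ y (addLetter x u) (addLetter-∈ˡ x u)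
    ... | inj₂ j with addLetter-∈⁻ y u j
    ... | inj₁ refl = addLetter-∈ˡ y (addLetter x u)
    ... | inj₂ k    = addLetter-∈ʳ y (addLetter x u) (addLetter-∈ʳ x u k)

  -- y is the least letter of u greater than x
  Next : Fin n → List (Fin n) → Fin n → Set
  Next x u y = y ∈ u × x < y × (∀ {z} → z ∈ u → x < z → y ≤ z)

  bumpL : Fin n → List (Fin n) → Maybe (Fin n)
  bumpL x u = head (filter (x <?_) u)

  bumpL-just : ∀ x u {y} → AllPairs _<_ u → bumpL x u ≡ just y → Next x u y
  bumpL-just x (p ∷ ps) (p< ∷ ps↗) e with x <? p
  ... | yes x<p with trans (cong head (sym (filter-accept (x <?_) {p} {ps} x<p))) e
  ... | refl = here refl , x<p , λ { (here refl) _ → ≤-refl {x = p} ; (there i) _ → <⇒≤ (All.lookup p< i) }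
  bumpL-just x (p ∷ ps) (p< ∷ ps↗) e | no x≮p
    with bumpL-just x ps ps↗ (trans (cong head (sym (filter-reject (x <?_) {p} {ps} x≮p))) e)
  ... | y∈ , x<y , least =
    there y∈ , x<y , λ { (here refl) x<z → ⊥-elim (x≮p x<z) ; (there i) x<z → least i x<z }

  bumpL-nothing : ∀ x u → bumpL x u ≡ nothing → ∀ {z} → z ∈ u → ¬ x < z
  bumpL-nothing x (p ∷ ps) e i with x <? p
  ... | yes x<p with trans (cong head (sym (filter-accept (x <?_) {p} {ps} x<p))) e
  ... | ()
  bumpL-nothing x (p ∷ ps) e (here refl) | no x≮p = x≮p
  bumpL-nothing x (p ∷ ps) e (there i)   | no x≮p =
    bumpL-nothing x ps (trans (cong head (sym (filter-reject (x <?_) {p} {ps} x≮p))) e) i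

  bump-just : ∀ x u {y} → bump x u ≡ just y → Next x (word u) y
  bump-just x u = bumpL-just x (word u) (increasing u)

  bump-nothing : ∀ x u → bump x u ≡ nothing → ∀ {z} → z ∈ word u → ¬ x < z
  bump-nothing x u = bumpL-nothing x (word u)

  bump-next : ∀ x u {y} → Next x (word u) y → bump x u ≡ just y
  bump-next x u {y} (y∈ , x<y , least) with bump x u in eq
  ... | nothing = ⊥-elim (bump-nothing x u eq y∈ x<y)
  ... | just y′ with bump-just x u eq
  ... | y′∈ , x<y′ , least′ = cong just (≤-antisym (least′ y∈ x<y) (least y′∈ x<y′))

  bump-none : ∀ x u → (∀ {z} → z ∈ word u → ¬ x < z) → bump x u ≡ nothing
  bump-none x u none with bump x u in eq
  ... | nothing = refl
  ... | just y with bump-just x u eq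
  ... | y∈ , x<y , _ = ⊥-elim (none y∈ x<y)

  -- bump is determined by the letters greater than x
  bump-cong : ∀ x y u v → (∀ {z} → z ∈ word u → x < z → z ∈ word v × y < z) →
              (∀ {z} → z ∈ word v → y < z → z ∈ word u × x < z) → bump x u ≡ bump y v
  bump-cong x y u v f g with bump x u in eq
  ... | nothing = sym (bump-none y v λ i y<z → bump-nothing x u eq (proj₁ (g i y<z)) (proj₂ (g i y<z)))
  ... | just a with bump-just x u eq
  ... | a∈ , x<a , least = sym (bump-next y v
        (proj₁ (f a∈ x<a) , proj₂ (f a∈ x<a) , λ i y<z → least (proj₁ (g i y<z)) (proj₂ (g i y<z))))

  bump-addLetter : ∀ {x y} u → x ≤ y → bump y (addLetter x u) ≡ bump y u
  bump-addLetter {x} {y} u x≤y = bump-cong y y (addLetter x u) u f (λ i p → addLetter-∈ʳ x u i , p)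
    where
    f : ∀ {z} → z ∈ word (addLetter x u) → y < z → z ∈ word u × y < z
    f i y<z with addLetter-∈⁻ x u i
    ... | inj₁ refl = ⊥-elim (<⇒≱ y<z x≤y)
    ... | inj₂ j    = j , y<z

  bump-addLetter-old : ∀ {x a z} u → bump x u ≡ just a → a ≤ z → bump x (addLetter z u) ≡ just a
  bump-addLetter-old {x} {a} {z} u e a≤z with bump-just x u e
  ... | a∈ , x<a , least = bump-next x (addLetter z u) (addLetter-∈ʳ z u a∈ , x<a , least′)
    where
    least′ : ∀ {w} → w ∈ word (addLetter z u) → x < w → a ≤ w
    least′ i x<w with addLetter-∈⁻ z u i
    ... | inj₁ refl = a≤z
    ... | inj₂ j    = least j x<w

  bump-addLetter-new : ∀ {x z} u → x < z → (∀ {w} → w ∈ word u → x < w → z ≤ w) →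
                       bump x (addLetter z u) ≡ just z
  bump-addLetter-new {x} {z} u x<z least = bump-next x (addLetter z u) (addLetter-∈ˡ z u , x<z , least′)
    where
    least′ : ∀ {w} → w ∈ word (addLetter z u) → x < w → z ≤ w
    least′ i x<w with addLetter-∈⁻ z u i
    ... | inj₁ refl = ≤-refl {x = z}
    ... | inj₂ j    = least j x<w

  ins? : Maybe (Fin n) → Rows n → Rows n
  ins? m T = maybe′ (λ y → insert y T) T m

  insert-xx : ∀ x T → insert x (insert x T) ≡ insert x T
  insert-xx x [] rewrite addLetter-absorb x (row x [] [-]) (here refl)
    | bump-none x (row x [] [-]) (λ { (here refl) → <-irrefl refl }) = refl
  insert-xx x (u ∷ T)
    rewrite addLetter-absorb x (addLetter x u) (addLetter-∈ˡ x u)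
          | bump-addLetter {x} {x} u (≤-refl {x = x}) with bump x u
  ... | nothing = refl
  ... | just b  = cong (addLetter x u ∷_) (insert-xx b T)

  pre : Fin n → Row n
  pre x = row x [] [-]

  pre-none : ∀ {x z} → z ≤ x → bump x (pre z) ≡ nothing
  pre-none {x} {z} z≤x = bump-none x (pre z) λ { (here refl) x<z → <⇒≱ x<z z≤x }

  pre-just : ∀ {x z} → x < z → bump x (pre z) ≡ just z
  pre-just {x} {z} x<z = bump-next x (pre z) (here refl , x<z , λ { (here refl) _ → ≤-refl {x = z} })

  pre-comm : ∀ x z → addLetter x (pre z) ≡ addLetter z (pre x)
  pre-comm x z = row-ext (p x z) (p z x)
    where
    p : ∀ x z → word (addLetter x (pre z)) ⊆ word (addLetter z (pre x))
    p x z i with addLetter-∈⁻ x (pre z) i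
    ... | inj₁ refl        = addLetter-∈ʳ z (pre x) (here refl)
    ... | inj₂ (here refl) = addLetter-∈ˡ z (pre x)

  insert-zxy : ∀ {x y z} → x ≤ y → y < z → ∀ T →
               insert y (insert x (insert z T)) ≡ insert y (insert z (insert x T))
  insert-zxy {x} {y} {z} x≤y y<z []
    rewrite pre-just {x} {z} (≤-<-trans {x} {y} {z} x≤y y<z)
          | pre-none {z} {x} (≤-trans {i = x} {j = y} {k = z} x≤y (<⇒≤ y<z))
          | pre-comm x z
          | bump-addLetter-new {y} {z} (pre x) y<z (λ { (here refl) y<x → ⊥-elim (<⇒≱ y<x x≤y) })
          = cong (addLetter y (addLetter z (pre x)) ∷_) (insert-xx z [])
  insert-zxy {x} {y} {z} x≤y y<z (u ∷ T)
    rewrite addLetter-comm x z u | bump-addLetter {x} {z} u (<⇒≤ (≤-<-trans {x} {y} {z} x≤y y<z))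
          = cong (addLetter y (addLetter z (addLetter x u)) ∷_)
              (trans (cong (λ m → ins? m (ins? (bump x (addLetter z u)) (ins? (bump z u) T))) d-eq)
              (trans (above _ _ _ _ refl refl refl refl)
                     (cong (λ m → ins? m (ins? (bump z u) (ins? (bump x u) T))) (sym d-eq))))
    where
    x<z : x < z
    x<z = ≤-<-trans {x} {y} {z} x≤y y<z
    d-eq : bump y (addLetter z (addLetter x u)) ≡ bump y (addLetter z u)
    d-eq = trans (cong (bump y) (addLetter-comm z x u)) (bump-addLetter {x} {y} (addLetter z u) x≤y)
    far : (∀ {w} → w ∈ word u → x < w → z < w) → ∀ mx mz ma md →
          bump x u ≡ mx → bump z u ≡ mz → bump x (addLetter z u) ≡ ma → bump y (addLetter z u) ≡ md →
          ins? md (ins? ma (ins? mz T)) ≡ ins? md (ins? mz (ins? mx T))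
    far h mx mz ma md ex ez ea ed
      with trans (sym ea) (bump-addLetter-new {x} {z} u x<z (λ i p → <⇒≤ (h i p)))
         | trans (sym ed) (bump-addLetter-new {y} {z} u y<z (λ i p → <⇒≤ (h i (≤-<-trans {x} {y} x≤y p))))
         | trans (sym ez) (trans (sym (bump-cong x z u u (λ i p → i , h i p) (λ i p → i , <-trans {i = x} {j = z} x<z p))) ex)
    far h mx nothing _ _ ex ez ea ed | refl | refl | refl = insert-xx z T
    far h mx (just c) _ _ ex ez ea ed | refl | refl | refl =
      trans (insert-xx z (insert c T)) (cong (insert z) (sym (insert-xx c T)))
    above : ∀ mx mz ma md →
            bump x u ≡ mx → bump z u ≡ mz → bump x (addLetter z u) ≡ ma → bump y (addLetter z u) ≡ md →
            ins? md (ins? ma (ins? mz T)) ≡ ins? md (ins? mz (ins? mx T))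
    above nothing mz ma md ex ez ea ed =
      far (λ i p → ⊥-elim (bump-nothing x u ex i p)) nothing mz ma md ex ez ea ed
    above (just a) mz ma md ex ez ea ed with z <? a | bump-just x u ex
    ... | yes z<a | _ , _ , least = far (λ i p → <-≤-trans {z} {a} z<a (least i p)) (just a) mz ma md ex ez ea ed
    ... | no z≮a | a∈ , x<a , least with trans (sym ea) (bump-addLetter-old {x} {a} {z} u ex (≮⇒≥ z≮a))
    above (just a) nothing _ md ex ez ea ed | no z≮a | a∈ , x<a , least | refl = refl
    above (just a) (just c) _ nothing ex ez ea ed | no z≮a | a∈ , x<a , least | refl =
      ⊥-elim (bump-nothing y (addLetter z u) ed (addLetter-∈ˡ z u) y<z)
    above (just a) (just c) _ (just d) ex ez ea ed | no z≮a | a∈ , x<a , least | refl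
      with bump-just y (addLetter z u) ed | bump-just z u ez
    ... | d∈ , y<d , dleast | c∈ , z<c , _ = insert-zxy {a} {d} {c} a≤d d<c T
      where
      a≤d : a ≤ d
      a≤d with addLetter-∈⁻ z u d∈
      ... | inj₁ refl = ≮⇒≥ z≮a
      ... | inj₂ j    = least j (≤-<-trans {x} {y} {d} x≤y y<d)
      d<c : d < c
      d<c = ≤-<-trans {d} {z} {c} (dleast (addLetter-∈ˡ z u) y<z) z<c

  insert-yzx : ∀ {x y z} → x < y → y ≤ z → ∀ T →
               insert x (insert z (insert y T)) ≡ insert z (insert x (insert y T))
  insert-yzx {x} {y} {z} x<y y≤z []
    rewrite pre-none {z} {y} y≤z | pre-just {x} {y} x<y
          | bump-addLetter-old {x} {y} {z} (pre y) (pre-just x<y) y≤z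
          | bump-addLetter {x} {z} (pre y) (<⇒≤ (<-≤-trans {x} {y} {z} x<y y≤z))
          | pre-none {z} {y} y≤z | addLetter-comm x z (pre y) = refl
  insert-yzx {x} {y} {z} x<y y≤z (u ∷ T)
    rewrite addLetter-comm x z (addLetter y u)
          | bump-addLetter {x} {z} (addLetter y u) (<⇒≤ (<-≤-trans {x} {y} {z} x<y y≤z))
          = cong (addLetter z (addLetter x (addLetter y u)) ∷_) (above _ _ _ _ refl refl refl refl)
    where
    above : ∀ ma mc mb me →
            bump x (addLetter z (addLetter y u)) ≡ ma → bump z (addLetter y u) ≡ mc →
            bump x (addLetter y u) ≡ mb → bump y u ≡ me →
            ins? ma (ins? mc (ins? me T)) ≡ ins? mc (ins? mb (ins? me T))
    above ma mc nothing me ea ec eb ee =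
      ⊥-elim (bump-nothing x (addLetter y u) eb (addLetter-∈ˡ y u) x<y)
    above ma mc (just b) me ea ec eb ee with bump-just x (addLetter y u) eb
    ... | b∈ , x<b , bleast
      with trans (sym ea) (bump-addLetter-old {x} {b} {z} (addLetter y u) eb
                (≤-trans {i = b} {j = y} {k = z} (bleast (addLetter-∈ˡ y u) x<y) y≤z))
    above ma nothing (just b) me ea ec eb ee | b∈ , x<b , bleast | refl = refl
    above ma (just c) (just b) me ea ec eb ee | b∈ , x<b , bleast | refl
      with bump-just z u (trans (sym (bump-addLetter {y} {z} u y≤z)) ec)
    above ma (just c) (just b) nothing ea ec eb ee | b∈ , x<b , bleast | refl | c∈ , z<c , _ =
      ⊥-elim (bump-nothing y u ee c∈ (≤-<-trans {y} {z} {c} y≤z z<c))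
    above ma (just c) (just b) (just e) ea ec eb ee | b∈ , x<b , bleast | refl | c∈ , z<c , _
      with bump-just y u ee
    ... | _ , y<e , eleast =
      insert-yzx {b} {e} {c} (≤-<-trans {b} {y} {e} (bleast (addLetter-∈ˡ y u) x<y) y<e)
                 (eleast c∈ (≤-<-trans {y} {z} {c} y≤z z<c)) T

  insertAll-cell : ∀ (T : Rows n) c → insertAll T (Polygraph₂.src (stylic n) c) ≡ insertAll T (Polygraph₂.tgt (stylic n) c)
  insertAll-cell T (xx x)          = insert-xx x T
  insertAll-cell T (zxy x y z p q) = insert-zxy {x} {y} {z} p q T
  insertAll-cell T (yzx x y z p q) = insert-yzx {x} {y} {z} p q T

  infix 4 _∼_
  _∼_ : List (Fin n) → List (Fin n) → Set
  _∼_ = Zigzag (stylic n)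

  insertAll-step : ∀ {w w′} → Step (stylic n) w w′ → ∀ T → insertAll T w ≡ insertAll T w′
  insertAll-step (step a c b refl refl) T = begin
    insertAll T (a ++ s ++ b)                       ≡⟨ split s ⟩
    insertAll (insertAll (insertAll T a) s) b       ≡⟨ cong (λ U → insertAll U b) (insertAll-cell (insertAll T a) c) ⟩
    insertAll (insertAll (insertAll T a) t) b       ≡⟨ split t ⟨
    insertAll T (a ++ t ++ b)                       ∎
    where
    open ≡-Reasoning
    s = Polygraph₂.src (stylic n) c
    t = Polygraph₂.tgt (stylic n) c
    split : ∀ s → insertAll T (a ++ s ++ b) ≡ insertAll (insertAll (insertAll T a) s) b
    split s = trans (foldl-++ (flip insert) T a (s ++ b)) (foldl-++ (flip insert) (insertAll T a) s b)

  N-invariant : ∀ {w w′} → w ∼ w′ → ∀ T → insertAll T w ≡ insertAll T w′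
  N-invariant ε           T = refl
  N-invariant (fwd s ◅ z) T = trans (insertAll-step s T) (N-invariant z T)
  N-invariant (bwd s ◅ z) T = trans (sym (insertAll-step s T)) (N-invariant z T)

module _ {n : ℕ} where
  open Order {n}

  step∼ : ∀ a (c : StylicCell n) b →
          a ++ Polygraph₂.src (stylic n) c ++ b ∼ a ++ Polygraph₂.tgt (stylic n) c ++ b
  step∼ a c b = fwd (step a c b refl refl) ◅ ε

  ∼-sym : ∀ {w w′ : List (Fin n)} → w ∼ w′ → w′ ∼ w
  ∼-sym = inverse

  ∼-reflexive : ∀ {w w′ : List (Fin n)} → w ≡ w′ → w ∼ w′
  ∼-reflexive refl = ε

  ∼-++ˡ : ∀ (a : List (Fin n)) {w w′} → w ∼ w′ → a ++ w ∼ a ++ w′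
  ∼-++ˡ a {w} {w′} z = subst₂ (λ r s → a ++ r ∼ a ++ s) (++-identityʳ w) (++-identityʳ w′) (whisker a [] z)

  ∼-++ʳ : ∀ (b : List (Fin n)) {w w′} → w ∼ w′ → w ++ b ∼ w′ ++ b
  ∼-++ʳ b z = whisker [] b z

  sink : ∀ {x} y ps → x < y → AllPairs _<_ (y ∷ ps) → y ∷ ps ++ x ∷ [] ∼ y ∷ x ∷ ps
  sink y [] x<y _ = ε
  sink {x} y (z ∷ zs) x<y ((y<z ∷ _) ∷ z∷zs↗) =
    ∼-++ˡ (y ∷ []) (sink {x} z zs (<-trans {i = x} {j = y} x<y y<z) z∷zs↗)
    ◅◅ step∼ [] (yzx x y z x<y (<⇒≤ y<z)) zs

  swap-eq : ∀ {x p} → x < p → p ∷ x ∷ [] ∼ p ∷ x ∷ p ∷ []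
  swap-eq {x} {p} x<p =
    ∼-sym (step∼ [] (xx p) (x ∷ [])) ◅◅ step∼ [] (yzx x p p x<p (≤-refl {x = p})) []

  row-absorb : ∀ x ps → AllPairs _<_ ps → ps ++ x ∷ [] ∼ fromMaybe (head (filter (x <?_) ps)) ++ add x ps
  add-head : ∀ {x p} ps → p < x → All (p <_) ps → ∃ λ h → ∃ λ r → add x ps ≡ h ∷ r × p < h × h ≤ x
  add-head {x} [] p<x _ = x , [] , refl , p<x , ≤-refl {x = x}
  add-head {x} (q ∷ qs) p<x (p<q ∷ _) with <-cmp x q
  ... | tri< _ _ _ = x , q ∷ qs , refl , p<x , ≤-refl {x = x}
  ... | tri≈ _ refl _ = q , qs , refl , p<q , ≤-refl {x = q}
  ... | tri> _ _ q<x = q , add x qs , refl , p<q , <⇒≤ q<x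

  row-absorb x [] _ = ε
  row-absorb x (p ∷ ps) (p< ∷ ps↗) with <-cmp x p
  ... | tri< x<p _ _ rewrite filter-accept (x <?_) {p} {ps} x<p =
    sink p ps x<p (p< ∷ ps↗) ◅◅ ∼-++ʳ ps (swap-eq x<p)
  row-absorb x (p ∷ []) (p< ∷ ps↗) | tri≈ x≮p refl _ rewrite filter-reject (x <?_) {p} {[]} x≮p =
    step∼ [] (xx x) []
  row-absorb x (p ∷ q ∷ qs) ((p<q ∷ _) ∷ ps↗) | tri≈ x≮p refl _
    rewrite filter-reject (x <?_) {p} {q ∷ qs} x≮p | filter-accept (x <?_) {q} {qs} p<q =
    ∼-++ˡ (p ∷ []) (sink q qs p<q ps↗)
    ◅◅ ∼-sym (step∼ [] (zxy p p q (≤-refl {x = p}) p<q) qs)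
    ◅◅ step∼ (q ∷ []) (xx p) qs
    ◅◅ ∼-++ʳ qs (swap-eq p<q)
  row-absorb x (p ∷ ps) (p< ∷ ps↗) | tri> x≮p _ p<x
    rewrite filter-reject (x <?_) {p} {ps} x≮p = ∼-++ˡ (p ∷ []) (row-absorb x ps ps↗) ◅◅ move
    where
    move : p ∷ fromMaybe (head (filter (x <?_) ps)) ++ add x ps ∼
           fromMaybe (head (filter (x <?_) ps)) ++ p ∷ add x ps
    move with head (filter (x <?_) ps) in eq
    ... | nothing = ε
    ... | just y with add-head {x} {p} ps p<x p<
    ... | h , r , e , p<h , h≤x rewrite e = ∼-sym (step∼ [] (zxy p h y (<⇒≤ p<h) (≤-<-trans {h} {x} {y} h≤x x<y)) r)
      where
      x<y : x < y
      x<y = go ps eq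
        where
        go : ∀ qs → head (filter (x <?_) qs) ≡ just y → x < y
        go (q ∷ qs) e with x <? q
        ... | yes x<q with trans (cong head (sym (filter-accept (x <?_) {q} {qs} x<q))) e
        ... | refl = x<q
        go (q ∷ qs) e | no x≮q = go qs (trans (cong head (sym (filter-reject (x <?_) {q} {qs} x≮q))) e)

  read-𝓡-∷ : ∀ u (T : Rows n) → read (𝓡 (u ∷ T)) ≡ read (𝓡 T) ++ word u
  read-𝓡-∷ u T = begin
    read (reverse (u ∷ T))              ≡⟨ cong read (unfold-reverse u T) ⟩
    read (reverse T ++ u ∷ [])          ≡⟨ concatMap-++ word (reverse T) (u ∷ []) ⟩
    read (reverse T) ++ (word u ++ [])  ≡⟨ cong (read (reverse T) ++_) (++-identityʳ (word u)) ⟩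
    read (reverse T) ++ word u          ∎
    where open ≡-Reasoning

  read-insert : ∀ x (T : Rows n) → read (𝓡 T) ++ x ∷ [] ∼ read (𝓡 (insert x T))
  read-insert x []      = ε
  read-insert x (u ∷ T) =
    ∼-reflexive (trans (cong (_++ x ∷ []) (read-𝓡-∷ u T)) (++-assoc (read (𝓡 T)) (word u) (x ∷ [])))
    ◅◅ ∼-++ˡ (read (𝓡 T)) (row-absorb x (word u) (increasing u))
    ◅◅ ∼-reflexive (sym (++-assoc (read (𝓡 T)) (fromMaybe (bump x u)) (add x (word u))))
    ◅◅ ∼-++ʳ (add x (word u)) above
    ◅◅ ∼-reflexive (sym (trans (read-𝓡-∷ (addLetter x u) T′) (cong (read (𝓡 T′) ++_) (word-addLetter x u))))
    where
    T′ = maybe′ (λ y → insert y T) T (bump x u)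
    above : read (𝓡 T) ++ fromMaybe (bump x u) ∼ read (𝓡 T′)
    above with bump x u
    ... | nothing = ∼-reflexive (++-identityʳ _)
    ... | just y  = read-insert y T

  read-insertAll : ∀ w (T : Rows n) → read (𝓡 T) ++ w ∼ read (𝓡 (insertAll T w))
  read-insertAll []      T = ∼-reflexive (++-identityʳ _)
  read-insertAll (x ∷ w) T =
    ∼-reflexive (sym (++-assoc (read (𝓡 T)) (x ∷ []) w))
    ◅◅ ∼-++ʳ w (read-insert x T) ◅◅ read-insertAll w (insert x T)

  read-N : ∀ w → w ∼ read (𝓡 (N w))
  read-N w = read-insertAll w []

  addAll : Row n → List (Fin n) → Row n
  addAll = foldl (flip addLetter)

  addAll-∈ʳ : ∀ s u {z} → z ∈ word u → z ∈ word (addAll u s)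
  addAll-∈ʳ []      u i = i
  addAll-∈ʳ (x ∷ s) u i = addAll-∈ʳ s (addLetter x u) (addLetter-∈ʳ x u i)

  addAll-∈ˡ : ∀ s u {z} → z ∈ s → z ∈ word (addAll u s)
  addAll-∈ˡ (x ∷ s) u (here refl) = addAll-∈ʳ s (addLetter x u) (addLetter-∈ˡ x u)
  addAll-∈ˡ (x ∷ s) u (there i)   = addAll-∈ˡ s (addLetter x u) i

  addAll-∈⁻ : ∀ s u {z} → z ∈ word (addAll u s) → z ∈ s ⊎ z ∈ word u
  addAll-∈⁻ []      u i = inj₂ i
  addAll-∈⁻ (x ∷ s) u i with addAll-∈⁻ s (addLetter x u) i
  ... | inj₁ j = inj₁ (there j)
  ... | inj₂ j with addLetter-∈⁻ x u j
  ... | inj₁ e = inj₁ (here e)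
  ... | inj₂ k = inj₂ k

  bumps : Row n → List (Fin n) → List (Fin n)
  bumps u = mapMaybe (λ x → bump x u)

  Sorted : List (Fin n) → Set
  Sorted = AllPairs _≤_

  bumps-addLetter : ∀ x u s → All (x ≤_) s → bumps (addLetter x u) s ≡ bumps u s
  bumps-addLetter x u [] [] = refl
  bumps-addLetter x u (y ∷ s) (x≤y ∷ x≤s)
    rewrite bump-addLetter {x = x} {y = y} u x≤y | bumps-addLetter x u s x≤s = refl

  insertAll-∷ : ∀ u T s → Sorted s → insertAll (u ∷ T) s ≡ addAll u s ∷ insertAll T (bumps u s)
  insertAll-∷ u T []      _            = refl
  insertAll-∷ u T (x ∷ s) (x≤s ∷ s↗) = trans (insertAll-∷ (addLetter x u) _ s s↗) (cong (addAll (addLetter x u) s ∷_) eq)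
    where
    eq : insertAll (maybe′ (λ y → insert y T) T (bump x u)) (bumps (addLetter x u) s) ≡ insertAll T (bumps u (x ∷ s))
    eq rewrite bumps-addLetter x u s x≤s with bump x u
    ... | nothing = refl
    ... | just _  = refl

  ∈-bumps⁻ : ∀ u s {z} → z ∈ bumps u s → ∃ λ y → y ∈ s × bump y u ≡ just z
  ∈-bumps⁻ u (x ∷ s) i with bump x u in eq
  ... | nothing with ∈-bumps⁻ u s i
  ... | y , y∈ , e = y , there y∈ , e
  ∈-bumps⁻ u (x ∷ s) (here refl) | just z = x , here refl , eq
  ∈-bumps⁻ u (x ∷ s) (there i)   | just _ with ∈-bumps⁻ u s i
  ... | y , y∈ , e = y , there y∈ , e

  ∈-bumps⁺ : ∀ u s {y z} → y ∈ s → bump y u ≡ just z → z ∈ bumps u s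
  ∈-bumps⁺ u (x ∷ s) (here refl) e rewrite e = here refl
  ∈-bumps⁺ u (x ∷ s) (there i) e with bump x u
  ... | nothing = ∈-bumps⁺ u s i e
  ... | just _  = there (∈-bumps⁺ u s i e)

  bumps-sorted : ∀ u s → Sorted s → Sorted (bumps u s)
  bumps-sorted u []      _            = []
  bumps-sorted u (x ∷ s) (x≤s ∷ s↗) with bump x u in eq
  ... | nothing = bumps-sorted u s s↗
  ... | just a  = All.tabulate ge ∷ bumps-sorted u s s↗
    where
    ge : ∀ {z} → z ∈ bumps u s → a ≤ z
    ge i with ∈-bumps⁻ u s i
    ... | y , y∈ , e with bump-just x u eq | bump-just y u e
    ... | _ , _ , least | z∈ , y<z , _ = least z∈ (≤-<-trans {x} {y} (All.lookup x≤s y∈) y<z)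

  word-sorted : ∀ u → Sorted (word u)
  word-sorted u = go (increasing u)
    where
    go : ∀ {xs} → AllPairs _<_ xs → Sorted xs
    go []        = []
    go (p ∷ ps) = All.map (λ {x} → <⇒≤) p ∷ go ps

  predecessor : ∀ {a z : Fin n} xs → AllPairs _<_ (a ∷ xs) → z ∈ xs →
                ∃ λ w → w ∈ a ∷ xs × w < z × (∀ {v} → v ∈ xs → w < v → z ≤ v)
  predecessor {a} (b ∷ bs) ((a<b ∷ _) ∷ b<bs ∷ _) (here refl) =
    a , here refl , a<b , λ { (here refl) _ → ≤-refl {x = b} ; (there i) _ → <⇒≤ (All.lookup b<bs i) }
  predecessor {a} {z} (b ∷ bs) (_ ∷ b<bs ∷ bs↗) (there i) with predecessor bs (b<bs ∷ bs↗) i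
  ... | w , w∈ , w<z , least = w , there w∈ , w<z ,
        λ { (here refl) w<b → ⊥-elim (<⇒≱ w<b (ge w∈)) ; (there j) w<v → least j w<v }
    where
    ge : ∀ {w} → w ∈ b ∷ bs → b ≤ w
    ge (here refl) = ≤-refl {x = b}
    ge (there k)   = <⇒≤ (All.lookup b<bs k)

  -- The tableau condition, read from bottom to top.
  Tableau : Rows n → Set
  Tableau = Linked (flip _◁_)

  insertAll-row : ∀ p T s → Sorted s → s ⊆ word p → word p ⊆ s → Tableau (p ∷ T) → insertAll T s ≡ p ∷ T
  insertAll-row p [] [] _ _ q _ with q (here refl)
  ... | ()
  insertAll-row p [] (x ∷ s) (x≤s ∷ s↗) p⊆ ⊆p _ =
    trans (insertAll-∷ (row x [] [-]) [] s s↗) (cong₂ (λ r w → r ∷ insertAll [] w) row≡ none)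
    where
    row≡ : addAll (row x [] [-]) s ≡ p
    row≡ = row-ext f g
      where
      f : word (addAll (row x [] [-]) s) ⊆ word p
      f i with addAll-∈⁻ s (row x [] [-]) i
      ... | inj₁ j           = p⊆ (there j)
      ... | inj₂ (here refl) = p⊆ (here refl)
      g : word p ⊆ word (addAll (row x [] [-]) s)
      g i with ⊆p i
      ... | here refl = addAll-∈ʳ s (row x [] [-]) (here refl)
      ... | there j   = addAll-∈ˡ s (row x [] [-]) j
    none : bumps (row x [] [-]) s ≡ []
    none = go s x≤s
      where
      go : ∀ s → All (x ≤_) s → bumps (row x [] [-]) s ≡ []
      go []      []            = refl
      go (y ∷ s) (x≤y ∷ x≤s)
        rewrite bump-none y (row x [] [-]) (λ { (here refl) y<x → <⇒≱ y<x x≤y }) = go s x≤s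
  insertAll-row p (p′ ∷ T) s s↗ p⊆ ⊆p ((p′⊆p , lt) ∷ T↗) =
    trans (insertAll-∷ p′ T s s↗)
          (cong₂ _∷_ row≡ (insertAll-row p′ T (bumps p′ s) (bumps-sorted p′ s s↗) f g T↗))
    where
    row≡ : addAll p′ s ≡ p
    row≡ = row-ext h (λ i → addAll-∈ˡ s p′ (⊆p i))
      where
      h : word (addAll p′ s) ⊆ word p
      h i with addAll-∈⁻ s p′ i
      ... | inj₁ j = p⊆ j
      ... | inj₂ j = p′⊆p j
    f : bumps p′ s ⊆ word p′
    f i with ∈-bumps⁻ p′ s i
    ... | y , _ , e = proj₁ (bump-just y p′ e)
    g : word p′ ⊆ bumps p′ s
    g {z} i with predecessor {min p} {z} (word p′) (All.tabulate (λ j → <-≤-trans {min p} {min p′} lt (min-≤ p′ j)) ∷ increasing p′) i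
    ... | w , w∈ , w<z , least = ∈-bumps⁺ p′ s (⊆p (w∈p w∈)) (bump-next w p′ (i , w<z , least))
      where
      w∈p : w ∈ min p ∷ word p′ → w ∈ word p
      w∈p (here refl) = here refl
      w∈p (there j)   = p′⊆p j

  Normal : List (Row n) → Set
  Normal = Linked _◁_

  insertAll-normal : ∀ w T → Normal w → (∀ {u v} → w ≡ u ∷ v → Tableau (u ∷ T)) → insertAll T (read w) ≡ w ʳ++ T
  insertAll-normal [] T _ _ = refl
  insertAll-normal (u ∷ w) T nrm tab = begin
    insertAll T (word u ++ read w)            ≡⟨ foldl-++ (flip insert) T (word u) (read w) ⟩
    insertAll (insertAll T (word u)) (read w) ≡⟨ cong (λ U → insertAll U (read w))
                                                  (insertAll-row u T (word u) (word-sorted u) id id (tab refl)) ⟩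
    insertAll (u ∷ T) (read w)                ≡⟨ insertAll-normal w (u ∷ T) (Linked.tail nrm) (next nrm) ⟩
    w ʳ++ (u ∷ T)                             ∎
    where
    open ≡-Reasoning
    next : ∀ {w} → Normal (u ∷ w) → ∀ {v w′} → w ≡ v ∷ w′ → Tableau (v ∷ u ∷ T)
    next (u◁v ∷ _) refl = u◁v ∷ tab refl

  normal-form : ∀ w → Normal w → w ≡ 𝓡 (N (read w))
  normal-form w nrm = sym (begin
    reverse (N (read w))  ≡⟨ cong reverse (insertAll-normal w [] nrm (λ { refl → [-] })) ⟩
    reverse (reverse w)   ≡⟨ reverse-involutive w ⟩
    w                     ∎)
    where open ≡-Reasoning

module _ {n : ℕ} where
  infix 4 _◁?_

  _◁?_ : (u v : Row n) → Dec (u ◁ v)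
  u ◁? v = DecSubset._⊆?_ _≟_ (word u) (word v) ×-dec (min v <? min u)

Σrow : ℕ → Polygraph₂
Σrow n = record
  { Gen  = Row n
  ; Cell = [ (u , v) ∈ Row n × Row n ∣ ¬ u ◁ v ]
  ; src  = λ α → let (u , v) = value α in u ∷ v ∷ []
  ; tgt  = λ α → let (u , v) = value α in 𝓡 (N (word u ++ word v))
  }

RowCell : ℕ → Set
RowCell n = Polygraph₂.Cell (Σrow n)

module _ {n : ℕ} where
  open Order {n}

  open DecMembership {A = Fin n} _≟_ using (_∈?_)

  union : Row n → Row n → Row n
  union u v = addAll u (word v)

  data Shape (u v : Row n) : List (Row n) → Set where
    one : Shape u v (union u v ∷ [])
    two : ∀ u′ → word u′ ⊆ bumps u (word v) → bumps u (word v) ⊆ word u′ → Shape u v (u′ ∷ union u v ∷ [])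

  shape : ∀ u v → Shape u v (𝓡 (N (word u ++ word v)))
  shape u v = subst (Shape u v ∘ 𝓡) (sym N≡) (go (bumps u (word v)) refl (bumps-sorted u (word v) (word-sorted v)))
    where
    N≡ : N (word u ++ word v) ≡ union u v ∷ insertAll [] (bumps u (word v))
    N≡ = begin
      N (word u ++ word v)             ≡⟨ cong N (cong (word u ++_) (++-identityʳ (word v))) ⟨
      N (word u ++ word v ++ [])       ≡⟨ split ⟩
      insertAll (N (word u)) (word v)  ≡⟨ cong (λ T → insertAll T (word v)) (insertAll-row u [] (word u) (word-sorted u) id id [-]) ⟩
      insertAll (u ∷ []) (word v)      ≡⟨ insertAll-∷ u [] (word v) (word-sorted v) ⟩
      union u v ∷ insertAll [] (bumps u (word v)) ∎
      where
      open ≡-Reasoning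
      split : N (word u ++ word v ++ []) ≡ insertAll (N (word u)) (word v)
      split = trans (cong (λ z → N (word u ++ z)) (++-identityʳ (word v)))
                    (foldl-++ (flip insert) [] (word u) (word v))
    go : ∀ s → bumps u (word v) ≡ s → Sorted s → Shape u v (𝓡 (union u v ∷ insertAll [] s))
    go []      _ _ = one
    go (x ∷ s) e s↗ = subst (λ T → Shape u v (𝓡 (union u v ∷ T))) (sym (insertAll-row u′ [] (x ∷ s) s↗ g f [-]))
      (two u′ (λ i → subst (_ ∈_) (sym e) (f i)) (λ i → g (subst (_ ∈_) e i)))
      where
      u′ = addAll (row x [] [-]) s
      f : word u′ ⊆ x ∷ s
      f i with addAll-∈⁻ s (row x [] [-]) i
      ... | inj₁ j           = there j
      ... | inj₂ (here refl) = here refl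
      g : x ∷ s ⊆ word u′
      g (here refl) = addAll-∈ʳ s (row x [] [-]) (here refl)
      g (there i)   = addAll-∈ˡ s (row x [] [-]) i

  -- Termination.  For words of a fixed length, the vector of the numbers
  -- measure x w (x = 1, …, n) decreases lexicographically along every step.
  select : Bool → Bool → ℕ → ℕ
  select true  true  d = 0
  select true  false d = 1
  select false true  d = d
  select false false d = 0

  Low : Fin n → List (Fin n) → Set
  Low x = Any (λ y → y < x)

  low? : ∀ x (u : Row n) → Dec (Low x (word u))
  low? x u = any? (_<? x) (word u)

  weight : Fin n → Row n → ℕ → ℕ
  weight x u d = select (does (low? x u)) (does (x ∈? word u)) d

  measure : Fin n → List (Row n) → ℕ
  measure x []      = 0
  measure x (u ∷ w) = weight x u (ℕ.suc (length w)) ℕ.+ measure x w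

  find-∈ : ∀ {x} {xs : List (Fin n)} → Low x xs → ∃ λ y → y ∈ xs × y < x
  find-∈ (here p)  = _ , here refl , p
  find-∈ (there i) with find-∈ i
  ... | y , y∈ , p = y , there y∈ , p

  lose-∈ : ∀ {x y} {xs : List (Fin n)} → y ∈ xs → y < x → Low x xs
  lose-∈ (here refl) p = here p
  lose-∈ (there i)   p = there (lose-∈ i p)

  weight-cong : ∀ x u v d → (∀ {y} → y ≤ x → y ∈ word u → y ∈ word v) →
                (∀ {y} → y ≤ x → y ∈ word v → y ∈ word u) → weight x u d ≡ weight x v d
  weight-cong x u v d f g = cong₂ (λ a b → select a b d)
    (does-⇔ (mk⇔ (low f) (low g)) (low? x u) (low? x v))
    (does-⇔ (mk⇔ (f (≤-refl {x = x})) (g (≤-refl {x = x}))) (x ∈? word u) (x ∈? word v))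
    where
    low : ∀ {xs ys : List (Fin n)} → (∀ {y : Fin n} → y ≤ x → y ∈ xs → y ∈ ys) → Low x xs → Low x ys
    low h a with find-∈ a
    ... | y , y∈ , y<x = lose-∈ (h (<⇒≤ y<x) y∈) y<x

  weight-≡ : ∀ x u d {a b} → does (low? x u) ≡ a → does (x ∈? word u) ≡ b → weight x u d ≡ select a b d
  weight-≡ x u d refl refl = refl

  module Pair (u v : Row n) (u⋪v : ¬ u ◁ v) (u′ : Row n)
              (to : word u′ ⊆ bumps u (word v)) (from : bumps u (word v) ⊆ word u′) where
    v′ = union u v

    u′⊆u : word u′ ⊆ word u
    u′⊆u i with ∈-bumps⁻ u (word v) (to i)
    ... | y , _ , e = proj₁ (bump-just y u e)

    Kept : Fin n → Set
    Kept x = x ∈ word u′ × x ∈ word v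

    kept? : ∀ x → Dec (Kept x)
    kept? x = (x ∈? word u′) ×-dec (x ∈? word v)

    least : ∀ xs → AllPairs _<_ xs → All Kept xs ⊎
            (∃ λ x → x ∈ xs × ¬ Kept x × (∀ {y} → y ∈ xs → y < x → Kept y))
    least [] _ = inj₁ []
    least (x ∷ xs) (x< ∷ xs↗) with kept? x | least xs xs↗
    ... | no ¬k | _ = inj₂ (x , here refl , ¬k ,
            λ { (here refl) y<x → ⊥-elim (<-irrefl refl y<x)
              ; (there i) y<x → ⊥-elim (<⇒≱ y<x (<⇒≤ (All.lookup x< i))) })
    ... | yes k | inj₁ ks = inj₁ (k ∷ ks)
    ... | yes k | inj₂ (y , y∈ , ¬k , below) = inj₂ (y , there y∈ , ¬k ,
            λ { (here refl) _ → k ; (there i) lt → below i lt })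

    not-all : ¬ All Kept (word u)
    not-all ks with ∈-bumps⁻ u (word v) (to (proj₁ (All.lookup ks (here refl))))
    ... | y , y∈v , e = u⋪v ((λ i → proj₂ (All.lookup ks i)) ,
            ≤-<-trans {min v} {y} {min u} (min-≤ v y∈v) (proj₁ (proj₂ (bump-just y u e))))

    decrease : ∃ λ x → (∀ d → weight x u′ (ℕ.suc d) ℕ.+ weight x v′ d ℕ.< weight x u (ℕ.suc d) ℕ.+ weight x v d)
                     × (∀ y → y < x → ∀ d → weight y u′ (ℕ.suc d) ℕ.+ weight y v′ d ≡ weight y u (ℕ.suc d) ℕ.+ weight y v d)
    decrease with least (word u) (increasing u)
    ... | inj₁ ks = ⊥-elim (not-all ks)
    ... | inj₂ (x , x∈u , ¬kept , below) = x , strict , same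
      where
      x∈v′ : x ∈ word v′
      x∈v′ = addAll-∈ʳ (word v) u x∈u

      v⊆v′ : word v ⊆ word v′
      v⊆v′ = addAll-∈ˡ (word v) u

      same : ∀ y → y < x → ∀ d → weight y u′ (ℕ.suc d) ℕ.+ weight y v′ d ≡ weight y u (ℕ.suc d) ℕ.+ weight y v d
      same y y<x d = cong₂ ℕ._+_
        (weight-cong y u′ u (ℕ.suc d) (λ _ → u′⊆u) (λ z≤y i → proj₁ (below i (≤-<-trans {y = y} z≤y y<x))))
        (weight-cong y v′ v d (λ z≤y i → back z≤y (addAll-∈⁻ (word v) u i)) (λ _ → v⊆v′))
        where
        back : ∀ {z} → z ≤ y → z ∈ word v ⊎ z ∈ word u → z ∈ word v
        back _   (inj₁ i) = i
        back z≤y (inj₂ i) = proj₂ (below i (≤-<-trans {y = y} z≤y y<x))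

      low-v′ : Low x (word v) → Low x (word v′)
      low-v′ a with find-∈ a
      ... | y , y∈ , y<x = lose-∈ (v⊆v′ y∈) y<x

      low-u′ : Low x (word u′) → Low x (word u)
      low-u′ a with find-∈ a
      ... | y , y∈ , y<x = lose-∈ (u′⊆u y∈) y<x

      ¬low-v′ : ¬ Low x (word u) → ¬ Low x (word v) → ¬ Low x (word v′)
      ¬low-v′ ¬lu ¬lv a with find-∈ a
      ... | y , y∈ , y<x with addAll-∈⁻ (word v) u y∈
      ... | inj₁ i = ¬lv (lose-∈ i y<x)
      ... | inj₂ i = ¬lu (lose-∈ i y<x)

      compare : ∀ d {a b a′ b′} → weight x u (ℕ.suc d) ≡ a → weight x v d ≡ b →
                weight x u′ (ℕ.suc d) ≡ a′ → weight x v′ d ≡ b′ → a′ ℕ.+ b′ ℕ.< a ℕ.+ b →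
                weight x u′ (ℕ.suc d) ℕ.+ weight x v′ d ℕ.< weight x u (ℕ.suc d) ℕ.+ weight x v d
      compare d refl refl refl refl lt = lt

      next-to : ∀ {y} → y ∈ word v → Next y (word u) x → x ∈ word u′
      next-to y∈v nx = from (∈-bumps⁺ u (word v) y∈v (bump-next _ u nx))

      ∈rest : ∀ {y z} → z ∈ word u → y ∈ word u → y < z → z ∈ rest u
      ∈rest (here refl) y∈u y<z = ⊥-elim (<⇒≱ y<z (min-≤ u y∈u))
      ∈rest (there i)   _   _   = i

      strict : ∀ d → weight x u′ (ℕ.suc d) ℕ.+ weight x v′ d ℕ.< weight x u (ℕ.suc d) ℕ.+ weight x v d
      strict d = by-cases (low? x u) (low? x v)
        where
        by-cases : Dec (Low x (word u)) → Dec (Low x (word v)) →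
                   weight x u′ (ℕ.suc d) ℕ.+ weight x v′ d ℕ.< weight x u (ℕ.suc d) ℕ.+ weight x v d
        by-cases (yes lu) _ with find-∈ lu
        ... | y , y∈u , y<x with predecessor {z = x} (rest u) (increasing u) (∈rest x∈u y∈u y<x)
        ... | w , w∈u , w<x , after = compare d
                (weight-≡ x u _ (dec-true (low? x u) lu) (dec-true (x ∈? word u) x∈u))
                (weight-≡ x v _ (dec-true (low? x v) lv) (dec-false (x ∈? word v) x∉v))
                (weight-≡ x u′ _ (dec-true (low? x u′) (lose-∈ (proj₁ (below y∈u y<x)) y<x)) (dec-true (x ∈? word u′) x∈u′))
                (weight-≡ x v′ _ (dec-true (low? x v′) (low-v′ lv)) (dec-true (x ∈? word v′) x∈v′))
                (ℕ.s≤s ℕ.z≤n)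
          where
          lv : Low x (word v)
          lv = lose-∈ (proj₂ (below y∈u y<x)) y<x
          x∈u′ : x ∈ word u′
          x∈u′ = next-to (proj₂ (below w∈u w<x)) (x∈u , w<x ,
            λ { (here refl) w<m → ⊥-elim (<⇒≱ w<m (min-≤ u w∈u)) ; (there i) w<z → after i w<z })
          x∉v : x ∉ word v
          x∉v i = ¬kept (x∈u′ , i)
        by-cases (no ¬lu) (yes lv) with find-∈ lv
        ... | y , y∈v , y<x = compare d
                (weight-≡ x u _ (dec-false (low? x u) ¬lu) (dec-true (x ∈? word u) x∈u))
                (weight-≡ x v _ (dec-true (low? x v) lv) (dec-false (x ∈? word v) x∉v))
                (weight-≡ x u′ _ (dec-false (low? x u′) (¬lu ∘ low-u′)) (dec-true (x ∈? word u′) x∈u′))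
                (weight-≡ x v′ _ (dec-true (low? x v′) (low-v′ lv)) (dec-true (x ∈? word v′) x∈v′))
                (ℕ.+-monoʳ-< (ℕ.suc d) (ℕ.s≤s ℕ.z≤n))
          where
          x∈u′ : x ∈ word u′
          x∈u′ = next-to y∈v (x∈u , y<x , λ i _ → ℕ.≮⇒≥ λ z<x → ¬lu (lose-∈ i z<x))
          x∉v : x ∉ word v
          x∉v i = ¬kept (x∈u′ , i)
        by-cases (no ¬lu) (no ¬lv) = compare d
                (weight-≡ x u _ (dec-false (low? x u) ¬lu) (dec-true (x ∈? word u) x∈u))
                refl
                (weight-≡ x u′ _ (dec-false (low? x u′) (¬lu ∘ low-u′)) (dec-false (x ∈? word u′) x∉u′))
                (weight-≡ x v′ _ (dec-false (low? x v′) (¬low-v′ ¬lu ¬lv)) (dec-true (x ∈? word v′) x∈v′))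
                (ℕ.s≤s (ℕ.m≤m+n d _))
          where
          x∉u′ : x ∉ word u′
          x∉u′ i with ∈-bumps⁻ u (word v) (to i)
          ... | y , y∈v , e = ¬lv (lose-∈ y∈v (proj₁ (proj₂ (bump-just y u e))))

  length-cong : ∀ (a : List (Row n)) {w w′} → length w ≡ length w′ → length (a ++ w) ≡ length (a ++ w′)
  length-cong a e = trans (length-++ a) (trans (cong (length a ℕ.+_) e) (sym (length-++ a)))

  measure-++ : ∀ x a {w w′} (_∙_ : ℕ → ℕ → Set) → (∀ k {i j} → i ∙ j → (k ℕ.+ i) ∙ (k ℕ.+ j)) →
               length w ≡ length w′ → measure x w ∙ measure x w′ → measure x (a ++ w) ∙ measure x (a ++ w′)
  measure-++ x []      _∙_ mono e p = p
  measure-++ x (u ∷ a) {w} {w′} _∙_ mono e p =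
    subst (λ k → (weight x u (ℕ.suc (length (a ++ w))) ℕ.+ measure x (a ++ w)) ∙ (weight x u (ℕ.suc k) ℕ.+ measure x (a ++ w′)))
          (length-cong a e) (mono _ (measure-++ x a _∙_ mono e p))

  Lex : ∀ {m} → (Fin m → ℕ) → (Fin m → ℕ) → Set
  Lex f g = ∃ λ i → f i ℕ.< g i × (∀ j → j < i → f j ≡ g j)

  Lex-wellFounded : ∀ m → WellFounded (Lex {m})
  Lex-wellFounded ℕ.zero    f = acc λ { (() , _) }
  Lex-wellFounded (ℕ.suc m) = Subrelation.wellFounded split
    (On.wellFounded (λ f → f zero , f ∘ suc) (×-wellFounded ℕ.<-wellFounded (Lex-wellFounded m)))
    where
    split : ∀ {f g} → Lex f g → ×-Lex _≡_ ℕ._<_ Lex (f zero , f ∘ suc) (g zero , g ∘ suc)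
    split (zero  , lt , _)  = inj₁ lt
    split (suc i , lt , eq) = inj₂ (eq zero (ℕ.s≤s ℕ.z≤n) , i , lt , λ j j<i → eq (suc j) (ℕ.s≤s j<i))

  rank : List (Row n) → Fin (ℕ.suc n) → ℕ
  rank w zero    = length w
  rank w (suc x) = measure x w

  step-decreases : ∀ {w w′} → Step (Σrow n) w w′ → Lex (rank w′) (rank w)
  step-decreases (step a ((u , v) , [ u⋪v ]) b refl refl) = go (shape u v)
    where
    go : ∀ {t} → Shape u v t → Lex (rank (a ++ t ++ b)) (rank (a ++ u ∷ v ∷ b))
    go one = zero , subst₂ ℕ._<_ (sym (length-++ a)) (sym (length-++ a)) (ℕ.+-monoʳ-< (length a) (ℕ.n<1+n _)) , λ _ ()
    go (two u′ to from) with Pair.decrease u v (recompute (¬? (u ◁? v)) u⋪v) u′ to from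
    ... | x , strict , same = suc x ,
            measure-++ x a ℕ._<_ (λ k → ℕ.+-monoʳ-< k) refl (pair x ℕ._<_ ℕ.+-monoˡ-< (strict (ℕ.suc (length b)))) ,
            λ { zero _ → length-cong a {u′ ∷ union u v ∷ b} {u ∷ v ∷ b} refl
              ; (suc y) (ℕ.s≤s y<x) → measure-++ y a _≡_ (λ k → cong (k ℕ.+_)) refl
                  (pair y _≡_ (λ k → cong (ℕ._+ k)) (same y y<x (ℕ.suc (length b)))) }
      where
      pair : ∀ x (_∙_ : ℕ → ℕ → Set) → (∀ k {i j} → i ∙ j → (i ℕ.+ k) ∙ (j ℕ.+ k)) →
             let d = ℕ.suc (length b) in
             (weight x u′ (ℕ.suc d) ℕ.+ weight x (union u v) d) ∙ (weight x u (ℕ.suc d) ℕ.+ weight x v d) →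
             measure x (u′ ∷ union u v ∷ b) ∙ measure x (u ∷ v ∷ b)
      pair x _∙_ mono p = subst₂ _∙_ (ℕ.+-assoc (weight x u′ _) _ _) (ℕ.+-assoc (weight x u _) _ _) (mono (measure x b) p)

  terminating : WellFounded (flip (Step (Σrow n)))
  terminating = Subrelation.wellFounded step-decreases (On.wellFounded rank (Lex-wellFounded (ℕ.suc n)))

  leftmost : (w : List (Row n)) → Normal w ⊎ ∃ (Step (Σrow n) w)
  leftmost []           = inj₁ []
  leftmost (u ∷ [])     = inj₁ [-]
  leftmost (u ∷ v ∷ w) with u ◁? v | leftmost (v ∷ w)
  ... | no u⋪v  | _                          = inj₂ (_ , step [] ((u , v) , [ u⋪v ]) w refl refl)
  ... | yes u◁v | inj₁ nrm                   = inj₁ (u◁v ∷ nrm)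
  ... | yes _   | inj₂ (_ , step a α b e e′) = inj₂ (_ , step (u ∷ a) α b (cong (u ∷_) e) (cong (u ∷_) e′))

  normalise : ∀ w → Acc (flip (Step (Σrow n))) w → ∃ λ ŵ → Path (Σrow n) w ŵ × Normal ŵ
  normalise w (acc rs) with leftmost w
  ... | inj₁ nrm     = w , ε , nrm
  ... | inj₂ (_ , s) with normalise _ (rs s)
  ... | ŵ , p , nrm = ŵ , s ◅ p , nrm

  read-step : ∀ {w w′} → Step (Σrow n) w w′ → read w ∼ read w′
  read-step (step a ((u , v) , _) b refl refl) = subst₂ _∼_ (split (u ∷ v ∷ [])) (split uv)
    (whisker (read a) (read b) (subst (_∼ read uv) (cong (word u ++_) (sym (++-identityʳ (word v)))) (read-N (word u ++ word v))))
    where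
    uv = 𝓡 (N (word u ++ word v))
    split : ∀ s → read a ++ read s ++ read b ≡ read (a ++ s ++ b)
    split s = sym (trans (concatMap-++ word a (s ++ b)) (cong (read a ++_) (concatMap-++ word s b)))

  read-path : ∀ {w w′} → Path (Σrow n) w w′ → read w ∼ read w′
  read-path ε       = ε
  read-path (s ◅ p) = read-step s ◅◅ read-path p

  normal-target : ∀ {w ŵ} → Path (Σrow n) w ŵ → Normal ŵ → ŵ ≡ 𝓡 (N (read w))
  normal-target p nrm = trans (normal-form _ nrm) (cong 𝓡 (sym (N-invariant (read-path p) [])))

  Λ : ∀ w → ∃ λ ŵ → Path (Σrow n) w ŵ × Normal ŵ
  Λ w = normalise w (terminating w)

module _ {P : Polygraph₂} where
  open Polygraph₂ P

  -- The rewriting step β, in the empty context, occurs in the path.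
  data OccursBare (β : Cell) : ∀ {w w′} → Path P w w′ → Set where
    here  : ∀ {w w′ w″ e e′} {g : Path P w′ w″} → OccursBare β (step {P} [] β [] {w} e e′ ◅ g)
    there : ∀ {w w′ w″} {s : Step P w w′} {g : Path P w′ w″} → OccursBare β g → OccursBare β (s ◅ g)

  before : ∀ {β w w′} {p : Path P w w′} → OccursBare β p → Path P w (src β)
  before {β} (here {w} {e = e}) = subst (Path P w) (trans e (++-identityʳ (src β))) ε
  before (there {s = s} o)      = s ◅ before o

  after : ∀ {β w w′} {p : Path P w w′} → OccursBare β p → Path P (tgt β) w′
  after {β} (here {e′ = e′} {g}) = subst (λ w → Path P w _) (trans e′ (++-identityʳ (tgt β))) g
  after (there o)                = after o

  module _ (_≟_ : DecidableEquality Cell) where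

    occursBare? : ∀ β {w w′} (p : Path P w w′) → Dec (OccursBare β p)
    occursBare? β ε = no λ ()
    occursBare? β (step (_ ∷ _) _ _ _ _ ◅ g) = map′ there (λ { (there o) → o }) (occursBare? β g)
    occursBare? β (step [] _ (_ ∷ _) _ _ ◅ g) = map′ there (λ { (there o) → o }) (occursBare? β g)
    occursBare? β (step [] α [] _ _ ◅ g) with β ≟ α | occursBare? β g
    ... | yes refl | _     = yes here
    ... | no _     | yes o = yes (there o)
    ... | no β≢α   | no ¬o = no λ { here → β≢α refl ; (there o) → ¬o o }

    count : ∀ β {w w′} → Path P w w′ → ℕ
    count β p = length (filter (β ≟_) (cells (embed p)))

module _ {n : ℕ} where

  infix 4 _≟ᴿ_ _≟ᶜ_

  _≟ᴿ_ : DecidableEquality (Row n)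
  u ≟ᴿ v = map′ word-injective (cong word) (List.≡-dec Fin._≟_ (word u) (word v))

  _≟ᶜ_ : DecidableEquality (RowCell n)
  _≟ᶜ_ = Refinement._≟_ (≡-dec _≟ᴿ_ _≟ᴿ_)

  ℓ : Row n → ℕ
  ℓ u = length (word u)

  deleteFirst : (u : Row n) → 2 ℕ.≤ ℓ u → Row n
  deleteFirst (row x (y ∷ ys) xs↗) _ = row y ys (Linked.tail xs↗)
  deleteFirst (row x [] _) (ℕ.s≤s ())

  𝔠 : Row n × Row n × Row n → Set
  𝔠 (u , v , t) = ¬ u ◁ v × ¬ v ◁ t

  𝔰 : Row n × Row n × Row n → Set
  𝔰 (u , v , t) = Σ[ 2≤ℓu ∈ 2 ℕ.≤ ℓ u ] ¬ deleteFirst u 2≤ℓu ◁ v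

  𝔱¹ : Row n × Row n × Row n → Set
  𝔱¹ τ = 𝔠 τ × ¬ (𝔠 τ × 𝔰 τ)

  𝔠? : Unary.Decidable 𝔠
  𝔠? (u , v , t) = ¬? (u ◁? v) ×-dec ¬? (v ◁? t)

  𝔰? : Unary.Decidable 𝔰
  𝔰? (u , v , t) with 2 ℕ.≤? ℓ u
  ... | no 2≰ℓu  = no λ (h , _) → 2≰ℓu h
  ... | yes 2≤ℓu = map′ (2≤ℓu ,_) (λ (h , p) → subst (λ h → ¬ deleteFirst u h ◁ v) (ℕ.≤-irrelevant h 2≤ℓu) p)
                        (¬? (deleteFirst u 2≤ℓu ◁? v))

  𝔱¹? : Unary.Decidable 𝔱¹
  𝔱¹? τ = 𝔠? τ ×-dec ¬? (𝔠? τ ×-dec 𝔰? τ)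

𝔗¹ : ℕ → Set
𝔗¹ n = [ τ ∈ Row n × Row n × Row n ∣ 𝔱¹ τ ]

module _ {n : ℕ} where
  infix 4 _≟ᵀ_

  _≟ᵀ_ : DecidableEquality (𝔗¹ n)
  _≟ᵀ_ = Refinement._≟_ (≡-dec _≟ᴿ_ (≡-dec _≟ᴿ_ _≟ᴿ_))

  -- By normal-target, normalForm τ is the target of both sides of the branching.
  peak normalForm : 𝔗¹ n → List (Row n)
  peak    ((u , v , t) , _) = u ∷ v ∷ t ∷ []
  normalForm τ = 𝓡 (N (read (peak τ)))

  normalisingPath : ∀ {w w′} → Step (Σrow n) w w′ → Path (Σrow n) w (𝓡 (N (read w)))
  normalisingPath {w} {w′} s with Λ w′
  ... | ŵ , p , nrm = subst (Path (Σrow n) w) (normal-target (s ◅ p) nrm) (s ◅ p)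

  L R : (τ : 𝔗¹ n) → Path (Σrow n) (peak τ) (normalForm τ)
  L ((u , v , t) , [ c ]) = normalisingPath (step [] ((u , v) , [ proj₁ (proj₁ c) ]) (t ∷ []) refl refl)
  R ((u , v , t) , [ c ]) = normalisingPath (step (u ∷ []) ((v , t) , [ proj₂ (proj₁ c) ]) [] refl refl)

  Eligible : 𝔗¹ n → RowCell n → Set
  Eligible τ β = (OccursBare β (L τ) ⊎ OccursBare β (R τ)) × count _≟ᶜ_ β (L τ) ℕ.+ count _≟ᶜ_ β (R τ) ≡ 1

  eligible? : ∀ τ β → Dec (Eligible τ β)
  eligible? τ β = (occursBare? _≟ᶜ_ β (L τ) ⊎-dec occursBare? _≟ᶜ_ β (R τ)) ×-dec (_ ℕ.≟ 1)

  -- f⁻¹ ⋆₁ V ⋆₁ g⁻¹, where f ⋆₁ β ⋆₁ g is the side of τ containing β and V the other side.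
  rewritten : ∀ τ β → Eligible τ β → Zigzag (Σrow n) (Polygraph₂.src (Σrow n) β) (Polygraph₂.tgt (Σrow n) β)
  rewritten τ β (inj₁ o , _) = inverse (embed (before o)) ◅◅ embed (R τ) ◅◅ inverse (embed (after o))
  rewritten τ β (inj₂ o , _) = inverse (embed (before o)) ◅◅ embed (L τ) ◅◅ inverse (embed (after o))

Σrow,scoh : ℕ → Polygraph₃
Σrow,scoh n = record
  { base  = Σrow n
  ; Cell₃ = 𝔗¹ n
  ; ∂     = λ τ → sphere (embed (L τ)) (embed (R τ))
  }

record EligiblePair (n : ℕ) : Set where
  field
    triple   : 𝔗¹ n
    cell     : RowCell n
    eligible : Eligible triple cell

  S : Zigzag (Σrow n) (Polygraph₂.src (Σrow n) cell) (Polygraph₂.tgt (Σrow n) cell)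
  S = rewritten triple cell eligible

open EligiblePair public

subwords : ∀ {A : Set} → List A → List (List A)
subwords []       = [] ∷ []
subwords (x ∷ xs) = map (x ∷_) (subwords xs) ++ subwords xs

refinements : ∀ {A : Set} {P : A → Set} → Unary.Decidable P → List A → List [ x ∈ A ∣ P x ]
refinements P? = mapMaybe λ x → Maybe.map (λ p → x , [ p ]) (dec⇒maybe (P? x))

toRow : ∀ {n} → List (Fin n) → Maybe (Row n)
toRow []       = nothing
toRow (x ∷ xs) = Maybe.map (λ xs↗ → row x xs xs↗) (dec⇒maybe (linked? Fin._<?_ (x ∷ xs)))

rows : ∀ n → List (Row n)
rows n = mapMaybe toRow (subwords (allFin n))

rowCells : ∀ n → List (RowCell n)
rowCells n = refinements (λ (u , v) → ¬? (u ◁? v)) (cartesianProduct (rows n) (rows n))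

triples : ∀ n → List (𝔗¹ n)
triples n = refinements 𝔱¹? (cartesianProduct (rows n) (cartesianProduct (rows n) (rows n)))

pairOrder : ∀ n → DecTotalOrder 0ℓ 0ℓ 0ℓ
pairOrder n = StrictTotal.decTotalOrder (On.strictTotalOrder keyOrder key)
  where
  words : StrictTotalOrder 0ℓ 0ℓ 0ℓ
  words = Lex-strictTotalOrder (Fin.<-strictTotalOrder n)
  infixr 2 _⊗_
  _⊗_ = ×-strictTotalOrder
  keyOrder : StrictTotalOrder 0ℓ 0ℓ 0ℓ
  keyOrder = (ℕ.<-strictTotalOrder ⊗ ℕ.<-strictTotalOrder ⊗ words ⊗ words) ⊗ (words ⊗ words ⊗ words)
  key : EligiblePair n → StrictTotalOrder.Carrier keyOrder
  key p =
    let (p₁ , p₂)  = value (cell p)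
        (u , v , t) = value (triple p)
    in (ℓ p₁ ℕ.+ ℓ p₂ , ℓ p₁ , word p₁ , word p₂) , (word u , word v , word t)

eligiblePairs : ∀ n → List (EligiblePair n)
eligiblePairs n = Sort.sort (pairOrder n) (mapMaybe pair (cartesianProduct (triples n) (rowCells n)))
  where
  pair : 𝔗¹ n × RowCell n → Maybe (EligiblePair n)
  pair (τ , β) = Maybe.map (λ e → record { triple = τ ; cell = β ; eligible = e }) (dec⇒maybe (eligible? τ β))

-- Scans a list from left to right, keeping x iff P holds of the kept prefix and x.
greedy : ∀ {A : Set} {P : List A → A → Set} → (∀ kept x → Dec (P kept x)) → List A → List A
greedy P? = foldl (λ kept x → if does (P? kept x) then kept ∷ʳ x else kept) []

greedy-invariant : ∀ {A : Set} {P : List A → A → Set} (P? : ∀ kept x → Dec (P kept x)) (Q : List A → Set) →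
                   Q [] → (∀ kept x → P kept x → Q (kept ∷ʳ x)) → ∀ xs → Q (greedy P? xs)
greedy-invariant P? Q q[] q∷ = go [] q[]
  where
  go : ∀ kept → Q kept → ∀ xs → Q (foldl (λ kept x → if does (P? kept x) then kept ∷ʳ x else kept) kept xs)
  go kept q []       = q
  go kept q (x ∷ xs) with P? kept x
  ... | yes p = go (kept ∷ʳ x) (q∷ kept x p) xs
  ... | no _  = go kept q xs

Fresh : ∀ {n} → List (EligiblePair n) → EligiblePair n → Set
Fresh kept p = All (λ q → triple q ≢ triple p × cell q ≢ cell p) kept

fresh? : ∀ {n} kept (p : EligiblePair n) → Dec (Fresh kept p)
fresh? kept p = all? (λ q → ¬? (triple q ≟ᵀ triple p) ×-dec ¬? (cell q ≟ᶜ cell p)) kept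

-- The kept pairs (τ_β , β), in increasing order of β.
matchPairs : ∀ n → List (EligiblePair n)
matchPairs n = greedy fresh? (eligiblePairs n)

Dependency : ∀ {n} → Rel (EligiblePair n) 0ℓ
Dependency q p = cell q ∈ cells (S p)

dependency? : ∀ {n} (q p : EligiblePair n) → Dec (Dependency q p)
dependency? q p = DecMembership._∈?_ _≟ᶜ_ (cell q) (cells (S p))

module _ {A : Set} (E : Rel A 0ℓ) where

  Induced : List A → Rel A 0ℓ
  Induced vs x y = x ∈ vs × y ∈ vs × E x y

  Acyclic : List A → Set
  Acyclic vs = ∀ {x} → ¬ TransClosure (Induced vs) x x

  -- nonempty walks with interior vertices in vs
  Walk : List A → Rel A 0ℓ
  Walk []       x y = E x y
  Walk (v ∷ vs) x y = Walk vs x y ⊎ (Walk vs x v × Walk vs v y)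

  walk-edge : ∀ vs {x y} → E x y → Walk vs x y
  walk-edge []       e = e
  walk-edge (v ∷ vs) e = inj₁ (walk-edge vs e)

  walk-trans : ∀ vs {x v y} → v ∈ vs → Walk vs x v → Walk vs v y → Walk vs x y
  walk-trans (v ∷ vs) (here refl) p q = inj₂ (to p , from q)
    where
    to : ∀ {x} → Walk (v ∷ vs) x v → Walk vs x v
    to (inj₁ p)       = p
    to (inj₂ (p , _)) = p
    from : ∀ {y} → Walk (v ∷ vs) v y → Walk vs v y
    from (inj₁ p)       = p
    from (inj₂ (_ , p)) = p
  walk-trans (v ∷ vs) (there i) (inj₁ p)        (inj₁ q)        = inj₁ (walk-trans vs i p q)
  walk-trans (v ∷ vs) (there i) (inj₁ p)        (inj₂ (q , q′)) = inj₂ (walk-trans vs i p q , q′)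
  walk-trans (v ∷ vs) (there i) (inj₂ (p , p′)) (inj₁ q)        = inj₂ (p , walk-trans vs i p′ q)
  walk-trans (v ∷ vs) (there i) (inj₂ (p , _))  (inj₂ (_ , q))  = inj₂ (p , q)

  to-walk : ∀ vs {x y} → TransClosure (Induced vs) x y → Walk vs x y
  to-walk vs Plus.[ _ , _ , e ]         = walk-edge vs e
  to-walk vs ((_ , j , e) Plus.∷ p) = walk-trans vs j (walk-edge vs e) (to-walk vs p)

  from-walk : ∀ {ws} vs → (∀ {v} → v ∈ vs → v ∈ ws) → ∀ {x y} → x ∈ ws → y ∈ ws →
              Walk vs x y → TransClosure (Induced ws) x y
  from-walk []       vs⊆ i j e              = Plus.[ i , j , e ]
  from-walk (v ∷ vs) vs⊆ i j (inj₁ p)       = from-walk vs (vs⊆ ∘ there) i j p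
  from-walk (v ∷ vs) vs⊆ i j (inj₂ (p , q)) =
    from-walk vs (vs⊆ ∘ there) i (vs⊆ (here refl)) p Plus.++ from-walk vs (vs⊆ ∘ there) (vs⊆ (here refl)) j q

  start : ∀ {vs x y} → TransClosure (Induced vs) x y → x ∈ vs
  start Plus.[ i , _ , _ ]       = i
  start ((i , _ , _) Plus.∷ _) = i

  module _ (E? : ∀ x y → Dec (E x y)) where
    walk? : ∀ vs x y → Dec (Walk vs x y)
    walk? []       x y = E? x y
    walk? (v ∷ vs) x y = walk? vs x y ⊎-dec (walk? vs x v ×-dec walk? vs v y)

    acyclic? : ∀ vs → Dec (Acyclic vs)
    acyclic? vs = map′ sound complete (all? (λ v → ¬? (walk? vs v v)) vs)
      where
      sound : All (λ v → ¬ Walk vs v v) vs → Acyclic vs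
      sound h p = All.lookup h (start p) (to-walk vs p)
      complete : Acyclic vs → All (λ v → ¬ Walk vs v v) vs
      complete h = All.tabulate λ i p → h (from-walk vs id i i p)

  acyclic⇒wellFounded : ∀ vs → Acyclic vs → WellFounded (λ i j → E (lookup vs i) (lookup vs j))
  acyclic⇒wellFounded vs acyc = Plus.wellFounded⁻ E′ (spo-wellFounded isSPO)
    where
    E′ : Rel (Fin (length vs)) 0ℓ
    E′ i j = E (lookup vs i) (lookup vs j)
    embed⁺ : ∀ {i j} → TransClosure E′ i j → TransClosure (Induced vs) (lookup vs i) (lookup vs j)
    embed⁺ {i} {j} Plus.[ e ]     = Plus.[ ∈-lookup i , ∈-lookup j , e ]
    embed⁺ {i} (Plus._∷_ {y = k} e p) = (∈-lookup i , ∈-lookup k , e) Plus.∷ embed⁺ p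
    isSPO : IsStrictPartialOrder _≡_ (TransClosure E′)
    isSPO = record
      { isEquivalence = isEquivalence
      ; irrefl        = λ { refl p → acyc (embed⁺ p) }
      ; trans         = Plus._++_
      ; <-resp-≈      = (λ { refl p → p }) , (λ { refl p → p })
      }

-- The pairs (τ_β , β) for β in the acyclic selection.
acycPairs : ∀ n → List (EligiblePair n)
acycPairs n = greedy (λ kept p → acyclic? Dependency dependency? (kept ∷ʳ p)) (matchPairs n)

acycPairs-acyclic : ∀ n → Acyclic Dependency (acycPairs n)
acycPairs-acyclic n =
  greedy-invariant (λ kept p → acyclic? Dependency dependency? (kept ∷ʳ p)) (λ ps → Acyclic Dependency ps)
    (λ { Plus.[ () , _ ] ; ((() , _) Plus.∷ _) }) (λ _ _ acyc → acyc) (matchPairs n)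

𝓑ᵐᵃᵗᶜʰ 𝓑ᵃᶜʸᶜ : ∀ n → List (RowCell n)
𝓑ᵐᵃᵗᶜʰ n = map cell (matchPairs n)
𝓑ᵃᶜʸᶜ  n = map cell (acycPairs n)

-- The triples τ_β, β ∈ 𝓑ᵃᶜʸᶜ n.
τ[𝓑ᵃᶜʸᶜ] : ∀ n → List (𝔗¹ n)
τ[𝓑ᵃᶜʸᶜ] n = map triple (acycPairs n)

-- 𝒜 i is the 3-cell A_β for the i-th element β of 𝓑ᵃᶜʸᶜ n.
data NCell₃ (n : ℕ) : Set where
  𝒳 : [ τ ∈ 𝔗¹ n ∣ τ ∉ τ[𝓑ᵃᶜʸᶜ] n ] → NCell₃ n
  𝒜 : Fin (length (acycPairs n)) → NCell₃ n

Σrow,N : ℕ → Polygraph₃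
Σrow,N n = record { base = Σrow n ; Cell₃ = NCell₃ n ; ∂ = ∂ }
  where
  ∂ : NCell₃ n → Sphere (Σrow n)
  ∂ (𝒳 τ) = Polygraph₃.∂ (Σrow,scoh n) (value τ)
  ∂ (𝒜 i) = sphere (S p) (fwd (generator (cell p)) ◅ ε)
    where p = lookup (acycPairs n) i

Γ² : ∀ n → CollapsiblePart (Σrow,N n)
Γ² n = record
  { Γ           = Fin (length (acycPairs n))
  ; A           = 𝒜
  ; β           = λ i → cell (lookup (acycPairs n) i)
  ; S           = λ i → S (lookup (acycPairs n) i)
  ; ∂A          = λ _ → refl
  ; removed?    = λ α → Fin.any? (λ i → cell (lookup (acycPairs n) i) ≟ᶜ α)
  ; wellFounded = acyclic⇒wellFounded Dependency (acycPairs n) (acycPairs-acyclic n)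
  }

Σrow,red : ℕ → Polygraph₃
Σrow,red n = HomotopicalReduction.reduction (Σrow,N n) (Γ² n)

reducedBoundary : ∀ n → Sphere (Σrow n) → Sphere (Polygraph₃.base (Σrow,red n))
reducedBoundary n = HomotopicalReduction.reducedSphere (Σrow,N n) (Γ² n)

{-# OPTIONS --safe #-}
-- Call a path f : w ⇒ w′ of row cells coherent if f followed by the leftmost
-- normalisation of w′ is filled against the leftmost normalisation of w.
-- Coherence of a step a ⋅ α ⋅ b passes to larger b, and is invariant under replacing a by
-- its normal form.  For u = x ∂u the branching at u v t is compared with the one at
-- x ∂u v t: its two sides are x-whiskered leftmost paths, each step of which is a
-- branching (x , g , h), or a branching (x g , h , r) with g ◁ h.  Both kinds lie in
-- 𝔗¹, so induction on the length of u fills all critical branchings, and Squier's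
-- Noetherian induction makes Σrow,scoh coherent.
--
-- 𝒳 τ_β and A_β can be traded for one another since β occurs in an empty context in
-- the boundary of 𝒳 τ_β.  Finally a homotopical reduction preserves
-- coherence: the reduction functor ⟦_⟧ is a retraction of the inclusion of the
-- surviving cells and sends every filler to a filler.

module Submission where

open import Defs
open import Algebra.Morphism.Structures using (module MonoidMorphisms)
open import Axiom.UniquenessOfIdentityProofs.WithK using (uip)
open import Data.Bool.Base using (true; false; if_then_else_)
open import Data.Empty using (⊥; ⊥-elim; ⊥-elim-irr)
open import Data.Fin.Base as Fin using (Fin; zero; suc)
import Data.Fin.Properties as Fin
open import Data.Irrelevant using ([_])
open import Data.List.Base using (List; []; _∷_; _++_; _∷ʳ_; _∷ʳ′_; allFin; cartesianProduct; deduplicate; filter; foldl; initLast; length; lookup; map; mapMaybe)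
open import Data.List.Properties using (++-assoc; ++-identityʳ; ∷-injective; concatMap-++)
import Data.List.Membership.DecPropositional as DecMembership
open import Data.List.Membership.Propositional using (_∈_; _∉_)
open import Data.List.Membership.Propositional.Properties using (∈-lookup; ∈-map⁺; ∈-map⁻; ∈-++⁺ˡ; ∈-++⁺ʳ; ∈-filter⁺; ∈-filter⁻; ∈-allFin; ∈-cartesianProduct⁺; ∈-deduplicate⁺)
open import Data.List.Relation.Unary.All as All using (All; []; _∷_)
import Data.List.Relation.Unary.All.Properties as All
open import Data.List.Relation.Unary.AllPairs using (AllPairs; []; _∷_)
import Data.List.Relation.Unary.AllPairs.Properties as AllPairs
open import Data.List.Relation.Unary.Any as Any using (here; there)
open import Data.List.Relation.Unary.Any.Properties using (lookup-index; mapMaybe⁺)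
open import Data.List.Relation.Unary.Linked as Linked using (Linked; []; [-]; _∷_; linked?)
import Data.List.Relation.Unary.Unique.DecPropositional.Properties as Unique
open import Data.Maybe.Base as Maybe using (Maybe; just)
import Data.Maybe.Relation.Unary.Any as MAny
open import Data.Nat.Base as ℕ using (ℕ; _≤_)
import Data.Nat.Properties as ℕ
open import Data.Product.Base using (∃; Σ-syntax; _×_; _,_; proj₁; proj₂)
open import Data.Refinement using (Refinement-syntax; value; _,_)
import Data.Refinement.Properties as Refinement
open import Data.Sum.Base using (inj₁; inj₂)
open import Data.Unit.Base using (⊤; tt)
open import Function.Base using (_∘_; flip; id)
open import Function.Bundles using (_↔_; Inverse; mk↔ₛ′)
open import Function.Properties.Inverse using (↔-sym; ↔-trans)
open import Induction.WellFounded using (Acc; acc; module All)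
open import Level using (0ℓ)
open import Relation.Binary.Bundles using (Setoid)
open import Relation.Binary.Construct.Closure.Equivalence as Eq using ()
open import Relation.Binary.Construct.Closure.ReflexiveTransitive as Star using (Star; ε; _◅_; _◅◅_)
open import Relation.Binary.Construct.Closure.ReflexiveTransitive.Properties using (◅◅-assoc; gmap-◅◅)
open import Relation.Binary.Construct.Closure.Symmetric as Sym using (SymClosure; fwd; bwd)
import Relation.Binary.Construct.Closure.Transitive as Plus
open import Relation.Binary.Definitions using (DecidableEquality)
open import Relation.Binary.PropositionalEquality
import Relation.Binary.Reasoning.Setoid as SetoidReasoning
open import Relation.Nullary using (¬_; Dec; yes; no; recompute; ¬?; does)
open import Relation.Nullary.Decidable using (dec⇒maybe)
import Relation.Unary as Unary

-- Zigzags and their whiskerings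

-- A triple is left out of 𝔱¹ only if its first row u has at least two letters and ∂u is not ◁ v. In
-- (x , g , h) the first row has one letter, and in (x g , h , r) the shortened first row is g, with
-- g ◁ h; hence both are available as generators. The passage between x ∂u and u works because u is
-- the normal form of x ∂u, reached by a single leftmost step. Invariance under normalising a comes
-- from the strategy: a leftmost path finishes with a prefix before touching what follows it, so the
-- leftmost path from w ++ b begins with the one from w, and the exchange law moves steps on b past
-- it. For the same reason the Noetherian induction never has to treat a disjoint branching: behind
-- a normal prefix, a step is either leftmost itself or overlaps the leftmost reducible pair. Words
-- are associative only up to propositional equality. Whiskered zigzags therefore carry equations
-- for their endpoints, and uniqueness of identity proofs makes the choice of these equations
-- immaterial.

◅◅-identityʳ : ∀ {I : Set} {T : I → I → Set} {i j} (xs : Star T i j) → xs ◅◅ ε ≡ xs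
◅◅-identityʳ ε        = refl
◅◅-identityʳ (x ◅ xs) = cong (x ◅_) (◅◅-identityʳ xs)

module _ {P : Polygraph₂} where
  open Polygraph₂ P

  ≈-reflexive : ∀ {w w′} {f g : Zigzag P w w′} → f ≡ g → f ≈ g
  ≈-reflexive refl = ≈-refl

  zigzagSetoid : ∀ w w′ → Setoid 0ℓ 0ℓ
  zigzagSetoid w w′ = record
    { Carrier       = Zigzag P w w′
    ; _≈_           = _≈_
    ; isEquivalence = record { refl = ≈-refl ; sym = ≈-sym ; trans = ≈-trans }
    }

  module ≈-Reasoning {w w′} = SetoidReasoning (zigzagSetoid w w′)

  ◅-cong : ∀ {w x y} (k : SymClosure (Step P) w x) {f g : Zigzag P x y} → f ≈ g → k ◅ f ≈ k ◅ g
  ◅-cong k = ≈-cong (≈-refl {f = k ◅ ε})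

  ◅◅-congʳ : ∀ {w x y} (f : Zigzag P w x) {g h : Zigzag P x y} → g ≈ h → f ◅◅ g ≈ f ◅◅ h
  ◅◅-congʳ f = ≈-cong (≈-refl {f = f})

  ◅◅-congˡ : ∀ {w x y} {f g : Zigzag P w x} (h : Zigzag P x y) → f ≈ g → f ◅◅ h ≈ g ◅◅ h
  ◅◅-congˡ h p = ≈-cong p (≈-refl {f = h})

  -- Inversion is an accumulating reversal; clearing the accumulator yields the recursions
  -- `inverse-fwd` and `inverse-bwd`.
  inverse-◅◅-acc : ∀ {w x y} (f : Zigzag P w x) (g : Zigzag P w y) →
                   Star.revApp (Sym.symmetric (Step P)) f g ≡ inverse f ◅◅ g
  inverse-◅◅-acc ε       g = refl
  inverse-◅◅-acc (k ◅ f) g =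
    trans (inverse-◅◅-acc f (_ ◅ g))
          (trans (sym (◅◅-assoc (inverse f) (_ ◅ ε) g)) (cong (_◅◅ g) (sym (inverse-◅◅-acc f (_ ◅ ε)))))

  inverse-fwd : ∀ {w x y} (s : Step P w x) (f : Zigzag P x y) → inverse (fwd s ◅ f) ≡ inverse f ◅◅ (bwd s ◅ ε)
  inverse-fwd s f = inverse-◅◅-acc f (bwd s ◅ ε)

  inverse-bwd : ∀ {w x y} (s : Step P x w) (f : Zigzag P x y) → inverse (bwd s ◅ f) ≡ inverse f ◅◅ (fwd s ◅ ε)
  inverse-bwd s f = inverse-◅◅-acc f (fwd s ◅ ε)

  ◅◅-inverseʳ : ∀ {w w′} (f : Zigzag P w w′) → f ◅◅ inverse f ≈ ε
  ◅◅-inverseʳ ε = ≈-refl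
  ◅◅-inverseʳ (fwd s ◅ f) = begin
    fwd s ◅ (f ◅◅ inverse (fwd s ◅ f))      ≡⟨ cong (λ z → fwd s ◅ (f ◅◅ z)) (inverse-fwd s f) ⟩
    fwd s ◅ (f ◅◅ inverse f ◅◅ bwd s ◅ ε)   ≡⟨ cong (fwd s ◅_) (◅◅-assoc f (inverse f) _) ⟨
    fwd s ◅ ((f ◅◅ inverse f) ◅◅ bwd s ◅ ε) ≈⟨ ◅-cong (fwd s) (◅◅-congˡ (bwd s ◅ ε) (◅◅-inverseʳ f)) ⟩
    fwd s ◅ bwd s ◅ ε                       ≈⟨ inverseʳ s ⟩
    ε                                       ∎
    where open ≈-Reasoning
  ◅◅-inverseʳ (bwd s ◅ f) = begin
    bwd s ◅ (f ◅◅ inverse (bwd s ◅ f))      ≡⟨ cong (λ z → bwd s ◅ (f ◅◅ z)) (inverse-bwd s f) ⟩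
    bwd s ◅ (f ◅◅ inverse f ◅◅ fwd s ◅ ε)   ≡⟨ cong (bwd s ◅_) (◅◅-assoc f (inverse f) _) ⟨
    bwd s ◅ ((f ◅◅ inverse f) ◅◅ fwd s ◅ ε) ≈⟨ ◅-cong (bwd s) (◅◅-congˡ (fwd s ◅ ε) (◅◅-inverseʳ f)) ⟩
    bwd s ◅ fwd s ◅ ε                       ≈⟨ inverseˡ s ⟩
    ε                                       ∎
    where open ≈-Reasoning

  ◅◅-inverseˡ : ∀ {w w′} (f : Zigzag P w w′) → inverse f ◅◅ f ≈ ε
  ◅◅-inverseˡ ε = ≈-refl
  ◅◅-inverseˡ (fwd s ◅ f) = begin
    inverse (fwd s ◅ f) ◅◅ (fwd s ◅ f)          ≡⟨ cong (_◅◅ (fwd s ◅ f)) (inverse-fwd s f) ⟩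
    (inverse f ◅◅ bwd s ◅ ε) ◅◅ (fwd s ◅ f)     ≡⟨ ◅◅-assoc (inverse f) _ _ ⟩
    inverse f ◅◅ ((bwd s ◅ fwd s ◅ ε) ◅◅ f)     ≈⟨ ◅◅-congʳ (inverse f) (◅◅-congˡ f (inverseˡ s)) ⟩
    inverse f ◅◅ f                              ≈⟨ ◅◅-inverseˡ f ⟩
    ε                                           ∎
    where open ≈-Reasoning
  ◅◅-inverseˡ (bwd s ◅ f) = begin
    inverse (bwd s ◅ f) ◅◅ (bwd s ◅ f)          ≡⟨ cong (_◅◅ (bwd s ◅ f)) (inverse-bwd s f) ⟩
    (inverse f ◅◅ fwd s ◅ ε) ◅◅ (bwd s ◅ f)     ≡⟨ ◅◅-assoc (inverse f) _ _ ⟩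
    inverse f ◅◅ ((fwd s ◅ bwd s ◅ ε) ◅◅ f)     ≈⟨ ◅◅-congʳ (inverse f) (◅◅-congˡ f (inverseʳ s)) ⟩
    inverse f ◅◅ f                              ≈⟨ ◅◅-inverseˡ f ⟩
    ε                                           ∎
    where open ≈-Reasoning

  cancelˡ : ∀ {w x y} (f : Zigzag P w x) (g : Zigzag P x y) → inverse f ◅◅ f ◅◅ g ≈ g
  cancelˡ f g = ≈-trans (≈-reflexive (sym (◅◅-assoc (inverse f) f g))) (◅◅-congˡ g (◅◅-inverseˡ f))

  cancelʳ : ∀ {w x y} (f : Zigzag P w x) (g : Zigzag P x y) → (f ◅◅ g) ◅◅ inverse g ≈ f
  cancelʳ f g = ≈-trans (≈-reflexive (◅◅-assoc f g (inverse g)))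
                  (≈-trans (◅◅-congʳ f (◅◅-inverseʳ g)) (≈-reflexive (◅◅-identityʳ f)))

  step-irrelevant : ∀ {w w′ a a′ α b b′} {e : w ≡ a ++ src α ++ b} {e′ : w′ ≡ a ++ tgt α ++ b}
           {d : w ≡ a′ ++ src α ++ b′} {d′ : w′ ≡ a′ ++ tgt α ++ b′} →
           a ≡ a′ → b ≡ b′ → step {P} a α b e e′ ≡ step a′ α b′ d d′
  step-irrelevant {e = e} {e′} {d} {d′} refl refl = cong₂ (step _ _ _) (uip e d) (uip e′ d′)

  -- whisker a b f, with its endpoints given by equations so that whiskerings along
  -- different bracketings of a word can be composed.
  whiskerAt : ∀ a b {x y w w′} → w ≡ a ++ x ++ b → w′ ≡ a ++ y ++ b → Zigzag P x y → Zigzag P w w′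
  whiskerAt a b refl refl f = whisker a b f

  whiskerAt-irrelevant : ∀ a b {x y w w′} (d e : w ≡ a ++ x ++ b) (d′ e′ : w′ ≡ a ++ y ++ b) (f : Zigzag P x y) →
                         whiskerAt a b d d′ f ≡ whiskerAt a b e e′ f
  whiskerAt-irrelevant a b d e d′ e′ f = cong₂ (λ p q → whiskerAt a b p q f) (uip d e) (uip d′ e′)

  whiskerAt-◅◅ : ∀ a b {x m y w v w′} (e : w ≡ a ++ x ++ b) (e₀ : v ≡ a ++ m ++ b) (e′ : w′ ≡ a ++ y ++ b)
                 (f : Zigzag P x m) (g : Zigzag P m y) →
                 whiskerAt a b e e′ (f ◅◅ g) ≡ whiskerAt a b e e₀ f ◅◅ whiskerAt a b e₀ e′ g
  whiskerAt-◅◅ a b refl refl refl f g = gmap-◅◅ _ _ f g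

  -- The contexts `a′` and `b′` are given up to equality, so that the resulting step can be
  -- bracketed as its user requires.
  whiskerAt-step : ∀ a b x α y {u u′ w w′} (p : u ≡ x ++ src α ++ y) (p′ : u′ ≡ x ++ tgt α ++ y)
                   (e : w ≡ a ++ u ++ b) (e′ : w′ ≡ a ++ u′ ++ b) {a′ b′} → a′ ≡ a ++ x → b′ ≡ y ++ b →
                   (d : w ≡ a′ ++ src α ++ b′) (d′ : w′ ≡ a′ ++ tgt α ++ b′) →
                   whiskerAt a b e e′ (fwd (step x α y p p′) ◅ ε) ≡ fwd (step a′ α b′ d d′) ◅ ε
  whiskerAt-step a b x α y refl refl refl refl refl refl d d′ = cong (λ s → fwd s ◅ ε) (step-irrelevant refl refl)

  whiskerAt-inverse : ∀ a b {x y w w′} (e : w ≡ a ++ x ++ b) (e′ : w′ ≡ a ++ y ++ b) (f : Zigzag P x y) →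
                      whiskerAt a b e′ e (inverse f) ≡ inverse (whiskerAt a b e e′ f)
  whiskerAt-inverse a b refl refl f = go f
    where
    go : ∀ {x y} (f : Zigzag P x y) → whisker a b (inverse f) ≡ inverse (whisker a b f)
    go ε = refl
    go (fwd s ◅ f) = begin
      whisker a b (inverse (fwd s ◅ f))                        ≡⟨ cong (whisker a b) (inverse-fwd s f) ⟩
      whisker a b (inverse f ◅◅ bwd s ◅ ε)                     ≡⟨ gmap-◅◅ _ _ (inverse f) _ ⟩
      whisker a b (inverse f) ◅◅ bwd (whiskerStep a b s) ◅ ε   ≡⟨ cong (_◅◅ _) (go f) ⟩
      inverse (whisker a b f) ◅◅ bwd (whiskerStep a b s) ◅ ε   ≡⟨ inverse-fwd (whiskerStep a b s) (whisker a b f) ⟨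
      inverse (whisker a b (fwd s ◅ f))                        ∎
      where open ≡-Reasoning
    go (bwd s ◅ f) = begin
      whisker a b (inverse (bwd s ◅ f))                        ≡⟨ cong (whisker a b) (inverse-bwd s f) ⟩
      whisker a b (inverse f ◅◅ fwd s ◅ ε)                     ≡⟨ gmap-◅◅ _ _ (inverse f) _ ⟩
      whisker a b (inverse f) ◅◅ fwd (whiskerStep a b s) ◅ ε   ≡⟨ cong (_◅◅ _) (go f) ⟩
      inverse (whisker a b f) ◅◅ fwd (whiskerStep a b s) ◅ ε   ≡⟨ inverse-bwd (whiskerStep a b s) (whisker a b f) ⟨
      inverse (whisker a b (bwd s ◅ f))                        ∎
      where open ≡-Reasoning

  whiskerAt-ε : ∀ a b x {w} (e e′ : w ≡ a ++ x ++ b) → whiskerAt a b e e′ ε ≡ ε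
  whiskerAt-ε a b x refl refl = refl

  whiskerAt-whiskerAt : ∀ a b x y {s s′ u u′ w w′} (p : u ≡ x ++ s ++ y) (p′ : u′ ≡ x ++ s′ ++ y)
                        (e : w ≡ a ++ u ++ b) (e′ : w′ ≡ a ++ u′ ++ b)
                        (d : w ≡ (a ++ x) ++ s ++ (y ++ b)) (d′ : w′ ≡ (a ++ x) ++ s′ ++ (y ++ b)) (f : Zigzag P s s′) →
                        whiskerAt a b e e′ (whiskerAt x y p p′ f) ≡ whiskerAt (a ++ x) (y ++ b) d d′ f
  whiskerAt-whiskerAt a b x y {s} refl refl refl refl d d′ ε = sym (whiskerAt-ε (a ++ x) (y ++ b) s d d′)
  whiskerAt-whiskerAt a b x y {s} refl refl refl refl d d′ (_◅_ {j = m} k f) = begin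
    whisker a b (whisker x y (k ◅ ε)) ◅◅ whisker a b (whisker x y f)
      ≡⟨ cong₂ _◅◅_ (single k d d₀) (whiskerAt-whiskerAt a b x y refl refl refl refl d₀ d′ f) ⟩
    whiskerAt (a ++ x) (y ++ b) d d₀ (k ◅ ε) ◅◅ whiskerAt (a ++ x) (y ++ b) d₀ d′ f
      ≡⟨ whiskerAt-◅◅ (a ++ x) (y ++ b) d d₀ d′ (k ◅ ε) f ⟨
    whiskerAt (a ++ x) (y ++ b) d d′ (k ◅ f) ∎
    where
    open ≡-Reasoning
    d₀ = whisker-≡ {P} a b x m y
    single-fwd : ∀ {s m} (h : Step P s m) (d : a ++ (x ++ s ++ y) ++ b ≡ (a ++ x) ++ s ++ (y ++ b)) d₀ →
                 whisker a b (whisker x y (fwd h ◅ ε)) ≡ whiskerAt (a ++ x) (y ++ b) d d₀ (fwd h ◅ ε)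
    single-fwd (step p α q refl refl) d d₀ =
      trans (whiskerAt-step a b (x ++ p) α (q ++ y) _ _ refl refl refl refl e e′)
            (sym (whiskerAt-step (a ++ x) (y ++ b) p α q refl refl d d₀ (sym (++-assoc a x p)) (++-assoc q y b) e e′))
      where
      e = trans (cong (λ z → a ++ z ++ b) (whisker-≡ {P} x y p (src α) q)) (whisker-≡ {P} a b (x ++ p) (src α) (q ++ y))
      e′ = trans (cong (λ z → a ++ z ++ b) (whisker-≡ {P} x y p (tgt α) q)) (whisker-≡ {P} a b (x ++ p) (tgt α) (q ++ y))
    single : ∀ {s m} (k : SymClosure (Step P) s m) (d : a ++ (x ++ s ++ y) ++ b ≡ (a ++ x) ++ s ++ (y ++ b)) d₀ →
             whisker a b (whisker x y (k ◅ ε)) ≡ whiskerAt (a ++ x) (y ++ b) d d₀ (k ◅ ε)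
    single (fwd h) d d₀ = single-fwd h d d₀
    single (bwd h) d d₀ = begin
      inverse (whisker a b (whisker x y (fwd h ◅ ε)))          ≡⟨ cong inverse (single-fwd h d₀ d) ⟩
      inverse (whiskerAt (a ++ x) (y ++ b) d₀ d (fwd h ◅ ε))   ≡⟨ whiskerAt-inverse (a ++ x) (y ++ b) d₀ d (fwd h ◅ ε) ⟨
      whiskerAt (a ++ x) (y ++ b) d d₀ (bwd h ◅ ε)             ∎

  whiskerAt-identity : ∀ {x y} (e : x ≡ x ++ []) (e′ : y ≡ y ++ []) (f : Zigzag P x y) → whiskerAt [] [] e e′ f ≡ f
  whiskerAt-identity {x} e e′ ε = whiskerAt-ε [] [] x e e′
  whiskerAt-identity {x} e e′ (_◅_ {j = m} k f) =
    trans (whiskerAt-◅◅ [] [] e e₀ e′ (k ◅ ε) f) (cong₂ _◅◅_ (single k) (whiskerAt-identity e₀ e′ f))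
    where
    e₀ = sym (++-identityʳ m)
    single : (k : SymClosure (Step P) x m) → whiskerAt [] [] e e₀ (k ◅ ε) ≡ k ◅ ε
    single (fwd (step a α b p q)) = whiskerAt-step [] [] a α b p q e e₀ refl (sym (++-identityʳ b)) p q
    single (bwd (step a α b p q)) = trans (whiskerAt-inverse [] [] e₀ e (fwd (step a α b p q) ◅ ε))
      (cong inverse (whiskerAt-step [] [] a α b p q e₀ e refl (sym (++-identityʳ b)) p q))

-- The exchange law for zigzags

module _ {P : Polygraph₂} where
  open Polygraph₂ P

  -- Here `l` and `l′` are the left contexts of `g` before and after `f`, and `r` and `r′` the right
  -- contexts of `f` before and after `g`. Every corner of the square is a variable with its
  -- equations, so squares can be pasted and inverted without transports.
  Interchange : ∀ {s s′ t t′} → Zigzag P s s′ → Zigzag P t t′ → Set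
  Interchange {s} {s′} {t} {t′} f g =
    ∀ a b c {l l′ r r′ w x y w′} → l ≡ a ++ s ++ b → l′ ≡ a ++ s′ ++ b → r ≡ b ++ t ++ c → r′ ≡ b ++ t′ ++ c →
    (e₁ : w ≡ a ++ s ++ r) (e₂ : x ≡ a ++ s′ ++ r) (e₃ : x ≡ l′ ++ t ++ c) (e₄ : w′ ≡ l′ ++ t′ ++ c)
    (e₅ : w ≡ l ++ t ++ c) (e₆ : y ≡ l ++ t′ ++ c) (e₇ : y ≡ a ++ s ++ r′) (e₈ : w′ ≡ a ++ s′ ++ r′) →
    whiskerAt a r e₁ e₂ f ◅◅ whiskerAt l′ c e₃ e₄ g ≈ whiskerAt l c e₅ e₆ g ◅◅ whiskerAt a r′ e₇ e₈ f

  assoc₃ : ∀ (a x b y : Word) → a ++ x ++ b ++ y ≡ (a ++ x ++ b) ++ y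
  assoc₃ a x b y = sym (trans (++-assoc a (x ++ b) y) (cong (a ++_) (++-assoc x b y)))

  interchange-εˡ : ∀ {s t t′} (g : Zigzag P t t′) → Interchange (ε {x = s}) g
  interchange-εˡ {s} g a b c refl refl refl refl refl refl e₃ e₄ e₅ e₆ refl refl = begin
    whiskerAt (a ++ s ++ b) c e₃ e₄ g        ≡⟨ whiskerAt-irrelevant (a ++ s ++ b) c e₃ e₅ e₄ e₆ g ⟩
    whiskerAt (a ++ s ++ b) c e₅ e₆ g        ≡⟨ ◅◅-identityʳ _ ⟨
    whiskerAt (a ++ s ++ b) c e₅ e₆ g ◅◅ ε   ∎
    where open ≈-Reasoning

  interchange-εʳ : ∀ {s s′ t} (f : Zigzag P s s′) → Interchange f (ε {x = t})
  interchange-εʳ f a b c {r = r} refl refl refl refl e₁ e₂ refl refl refl refl e₇ e₈ = begin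
    whiskerAt a r e₁ e₂ f ◅◅ ε   ≡⟨ ◅◅-identityʳ _ ⟩
    whiskerAt a r e₁ e₂ f        ≡⟨ whiskerAt-irrelevant a r e₁ e₇ e₂ e₈ f ⟩
    whiskerAt a r e₇ e₈ f        ∎
    where open ≈-Reasoning

  interchange-◅◅ˡ : ∀ {s m s′ t t′} (f : Zigzag P s m) (f′ : Zigzag P m s′) (g : Zigzag P t t′) →
                    Interchange f g → Interchange f′ g → Interchange (f ◅◅ f′) g
  interchange-◅◅ˡ {m = m} {t = t} {t′} f f′ g p q a b c {l} {l′} {r} {r′} e-l e-l′ e-r e-r′ e₁ e₂ e₃ e₄ e₅ e₆ e₇ e₈ = begin
    whiskerAt a r e₁ e₂ (f ◅◅ f′) ◅◅ G′   ≡⟨ cong (_◅◅ G′) (whiskerAt-◅◅ a r e₁ refl e₂ f f′) ⟩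
    (F₀ ◅◅ F₁) ◅◅ G′                      ≡⟨ ◅◅-assoc F₀ F₁ G′ ⟩
    F₀ ◅◅ F₁ ◅◅ G′                        ≈⟨ ◅◅-congʳ F₀ (q a b c refl e-l′ e-r e-r′ refl e₂ e₃ e₄ e₀ refl e₀′ e₈) ⟩
    F₀ ◅◅ G₀ ◅◅ F′                        ≡⟨ ◅◅-assoc F₀ G₀ F′ ⟨
    (F₀ ◅◅ G₀) ◅◅ F′                      ≈⟨ ◅◅-congˡ F′ (p a b c e-l refl e-r e-r′ e₁ refl e₀ refl e₅ e₆ e₇ e₀′) ⟩
    (G ◅◅ F₀′) ◅◅ F′                      ≡⟨ ◅◅-assoc G F₀′ F′ ⟩
    G ◅◅ F₀′ ◅◅ F′                        ≡⟨ cong (G ◅◅_) (whiskerAt-◅◅ a r′ e₇ e₀′ e₈ f f′) ⟨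
    G ◅◅ whiskerAt a r′ e₇ e₈ (f ◅◅ f′)   ∎
    where
    open ≈-Reasoning
    e₀ : a ++ m ++ r ≡ (a ++ m ++ b) ++ t ++ c
    e₀ = trans (cong (λ z → a ++ m ++ z) e-r) (assoc₃ a m b (t ++ c))
    e₀′ : (a ++ m ++ b) ++ t′ ++ c ≡ a ++ m ++ r′
    e₀′ = sym (trans (cong (λ z → a ++ m ++ z) e-r′) (assoc₃ a m b (t′ ++ c)))
    F₀  = whiskerAt a r e₁ refl f
    F₁  = whiskerAt a r refl e₂ f′
    F₀′ = whiskerAt a r′ e₇ e₀′ f
    F′  = whiskerAt a r′ e₀′ e₈ f′
    G   = whiskerAt l c e₅ e₆ g
    G₀  = whiskerAt (a ++ m ++ b) c e₀ refl g
    G′  = whiskerAt l′ c e₃ e₄ g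

  interchange-◅◅ʳ : ∀ {s s′ t m t′} (f : Zigzag P s s′) (g : Zigzag P t m) (g′ : Zigzag P m t′) →
                    Interchange f g → Interchange f g′ → Interchange f (g ◅◅ g′)
  interchange-◅◅ʳ {s} {s′} {m = m} f g g′ p q a b c {l} {l′} {r} {r′} e-l e-l′ e-r e-r′ e₁ e₂ e₃ e₄ e₅ e₆ e₇ e₈ = begin
    F ◅◅ whiskerAt l′ c e₃ e₄ (g ◅◅ g′)   ≡⟨ cong (F ◅◅_) (whiskerAt-◅◅ l′ c e₃ refl e₄ g g′) ⟩
    F ◅◅ G₀′ ◅◅ G₁′                       ≡⟨ ◅◅-assoc F G₀′ G₁′ ⟨
    (F ◅◅ G₀′) ◅◅ G₁′                     ≈⟨ ◅◅-congˡ G₁′ (p a b c e-l e-l′ e-r refl e₁ e₂ e₃ refl e₅ refl e₀ e₀′) ⟩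
    (G₀ ◅◅ F₀) ◅◅ G₁′                     ≡⟨ ◅◅-assoc G₀ F₀ G₁′ ⟩
    G₀ ◅◅ F₀ ◅◅ G₁′                       ≈⟨ ◅◅-congʳ G₀ (q a b c e-l e-l′ refl e-r′ e₀ e₀′ refl e₄ refl e₆ e₇ e₈) ⟩
    G₀ ◅◅ G₁ ◅◅ F′                        ≡⟨ ◅◅-assoc G₀ G₁ F′ ⟨
    (G₀ ◅◅ G₁) ◅◅ F′                      ≡⟨ cong (_◅◅ F′) (whiskerAt-◅◅ l c e₅ refl e₆ g g′) ⟨
    whiskerAt l c e₅ e₆ (g ◅◅ g′) ◅◅ F′   ∎
    where
    open ≈-Reasoning
    e₀ : l ++ m ++ c ≡ a ++ s ++ b ++ m ++ c
    e₀ = trans (cong (_++ m ++ c) e-l) (sym (assoc₃ a s b (m ++ c)))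
    e₀′ : l′ ++ m ++ c ≡ a ++ s′ ++ b ++ m ++ c
    e₀′ = trans (cong (_++ m ++ c) e-l′) (sym (assoc₃ a s′ b (m ++ c)))
    F   = whiskerAt a r e₁ e₂ f
    F₀  = whiskerAt a (b ++ m ++ c) e₀ e₀′ f
    F′  = whiskerAt a r′ e₇ e₈ f
    G₀  = whiskerAt l c e₅ refl g
    G₁  = whiskerAt l c refl e₆ g′
    G₀′ = whiskerAt l′ c e₃ refl g
    G₁′ = whiskerAt l′ c refl e₄ g′

  -- The square for `f` is conjugated: `inverse F` is put in front, `inverse F′` behind, and the
  -- outer pairs cancel.
  interchange-inverseˡ : ∀ {s s′ t t′} (f : Zigzag P s s′) (g : Zigzag P t t′) → Interchange f g → Interchange (inverse f) g
  interchange-inverseˡ f g p a b c {l} {l′} {r} {r′} e-l e-l′ e-r e-r′ e₁ e₂ e₃ e₄ e₅ e₆ e₇ e₈ = begin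
    whiskerAt a r e₁ e₂ (inverse f) ◅◅ G′   ≡⟨ cong (_◅◅ G′) (whiskerAt-inverse a r e₂ e₁ f) ⟩
    inverse F ◅◅ G′                         ≈⟨ ◅◅-congʳ (inverse F) (cancelʳ G′ F′) ⟨
    inverse F ◅◅ (G′ ◅◅ F′) ◅◅ inverse F′   ≈⟨ ◅◅-congʳ (inverse F) (◅◅-congˡ (inverse F′) (p a b c e-l′ e-l e-r e-r′ e₂ e₁ e₅ e₆ e₃ e₄ e₈ e₇)) ⟨
    inverse F ◅◅ (F ◅◅ G) ◅◅ inverse F′     ≡⟨ cong (inverse F ◅◅_) (◅◅-assoc F G (inverse F′)) ⟩
    inverse F ◅◅ F ◅◅ G ◅◅ inverse F′       ≈⟨ cancelˡ F _ ⟩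
    G ◅◅ inverse F′                         ≡⟨ cong (G ◅◅_) (whiskerAt-inverse a r′ e₈ e₇ f) ⟨
    G ◅◅ whiskerAt a r′ e₇ e₈ (inverse f)   ∎
    where
    open ≈-Reasoning
    F  = whiskerAt a r e₂ e₁ f
    F′ = whiskerAt a r′ e₈ e₇ f
    G  = whiskerAt l c e₅ e₆ g
    G′ = whiskerAt l′ c e₃ e₄ g

  interchange-inverseʳ : ∀ {s s′ t t′} (f : Zigzag P s s′) (g : Zigzag P t t′) → Interchange f g → Interchange f (inverse g)
  interchange-inverseʳ f g p a b c {l} {l′} {r} {r′} e-l e-l′ e-r e-r′ e₁ e₂ e₃ e₄ e₅ e₆ e₇ e₈ = begin
    F ◅◅ whiskerAt l′ c e₃ e₄ (inverse g)   ≡⟨ cong (F ◅◅_) (whiskerAt-inverse l′ c e₄ e₃ g) ⟩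
    F ◅◅ inverse G′                         ≈⟨ cancelˡ G _ ⟨
    inverse G ◅◅ G ◅◅ F ◅◅ inverse G′       ≡⟨ cong (inverse G ◅◅_) (◅◅-assoc G F (inverse G′)) ⟨
    inverse G ◅◅ (G ◅◅ F) ◅◅ inverse G′     ≈⟨ ◅◅-congʳ (inverse G) (◅◅-congˡ (inverse G′) (p a b c e-l e-l′ e-r′ e-r e₇ e₈ e₄ e₃ e₆ e₅ e₁ e₂)) ⟨
    inverse G ◅◅ (F′ ◅◅ G′) ◅◅ inverse G′   ≈⟨ ◅◅-congʳ (inverse G) (cancelʳ F′ G′) ⟩
    inverse G ◅◅ F′                         ≡⟨ cong (_◅◅ F′) (whiskerAt-inverse l c e₆ e₅ g) ⟨
    whiskerAt l c e₅ e₆ (inverse g) ◅◅ F′   ∎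
    where
    open ≈-Reasoning
    F  = whiskerAt a r e₁ e₂ f
    F′ = whiskerAt a r′ e₇ e₈ f
    G  = whiskerAt l c e₆ e₅ g
    G′ = whiskerAt l′ c e₄ e₃ g

  interchange-step : ∀ {s s′ t t′} (k : Step P s s′) (h : Step P t t′) → Interchange (fwd k ◅ ε) (fwd h ◅ ε)
  interchange-step (step x α y refl refl) (step z β v refl refl) a b c {l} {l′} refl refl refl refl e₁ e₂ e₃ e₄ e₅ e₆ e₇ e₈ = begin
    whiskerAt a _ e₁ e₂ k ◅◅ whiskerAt l′ c e₃ e₄ h
      ≡⟨ cong₂ _◅◅_ (whiskerAt-step a _ x α y refl refl e₁ e₂ refl (r-eq (src β)) (e₁ ⟫ wide (src α) (src β)) (e₂ ⟫ wide (tgt α) (src β)))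
                    (whiskerAt-step l′ c z β v refl refl e₃ e₄ (l-eq (tgt α)) refl (e₂ ⟫ nested (tgt α) (src β)) (e₈ ⟫ nested (tgt α) (tgt β))) ⟩
    _ ≈⟨ exchange (a ++ x) α (y ++ b ++ z) β (v ++ c)
           (e₁ ⟫ wide (src α) (src β)) (e₂ ⟫ wide (tgt α) (src β)) (e₂ ⟫ nested (tgt α) (src β)) (e₈ ⟫ nested (tgt α) (tgt β))
           (e₁ ⟫ nested (src α) (src β)) (e₇ ⟫ nested (src α) (tgt β)) (e₇ ⟫ wide (src α) (tgt β)) (e₈ ⟫ wide (tgt α) (tgt β)) ⟩
    _ ≡⟨ cong₂ _◅◅_ (whiskerAt-step l c z β v refl refl e₅ e₆ (l-eq (src α)) refl (e₁ ⟫ nested (src α) (src β)) (e₇ ⟫ nested (src α) (tgt β)))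
                    (whiskerAt-step a _ x α y refl refl e₇ e₈ refl (r-eq (tgt β)) (e₇ ⟫ wide (src α) (tgt β)) (e₈ ⟫ wide (tgt α) (tgt β))) ⟨
    whiskerAt l c e₅ e₆ h ◅◅ whiskerAt a _ e₇ e₈ k ∎
    where
    open ≈-Reasoning
    infixr 4 _⟫_
    _⟫_ : {u v w : Word} → u ≡ v → v ≡ w → u ≡ w
    _⟫_ = trans
    k = fwd (step x α y refl refl) ◅ ε
    h = fwd (step z β v refl refl) ◅ ε
    r-eq : ∀ q → (y ++ b ++ z) ++ q ++ v ++ c ≡ y ++ b ++ (z ++ q ++ v) ++ c
    r-eq q = ++-assoc y (b ++ z) _ ⟫ cong (y ++_) (++-assoc b z _ ⟫ cong (b ++_) (assoc₃ z q v c))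
    l-eq : ∀ p → (a ++ x) ++ p ++ y ++ b ++ z ≡ (a ++ (x ++ p ++ y) ++ b) ++ z
    l-eq p = ++-assoc a x _ ⟫ cong (a ++_) (assoc₃ x p y (b ++ z)) ⟫ assoc₃ a (x ++ p ++ y) b z
    -- The same word in the two forms that `exchange` asks for: `wide` isolates the factor rewritten
    -- by `α`, with the other one in its right context, and `nested` isolates the factor rewritten
    -- by `β`.
    wide : ∀ p q → a ++ (x ++ p ++ y) ++ b ++ (z ++ q ++ v) ++ c ≡ (a ++ x) ++ p ++ (y ++ b ++ z) ++ q ++ v ++ c
    wide p q = whisker-≡ {P} a _ x p y ⟫ cong (λ r → (a ++ x) ++ p ++ r) (sym (r-eq q))
    nested : ∀ p q → a ++ (x ++ p ++ y) ++ b ++ (z ++ q ++ v) ++ c ≡ ((a ++ x) ++ p ++ y ++ b ++ z) ++ q ++ v ++ c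
    nested p q = wide p q ⟫ assoc₃ (a ++ x) p (y ++ b ++ z) (q ++ v ++ c)

  -- The exchange relation between two steps extends to zigzags since it is stable
  -- under composition and inversion on each side.
  interchange : ∀ {s s′ t t′} (f : Zigzag P s s′) (g : Zigzag P t t′) → Interchange f g
  interchange ε           g = interchange-εˡ g
  interchange (k ◅ f) g = interchange-◅◅ˡ (k ◅ ε) f g (atom k g) (interchange f g)
    where
    atoms : ∀ {s s′ t t′} (k : SymClosure (Step P) s s′) (h : SymClosure (Step P) t t′) → Interchange (k ◅ ε) (h ◅ ε)
    atoms (fwd k) (fwd h) = interchange-step k h
    atoms (bwd k) (fwd h) = interchange-inverseˡ (fwd k ◅ ε) (fwd h ◅ ε) (interchange-step k h)
    atoms (fwd k) (bwd h) = interchange-inverseʳ (fwd k ◅ ε) (fwd h ◅ ε) (interchange-step k h)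
    atoms (bwd k) (bwd h) = interchange-inverseʳ (bwd k ◅ ε) (fwd h ◅ ε) (atoms (bwd k) (fwd h))
    atom : ∀ {s s′ t t′} (k : SymClosure (Step P) s s′) (g : Zigzag P t t′) → Interchange (k ◅ ε) g
    atom k ε       = interchange-εʳ (k ◅ ε)
    atom k (h ◅ g) = interchange-◅◅ʳ (k ◅ ε) (h ◅ ε) g (atoms k h) (atom k g)

-- Homotopical reduction

module Reduction (P : Polygraph₃) (C : CollapsiblePart P) where
  open Polygraph₃ P
  open CollapsiblePart C renaming (S to σ)
  open HomotopicalReduction P C

  Dependent : Γ → Γ → Set
  Dependent j i = β j ∈ cells (σ i)

  extend-cong : ∀ {w w′} (z : Zigzag base w w′) {φ ψ} → (∀ α i → φ α i ≡ ψ α i) → extend z φ ≡ extend z ψ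
  extend-cong ε p = refl
  extend-cong (fwd (step a α b refl refl) ◅ z) p =
    cong₂ _◅◅_ (cong (whisker a b) (p α (here refl))) (extend-cong z (λ α → p α ∘ there))
  extend-cong (bwd (step a α b refl refl) ◅ z) p =
    cong₂ _◅◅_ (cong (λ f → inverse (whisker a b f)) (p α (here refl))) (extend-cong z (λ α → p α ∘ there))

  Assignment : ∀ {w w′} → Zigzag base w w′ → Set
  Assignment z = ∀ α → α ∈ cells z → Zigzag reducedBase (src α) (tgt α)

  -- The assignments of reduce and of onCollapsed are local to their definitions;
  -- here they are recovered by unification.
  reduce-extend : ∀ {w w′} (z : Zigzag base w w′) → Σ[ φ ∈ Assignment z ] reduce z ≡ extend z φ
  reduce-extend z = _ , refl

  onCollapsed-extend : ∀ i (rs : ∀ {j} → Dependent j i → Acc Dependent j) → Σ[ φ ∈ Assignment (σ i) ] onCollapsed i (acc rs) ≡ extend (σ i) φ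
  onCollapsed-extend i rs = _ , refl

  -- The assignment of the reduction functor as a function of the cell alone, with `wellFounded j`
  -- as the fixed accessibility proof.
  image : ∀ α → Zigzag reducedBase (src α) (tgt α)
  image α with removed? α
  ... | yes (j , refl) = onCollapsed j (wellFounded j)
  ... | no ¬removed    = fwd (generator (α , [ ¬removed ])) ◅ ε

  -- The recursion passes on subproofs of accessibility, whereas `image` always starts from
  -- `wellFounded`; a simultaneous induction on both proofs shows that the values agree.
  onCollapsed-irrelevant : ∀ i (p q : Acc Dependent i) → onCollapsed i p ≡ onCollapsed i q
  onCollapsed-irrelevant i (acc rs) (acc rs′) = extend-cong (σ i) onCell
    where
    onCell : ∀ α α∈S → proj₁ (onCollapsed-extend i rs) α α∈S ≡ proj₁ (onCollapsed-extend i rs′) α α∈S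
    onCell α α∈S with removed? α
    ... | yes (j , refl) = onCollapsed-irrelevant j (rs α∈S) (rs′ α∈S)
    ... | no _           = refl

  -- `reduce` in a form that computes without matching on the endpoint equations, which `whiskerAt`
  -- absorbs.
  ⟦_⟧ : ∀ {w w′} → Zigzag base w w′ → Zigzag reducedBase w w′
  ⟦ ε ⟧                           = ε
  ⟦ fwd (step a α b e e′) ◅ z ⟧ = whiskerAt a b e e′ (image α) ◅◅ ⟦ z ⟧
  ⟦ bwd (step a α b e e′) ◅ z ⟧ = inverse (whiskerAt a b e e′ (image α)) ◅◅ ⟦ z ⟧

  extend-image : ∀ {w w′} (z : Zigzag base w w′) → extend z (λ α _ → image α) ≡ ⟦ z ⟧
  extend-image ε                                 = refl
  extend-image (fwd (step a α b refl refl) ◅ z) = cong (_ ◅◅_) (extend-image z)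
  extend-image (bwd (step a α b refl refl) ◅ z) = cong (_ ◅◅_) (extend-image z)

  reduce-⟦⟧ : ∀ {w w′} (z : Zigzag base w w′) → reduce z ≡ ⟦ z ⟧
  reduce-⟦⟧ z = trans (extend-cong z onCell) (extend-image z)
    where
    onCell : ∀ α α∈z → proj₁ (reduce-extend z) α α∈z ≡ image α
    onCell α _ with removed? α
    ... | yes (j , refl) = refl
    ... | no _           = refl

  onCollapsed-⟦⟧ : ∀ i p → onCollapsed i p ≡ ⟦ σ i ⟧
  onCollapsed-⟦⟧ i (acc rs) = trans (extend-cong (σ i) onCell) (extend-image (σ i))
    where
    onCell : ∀ α α∈S → proj₁ (onCollapsed-extend i rs) α α∈S ≡ image α
    onCell α α∈S with removed? α
    ... | yes (j , refl) = onCollapsed-irrelevant j (rs α∈S) (wellFounded j)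
    ... | no _           = refl

  ⟦⟧-◅◅ : ∀ {w x y} (f : Zigzag base w x) (g : Zigzag base x y) → ⟦ f ◅◅ g ⟧ ≡ ⟦ f ⟧ ◅◅ ⟦ g ⟧
  ⟦⟧-◅◅ ε                        g = refl
  ⟦⟧-◅◅ (fwd (step a α b e e′) ◅ f) g =
    trans (cong (whiskerAt a b e e′ (image α) ◅◅_) (⟦⟧-◅◅ f g)) (sym (◅◅-assoc (whiskerAt a b e e′ (image α)) _ _))
  ⟦⟧-◅◅ (bwd (step a α b e e′) ◅ f) g =
    trans (cong (inverse (whiskerAt a b e e′ (image α)) ◅◅_) (⟦⟧-◅◅ f g)) (sym (◅◅-assoc (inverse (whiskerAt a b e e′ (image α))) _ _))

  ⟦⟧-whisker : ∀ a b {w w′} (f : Zigzag base w w′) → ⟦ whisker a b f ⟧ ≡ whisker a b ⟦ f ⟧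
  ⟦⟧-whisker a b ε = refl
  ⟦⟧-whisker a b (fwd (step x α y refl refl) ◅ f) = trans
    (cong₂ _◅◅_ (sym (whiskerAt-whiskerAt a b x y refl refl refl refl (whisker-≡ {base} a b x (src α) y) (whisker-≡ {base} a b x (tgt α) y) (image α))) (⟦⟧-whisker a b f))
    (sym (gmap-◅◅ _ _ (whisker x y (image α)) ⟦ f ⟧))
  ⟦⟧-whisker a b (bwd (step x α y refl refl) ◅ f) = trans
    (cong₂ _◅◅_ (trans (cong inverse (sym (whiskerAt-whiskerAt a b x y refl refl refl refl (whisker-≡ {base} a b x (src α) y) (whisker-≡ {base} a b x (tgt α) y) (image α))))
                       (sym (whiskerAt-inverse a b refl refl (whisker x y (image α)))))
                (⟦⟧-whisker a b f))
    (sym (gmap-◅◅ _ _ (inverse (whisker x y (image α))) ⟦ f ⟧))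

  -- A generator may be sent to a long zigzag, so the defining relations of 2-cells must be
  -- available for arbitrary zigzags: inverse laws become cancellation, and `exchange` becomes
  -- `interchange`.
  ⟦⟧-≈ : ∀ {w w′} {f g : Zigzag base w w′} → f ≈ g → ⟦ f ⟧ ≈ ⟦ g ⟧
  ⟦⟧-≈ ≈-refl        = ≈-refl
  ⟦⟧-≈ (≈-sym p)     = ≈-sym (⟦⟧-≈ p)
  ⟦⟧-≈ (≈-trans p q) = ≈-trans (⟦⟧-≈ p) (⟦⟧-≈ q)
  ⟦⟧-≈ (≈-cong {f = f} {f′} {g} {g′} p q) =
    ≈-trans (≈-reflexive (⟦⟧-◅◅ f g)) (≈-trans (≈-cong (⟦⟧-≈ p) (⟦⟧-≈ q)) (≈-reflexive (sym (⟦⟧-◅◅ f′ g′))))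
  ⟦⟧-≈ (inverseʳ (step a α b e e′)) = begin
    F ◅◅ inverse F ◅◅ ε   ≡⟨ cong (F ◅◅_) (◅◅-identityʳ (inverse F)) ⟩
    F ◅◅ inverse F        ≈⟨ ◅◅-inverseʳ F ⟩
    ε                     ∎
    where
    open ≈-Reasoning
    F = whiskerAt a b e e′ (image α)
  ⟦⟧-≈ (inverseˡ (step a α b e e′)) = cancelˡ (whiskerAt a b e e′ (image α)) ε
  ⟦⟧-≈ (exchange a α b γ c e₁ e₂ e₃ e₄ e₅ e₆ e₇ e₈) = begin
    whiskerAt a (b ++ src γ ++ c) e₁ e₂ (image α) ◅◅ whiskerAt (a ++ tgt α ++ b) c e₃ e₄ (image γ) ◅◅ ε
      ≡⟨ cong (whiskerAt a (b ++ src γ ++ c) e₁ e₂ (image α) ◅◅_) (◅◅-identityʳ _) ⟩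
    whiskerAt a (b ++ src γ ++ c) e₁ e₂ (image α) ◅◅ whiskerAt (a ++ tgt α ++ b) c e₃ e₄ (image γ)
      ≈⟨ interchange (image α) (image γ) a b c refl refl refl refl e₁ e₂ e₃ e₄ e₅ e₆ e₇ e₈ ⟩
    whiskerAt (a ++ src α ++ b) c e₅ e₆ (image γ) ◅◅ whiskerAt a (b ++ tgt γ ++ c) e₇ e₈ (image α)
      ≡⟨ cong (whiskerAt (a ++ src α ++ b) c e₅ e₆ (image γ) ◅◅_) (◅◅-identityʳ _) ⟨
    whiskerAt (a ++ src α ++ b) c e₅ e₆ (image γ) ◅◅ whiskerAt a (b ++ tgt γ ++ c) e₇ e₈ (image α) ◅◅ ε ∎
    where open ≈-Reasoning

  includeStep : ∀ {w w′} → Step reducedBase w w′ → Step base w w′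
  includeStep (step a α b e e′) = step a (value α) b e e′

  include : ∀ {w w′} → Zigzag reducedBase w w′ → Zigzag base w w′
  include = Eq.gmap id includeStep

  image-surviving : ∀ (α : Polygraph₂.Cell reducedBase) → image (value α) ≡ fwd (generator α) ◅ ε
  image-surviving (α , [ ¬removed ]) with removed? α
  ... | yes r = ⊥-elim-irr (¬removed r)
  ... | no _  = refl

  ⟦include⟧ : ∀ {w w′} (f : Zigzag reducedBase w w′) → ⟦ include f ⟧ ≡ f
  ⟦include⟧ ε = refl
  ⟦include⟧ (fwd (step a α b e e′) ◅ f) = cong₂ _◅◅_ (begin
    whiskerAt a b e e′ (image (value α))         ≡⟨ cong (whiskerAt a b e e′) (image-surviving α) ⟩
    whiskerAt a b e e′ (fwd (generator α) ◅ ε)   ≡⟨ whiskerAt-step a b [] α [] _ _ e e′ (sym (++-identityʳ a)) refl e e′ ⟩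
    fwd (step a α b e e′) ◅ ε                    ∎) (⟦include⟧ f)
    where
    open ≡-Reasoning
  ⟦include⟧ (bwd (step a α b e e′) ◅ f) = cong₂ _◅◅_ (begin
    inverse (whiskerAt a b e e′ (image (value α)))         ≡⟨ cong (inverse ∘ whiskerAt a b e e′) (image-surviving α) ⟩
    inverse (whiskerAt a b e e′ (fwd (generator α) ◅ ε))   ≡⟨ cong inverse (whiskerAt-step a b [] α [] _ _ e e′ (sym (++-identityʳ a)) refl e e′) ⟩
    bwd (step a α b e e′) ◅ ε                              ∎) (⟦include⟧ f)
    where
    open ≡-Reasoning

  -- Both polygraphs identify the same words: `include` turns a reduced zigzag into a zigzag and
  -- `⟦_⟧` goes back. The same isomorphism therefore serves.
  reduction-presents : ∀ {M} → Presents base M → Presents reducedBase M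
  reduction-presents (f , iso) = f , record
    { isMonoidMonomorphism = record
      { isMonoidHomomorphism = record
        { isMagmaHomomorphism = record
          { isRelHomomorphism = record { cong = iso-cong ∘ include }
          ; homo              = homo
          }
        ; ε-homo = ε-homo
        }
      ; injective = ⟦_⟧ ∘ injective
      }
    ; surjective = λ y → proj₁ (surjective y) , λ z≈x → proj₂ (surjective y) (include z≈x)
    }
    where open MonoidMorphisms.IsMonoidIsomorphism iso renaming (⟦⟧-cong to iso-cong)


  reduction-coherent : (∀ {i j} → β i ≡ β j → i ≡ j) → (∀ B → Dec (∃ λ i → A i ≡ B)) →
                       ∀ {M} → IsCoherentPresentation P M → IsCoherentPresentation reduction M
  reduction-coherent β-injective collapsed? {M} coh = record
    { presents = reduction-presents {M} presents
    ; fills    = λ f g → subst₂ (_⇛_ reduction) (⟦include⟧ f) (⟦include⟧ g) (map₃ (fills (include f) (include g)))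
    }
    where
    open IsCoherentPresentation coh

    -- `removed?` may answer with any index whose cell is `β i`; injectivity of `β` forces that
    -- index to be `i`.
    image-collapsed : ∀ i → image (β i) ≡ ⟦ σ i ⟧
    image-collapsed i with removed? (β i)
    ... | no ¬removed = ⊥-elim (¬removed (i , refl))
    ... | yes (j , e) with β-injective e
    image-collapsed i | yes (.i , refl) | refl = onCollapsed-⟦⟧ i (wellFounded i)

    ⟦generator⟧ : ∀ α → ⟦ fwd (generator α) ◅ ε ⟧ ≡ image α
    ⟦generator⟧ α = trans (◅◅-identityʳ _) (whiskerAt-identity (sym (++-identityʳ (src α))) (sym (++-identityʳ (tgt α))) (image α))

    -- Both ends of a removed 3-cell `A i` are sent to `⟦ σ i ⟧`, so an identity fills its image.
    collapsed : ∀ i {s : Sphere base} → s ≡ sphere (σ i) (fwd (generator (β i)) ◅ ε) →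
                _⇛_ reduction ⟦ Sphere.source s ⟧ ⟦ Sphere.target s ⟧
    collapsed i refl = ident (≈-reflexive (sym (trans (⟦generator⟧ (β i)) (image-collapsed i))))

    map₃ : ∀ {w w′} {f g : Zigzag base w w′} → _⇛_ P f g → _⇛_ reduction ⟦ f ⟧ ⟦ g ⟧
    map₃ (gen B) with collapsed? B
    ... | yes (i , refl)  = collapsed i (∂A i)
    ... | no ¬collapsed = subst₂ (_⇛_ reduction) (reduce-⟦⟧ (Sphere.source (∂ B))) (reduce-⟦⟧ (Sphere.target (∂ B))) (gen (B , [ ¬collapsed ]))
    map₃ (ident p)       = ident (⟦⟧-≈ p)
    map₃ (inv A)         = inv (map₃ A)
    map₃ (A ⋆₂ B)        = map₃ A ⋆₂ map₃ B
    map₃ (_⋆₁_ {f = f} {f′} {g} {g′} A B) = subst₂ (_⇛_ reduction) (sym (⟦⟧-◅◅ f g)) (sym (⟦⟧-◅◅ f′ g′)) (map₃ A ⋆₁ map₃ B)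
    map₃ (whisk a b {f = f} {g} A) = subst₂ (_⇛_ reduction) (sym (⟦⟧-whisker a b f)) (sym (⟦⟧-whisker a b g)) (whisk a b (map₃ A))

-- Whiskering on one side

module _ {P : Polygraph₂} where
  open Polygraph₂ P

  -- Whiskering with `whisker a []` would leave a trailing `++ []` in both endpoints; this form
  -- avoids it.
  leftStep : ∀ a {w w′} → Step P w w′ → Step P (a ++ w) (a ++ w′)
  leftStep a (step x α y e e′) =
    step (a ++ x) α y (trans (cong (a ++_) e) (sym (++-assoc a x _))) (trans (cong (a ++_) e′) (sym (++-assoc a x _)))

  left : ∀ a {w w′} → Zigzag P w w′ → Zigzag P (a ++ w) (a ++ w′)
  left a = Eq.gmap (a ++_) (leftStep a)

  leftPath : ∀ a {w w′} → Path P w w′ → Path P (a ++ w) (a ++ w′)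
  leftPath a = Star.gmap (a ++_) (leftStep a)

  rightPath : ∀ b {w w′} → Path P w w′ → Path P (w ++ b) (w′ ++ b)
  rightPath b = Star.gmap (_++ b) (whiskerStep [] b)

  embed-◅◅ : ∀ {x y z} (p : Path P x y) (q : Path P y z) → embed (p ◅◅ q) ≡ embed p ◅◅ embed q
  embed-◅◅ = gmap-◅◅ _ _

  embed-leftPath : ∀ a {w w′} (p : Path P w w′) → embed (leftPath a p) ≡ left a (embed p)
  embed-leftPath a ε       = refl
  embed-leftPath a (s ◅ p) = cong (_ ◅_) (embed-leftPath a p)

  embed-rightPath : ∀ b {w w′} (p : Path P w w′) → embed (rightPath b p) ≡ whisker [] b (embed p)
  embed-rightPath b ε       = refl
  embed-rightPath b (s ◅ p) = cong (_ ◅_) (embed-rightPath b p)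

  left-whiskerAt : ∀ a {x y} (e : a ++ x ≡ a ++ x ++ []) (e′ : a ++ y ≡ a ++ y ++ []) (f : Zigzag P x y) →
                   left a f ≡ whiskerAt a [] e e′ f
  left-whiskerAt a {x} e e′ ε = sym (whiskerAt-ε a [] x e e′)
  left-whiskerAt a {x} e e′ (_◅_ {j = m} k f) =
    trans (cong₂ _◅◅_ (single k) (left-whiskerAt a e₀ e′ f)) (sym (whiskerAt-◅◅ a [] e e₀ e′ (k ◅ ε) f))
    where
    e₀ = cong (a ++_) (sym (++-identityʳ m))
    single-fwd : ∀ {x m} (s : Step P x m) (e : a ++ x ≡ a ++ x ++ []) (e₀ : a ++ m ≡ a ++ m ++ []) →
                 left a (fwd s ◅ ε) ≡ whiskerAt a [] e e₀ (fwd s ◅ ε)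
    single-fwd (step z α y p q) e e₀ = sym (whiskerAt-step a [] z α y p q e e₀ refl (sym (++-identityʳ y)) _ _)
    single : (k : SymClosure (Step P) x m) → left a (k ◅ ε) ≡ whiskerAt a [] e e₀ (k ◅ ε)
    single (fwd s) = single-fwd s e e₀
    single (bwd s) = trans (cong inverse (single-fwd s e₀ e)) (sym (whiskerAt-inverse a [] e₀ e (fwd s ◅ ε)))

  left-right : ∀ {w w′ x x′} (f : Zigzag P w w′) (g : Zigzag P x x′) →
               left w g ◅◅ whisker [] x′ f ≈ whisker [] x f ◅◅ left w′ g
  left-right {w} {w′} {x} {x′} f g = begin
    left w g ◅◅ whisker [] x′ f
      ≡⟨ cong (_◅◅ _) (left-whiskerAt w (e w x) (e w x′) g) ⟩
    whiskerAt w [] (e w x) (e w x′) g ◅◅ whisker [] x′ f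
      ≈⟨ interchange f g [] [] [] (sym (++-identityʳ w)) (sym (++-identityʳ w′)) (sym (++-identityʳ x)) (sym (++-identityʳ x′))
           refl refl (e w′ x) (e w′ x′) (e w x) (e w x′) refl refl ⟨
    whisker [] x f ◅◅ whiskerAt w′ [] (e w′ x) (e w′ x′) g
      ≡⟨ cong (_ ◅◅_) (left-whiskerAt w′ (e w′ x) (e w′ x′) g) ⟨
    whisker [] x f ◅◅ left w′ g ∎
    where
    open ≈-Reasoning
    e : ∀ (u v : Word) → u ++ v ≡ u ++ v ++ []
    e u v = cong (u ++_) (sym (++-identityʳ v))

-- Calculating with fillers

module _ {P : Polygraph₃} where
  open Polygraph₃ P

  infix 4 _≋_
  _≋_ : ∀ {w w′} → Zigzag base w w′ → Zigzag base w w′ → Set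
  _≋_ = _⇛_ P

  ≋-reflexive : ∀ {w w′} {f g : Zigzag base w w′} → f ≡ g → f ≋ g
  ≋-reflexive e = ident (≈-reflexive e)

  ⇛-setoid : ∀ w w′ → Setoid 0ℓ 0ℓ
  ⇛-setoid w w′ = record
    { Carrier       = Zigzag base w w′
    ; _≈_           = _≋_
    ; isEquivalence = record { refl = ident ≈-refl ; sym = inv ; trans = _⋆₂_ }
    }

  module ⇛-Reasoning {w w′} = SetoidReasoning (⇛-setoid w w′)

  ◅◅-congʳ-⇛ : ∀ {w x y} (f : Zigzag base w x) {g h : Zigzag base x y} → g ≋ h → f ◅◅ g ≋ f ◅◅ h
  ◅◅-congʳ-⇛ f A = ident (≈-refl {f = f}) ⋆₁ A

  ◅◅-congˡ-⇛ : ∀ {w x y} {f g : Zigzag base w x} (h : Zigzag base x y) → f ≋ g → f ◅◅ h ≋ g ◅◅ h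
  ◅◅-congˡ-⇛ h A = A ⋆₁ ident (≈-refl {f = h})

  ◅◅-cancelˡ-⇛ : ∀ {w x y} (f : Zigzag base w x) {g h : Zigzag base x y} → f ◅◅ g ≋ f ◅◅ h → g ≋ h
  ◅◅-cancelˡ-⇛ f {g} {h} A = begin
    g                      ≈⟨ ident (cancelˡ f g) ⟨
    inverse f ◅◅ f ◅◅ g    ≈⟨ ◅◅-congʳ-⇛ (inverse f) A ⟩
    inverse f ◅◅ f ◅◅ h    ≈⟨ ident (cancelˡ f h) ⟩
    h                      ∎
    where open ⇛-Reasoning

  ◅◅-cancelʳ-⇛ : ∀ {w x y} {f g : Zigzag base w x} (h : Zigzag base x y) → f ◅◅ h ≋ g ◅◅ h → f ≋ g
  ◅◅-cancelʳ-⇛ {f = f} {g} h A = begin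
    f                       ≈⟨ ident (cancelʳ f h) ⟨
    (f ◅◅ h) ◅◅ inverse h   ≈⟨ ◅◅-congˡ-⇛ (inverse h) A ⟩
    (g ◅◅ h) ◅◅ inverse h   ≈⟨ ident (cancelʳ g h) ⟩
    g                       ∎
    where open ⇛-Reasoning

  left-⇛ : ∀ a {w w′} {f g : Zigzag base w w′} → f ≋ g → left a f ≋ left a g
  left-⇛ a {w} {w′} {f} {g} A =
    subst₂ _≋_ (sym (left-whiskerAt a e e′ f)) (sym (left-whiskerAt a e e′ g)) (whiskerAt-⇛ e e′)
    where
    e = cong (a ++_) (sym (++-identityʳ w))
    e′ = cong (a ++_) (sym (++-identityʳ w′))
    whiskerAt-⇛ : ∀ {x y} (p : x ≡ a ++ w ++ []) (q : y ≡ a ++ w′ ++ []) → whiskerAt a [] p q f ≋ whiskerAt a [] p q g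
    whiskerAt-⇛ refl refl = whisk a [] A

-- Leftmost paths in the row polygraph

module _ {n : ℕ} where
  open Polygraph₂ (Σrow n)

  irreducible : ∀ (α : Cell) → ¬ proj₁ (value α) ◁ proj₂ (value α)
  irreducible ((u , v) , [ u⋪v ]) = recompute (¬? (u ◁? v)) u⋪v

  -- Normality of `a` followed by the first row of the redex says that no reducible pair starts
  -- further left. The condition ignores the right context.
  LeftmostStep : ∀ {w w′} → Step (Σrow n) w w′ → Set
  LeftmostStep (step a α _ _ _) = Normal (a ∷ʳ proj₁ (value α))

  data Leftmost : ∀ {w ŵ} → Path (Σrow n) w ŵ → Set where
    ε   : ∀ {w} → Normal w → Leftmost {w} ε
    _◅_ : ∀ {w w′ ŵ} {s : Step (Σrow n) w w′} {p : Path (Σrow n) w′ ŵ} → LeftmostStep s → Leftmost p → Leftmost (s ◅ p)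

  normal-irreducible : ∀ (a : Word) {u v b} → Normal (a ++ u ∷ v ∷ b) → u ◁ v
  normal-irreducible []          (u◁v ∷ _) = u◁v
  normal-irreducible (_ ∷ [])    (_ ∷ nrm) = normal-irreducible [] nrm
  normal-irreducible (_ ∷ x ∷ a) (_ ∷ nrm) = normal-irreducible (x ∷ a) nrm

  leftmost-step-unique : ∀ (a a′ : Word) {u v b u′ v′ b′} → a ++ u ∷ v ∷ b ≡ a′ ++ u′ ∷ v′ ∷ b′ →
                         ¬ u ◁ v → ¬ u′ ◁ v′ → Normal (a ∷ʳ u) → Normal (a′ ∷ʳ u′) →
                         a ≡ a′ × (u , v) ≡ (u′ , v′) × b ≡ b′
  leftmost-step-unique []      []           refl _   _    _ _           = refl , refl , refl
  leftmost-step-unique []      (_ ∷ [])     refl u⋪v _    _ (u◁v ∷ _)   = ⊥-elim (u⋪v u◁v)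
  leftmost-step-unique []      (_ ∷ _ ∷ _)  refl u⋪v _    _ (u◁v ∷ _)   = ⊥-elim (u⋪v u◁v)
  leftmost-step-unique (_ ∷ []) []          refl _   u⋪v (u◁v ∷ _) _    = ⊥-elim (u⋪v u◁v)
  leftmost-step-unique (_ ∷ _ ∷ _) []       refl _   u⋪v (u◁v ∷ _) _    = ⊥-elim (u⋪v u◁v)
  leftmost-step-unique (x ∷ a) (y ∷ a′) e p q nrm nrm′ with ∷-injective e
  ... | refl , e′ with leftmost-step-unique a a′ e′ p q (Linked.tail nrm) (Linked.tail nrm′)
  ... | refl , es = refl , es

  -- Steps are compared together with their targets, because the targets of two steps out of `w` are
  -- different variables until the steps are known to agree.
  step-ext : ∀ {w w′ w″ a a′ α α′ b b′ e e′ d d′} → a ≡ a′ × value α ≡ value α′ × b ≡ b′ →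
             _≡_ {A = ∃ (Step (Σrow n) w)} (w′ , step a α b e e′) (w″ , step a′ α′ b′ d d′)
  step-ext {e′ = refl} {d′ = refl} (refl , refl , refl) = cong (_ ,_) (step-irrelevant refl refl)

  leftmost-unique : ∀ {w ŵ} {p q : Path (Σrow n) w ŵ} → Leftmost p → Leftmost q → p ≡ q
  leftmost-unique-◅ : ∀ {w ŵ} {x y : ∃ (Step (Σrow n) w)} {p : Path (Σrow n) (proj₁ x) ŵ} {q : Path (Σrow n) (proj₁ y) ŵ} →
                      x ≡ y → Leftmost p → Leftmost q → _≡_ {A = Path (Σrow n) w ŵ} (proj₂ x ◅ p) (proj₂ y ◅ q)
  leftmost-unique (ε _) (ε _) = refl
  leftmost-unique (ε nrm) (_◅_ {s = step a α _ refl _} _ _) = ⊥-elim (irreducible α (normal-irreducible a nrm))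
  leftmost-unique (_◅_ {s = step a α _ refl _} _ _) (ε nrm) = ⊥-elim (irreducible α (normal-irreducible a nrm))
  leftmost-unique (_◅_ {s = step a α b e e′} l P) (_◅_ {s = step a₁ α₁ b₁ d d′} l₁ Q) =
    leftmost-unique-◅ (step-ext (leftmost-step-unique a a₁ (trans (sym e) d) (irreducible α) (irreducible α₁) l l₁)) P Q
  leftmost-unique-◅ refl P Q = cong (_ ◅_) (leftmost-unique P Q)

  leftmost-normal : ∀ {w ŵ} {p : Path (Σrow n) w ŵ} → Leftmost p → Normal ŵ
  leftmost-normal (ε nrm)  = nrm
  leftmost-normal (_ ◅ P)  = leftmost-normal P

  nf : Word → Word
  nf w = 𝓡 (N (read w))

  nf-path : ∀ {w w′} → Path (Σrow n) w w′ → nf w ≡ nf w′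
  nf-path p = cong 𝓡 (N-invariant (read-path p) [])

  leftmost-target : ∀ {w ŵ} {p : Path (Σrow n) w ŵ} → Leftmost p → ŵ ≡ nf w
  leftmost-target {p = p} P = normal-target p (leftmost-normal P)

  leftmost-isLeftmost : ∀ w {w′} {s : Step (Σrow n) w w′} → leftmost w ≡ inj₂ (w′ , s) → LeftmostStep s
  leftmost-isLeftmost (u ∷ v ∷ w) eq with u ◁? v | leftmost (v ∷ w) in eq′
  leftmost-isLeftmost (u ∷ v ∷ w) refl | no _  | _ = [-]
  leftmost-isLeftmost (u ∷ v ∷ w) refl | yes u◁v | inj₂ (_ , step [] α b refl e′) = u◁v ∷ [-]
  leftmost-isLeftmost (u ∷ v ∷ w) refl | yes u◁v | inj₂ (_ , step (_ ∷ a) α b refl e′) = u◁v ∷ leftmost-isLeftmost (v ∷ w) eq′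

  normalise-leftmost : ∀ w (a : Acc (flip (Step (Σrow n))) w) → Leftmost (proj₁ (proj₂ (normalise w a)))
  normalise-leftmost w (acc rs) with leftmost w in eq
  ... | inj₁ nrm      = ε nrm
  ... | inj₂ (w′ , s) = leftmost-isLeftmost w eq ◅ normalise-leftmost w′ (rs s)

  Λ-leftmost : ∀ w → Leftmost (proj₁ (proj₂ (Λ w)))
  Λ-leftmost w = normalise-leftmost w (terminating w)

  -- The target is a variable equal to `nf w`, so that leftmost paths from different words can be
  -- given a common target.
  leftmostPath : ∀ w {ŵ} → ŵ ≡ nf w → Σ[ p ∈ Path (Σrow n) w ŵ ] Leftmost p
  leftmostPath w refl with Λ w | Λ-leftmost w
  ... | ŵ , p , nrm | P with leftmost-target P
  ... | refl = p , P

  -- Appending letters on the right keeps a step leftmost, so the strategy normalises a prefix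
  -- first. All factorisations of leftmost paths below rest on this.
  leftmost-right : ∀ {w ŵ b z} {p : Path (Σrow n) w ŵ} {q : Path (Σrow n) (ŵ ++ b) z} →
                   Leftmost p → Leftmost q → Leftmost (rightPath b p ◅◅ q)
  leftmost-right (ε _) Q = Q
  leftmost-right (_◅_ {s = step _ _ _ refl refl} l P) Q = l ◅ leftmost-right P Q

  -- Leftmost paths are unique, so quantifying over all of them amounts to choosing one, and spares
  -- transports along equalities of targets.
  Coherent : ∀ {w w′} → Path (Σrow n) w w′ → Set
  Coherent {w} {w′} p = ∀ {ŵ} (q : Path (Σrow n) w′ ŵ) (r : Path (Σrow n) w ŵ) → Leftmost q → Leftmost r →
                        _≋_ {Σrow,scoh n} (embed p ◅◅ embed q) (embed r)

  coherent-ε : ∀ {w} → Coherent (ε {x = w})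
  coherent-ε q r Q R = ≋-reflexive (cong embed (leftmost-unique Q R))

  coherent-◅◅ : ∀ {w x y} (p : Path (Σrow n) w x) (p′ : Path (Σrow n) x y) → Coherent p → Coherent p′ → Coherent (p ◅◅ p′)
  coherent-◅◅ {x = x} p p′ A B q r Q R with leftmostPath x (trans (leftmost-target R) (nf-path p))
  ... | m , M = begin
    embed (p ◅◅ p′) ◅◅ embed q          ≡⟨ cong (_◅◅ embed q) (embed-◅◅ p p′) ⟩
    (embed p ◅◅ embed p′) ◅◅ embed q    ≡⟨ ◅◅-assoc (embed p) (embed p′) (embed q) ⟩
    embed p ◅◅ embed p′ ◅◅ embed q      ≈⟨ ◅◅-congʳ-⇛ (embed p) (B q m Q M) ⟩
    embed p ◅◅ embed m                  ≈⟨ A m r M R ⟩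
    embed r                             ∎
    where open ⇛-Reasoning

  -- The leftmost paths from `w ++ b` and `w′ ++ b` both pass through `nf w ++ b` and share the tail
  -- `m` from there; before it, the filler for `p` is whiskered by `b`.
  coherent-right : ∀ b {w w′} (p : Path (Σrow n) w w′) → Coherent p → Coherent (rightPath b p)
  coherent-right b {w} {w′} p A {ŵ} q r Q R
    with leftmostPath w refl | leftmostPath w′ (nf-path p)
  ... | p₁ , P₁ | p₂ , P₂ with leftmostPath (nf w ++ b) {ŵ} (trans (leftmost-target R) (nf-path (rightPath b p₁)))
  ... | m , M with leftmost-unique R (leftmost-right P₁ M) | leftmost-unique Q (leftmost-right P₂ M)
  ... | refl | refl = begin
    embed (rightPath b p) ◅◅ embed (rightPath b p₂ ◅◅ m)                ≡⟨ cong₂ _◅◅_ (embed-rightPath b p) (embed-rightPath-◅◅ p₂ m) ⟩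
    whisker [] b (embed p) ◅◅ whisker [] b (embed p₂) ◅◅ embed m        ≡⟨ ◅◅-assoc (whisker [] b (embed p)) _ _ ⟨
    (whisker [] b (embed p) ◅◅ whisker [] b (embed p₂)) ◅◅ embed m      ≡⟨ cong (_◅◅ embed m) (gmap-◅◅ _ _ (embed p) (embed p₂)) ⟨
    whisker [] b (embed p ◅◅ embed p₂) ◅◅ embed m                       ≈⟨ ◅◅-congˡ-⇛ (embed m) (whisk [] b (A p₂ p₁ P₂ P₁)) ⟩
    whisker [] b (embed p₁) ◅◅ embed m                                  ≡⟨ embed-rightPath-◅◅ p₁ m ⟨
    embed (rightPath b p₁ ◅◅ m)                                         ∎
    where
    open ⇛-Reasoning
    embed-rightPath-◅◅ : ∀ {x y z} (p : Path (Σrow n) x y) (q : Path (Σrow n) (y ++ b) z) →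
                         embed (rightPath b p ◅◅ q) ≡ whisker [] b (embed p) ◅◅ embed q
    embed-rightPath-◅◅ p q = trans (embed-◅◅ (rightPath b p) q) (cong (_◅◅ embed q) (embed-rightPath b p))

  path-exchange : ∀ {w ŵ x x′ z} (s : Path (Σrow n) x x′) (p : Path (Σrow n) w ŵ) (m : Path (Σrow n) (ŵ ++ x′) z) →
                  embed (rightPath x p) ◅◅ embed (leftPath ŵ s) ◅◅ embed m ≈ embed (leftPath w s) ◅◅ embed (rightPath x′ p ◅◅ m)
  path-exchange {w} {ŵ} {x} {x′} s p m = begin
    embed (rightPath x p) ◅◅ embed (leftPath ŵ s) ◅◅ embed m
      ≡⟨ cong₂ (λ f g → f ◅◅ g ◅◅ embed m) (embed-rightPath x p) (embed-leftPath ŵ s) ⟩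
    whisker [] x (embed p) ◅◅ left ŵ (embed s) ◅◅ embed m
      ≡⟨ ◅◅-assoc (whisker [] x (embed p)) _ _ ⟨
    (whisker [] x (embed p) ◅◅ left ŵ (embed s)) ◅◅ embed m
      ≈⟨ ◅◅-congˡ (embed m) (left-right (embed p) (embed s)) ⟨
    (left w (embed s) ◅◅ whisker [] x′ (embed p)) ◅◅ embed m
      ≡⟨ ◅◅-assoc (left w (embed s)) _ _ ⟩
    left w (embed s) ◅◅ whisker [] x′ (embed p) ◅◅ embed m
      ≡⟨ cong₂ (λ f g → f ◅◅ g ◅◅ embed m) (embed-leftPath w s) (embed-rightPath x′ p) ⟨
    embed (leftPath w s) ◅◅ embed (rightPath x′ p) ◅◅ embed m
      ≡⟨ cong (embed (leftPath w s) ◅◅_) (embed-◅◅ (rightPath x′ p) m) ⟨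
    embed (leftPath w s) ◅◅ embed (rightPath x′ p ◅◅ m) ∎
    where open ≈-Reasoning

  -- The leftmost paths from `w ++ x` and `w ++ x′` both begin with `p`, and `path-exchange` moves
  -- `s` past it.
  coherent-unreduce : ∀ {w ŵ x x′} {p : Path (Σrow n) w ŵ} → Leftmost p → (s : Path (Σrow n) x x′) →
                      Coherent (leftPath ŵ s) → Coherent (leftPath w s)
  coherent-unreduce {w} {ŵ} {x} {x′} {p} P s A {z} q r Q R
    with leftmostPath (ŵ ++ x) {z} (trans (leftmost-target R) (nf-path (rightPath x p)))
       | leftmostPath (ŵ ++ x′) {z} (trans (leftmost-target Q) (nf-path (rightPath x′ p)))
  ... | m , M | m′ , M′ with leftmost-unique R (leftmost-right P M) | leftmost-unique Q (leftmost-right P M′)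
  ... | refl | refl = begin
    embed (leftPath w s) ◅◅ embed (rightPath x′ p ◅◅ m′)        ≈⟨ ident (path-exchange s p m′) ⟨
    embed (rightPath x p) ◅◅ embed (leftPath ŵ s) ◅◅ embed m′   ≈⟨ ◅◅-congʳ-⇛ (embed (rightPath x p)) (A m′ m M′ M) ⟩
    embed (rightPath x p) ◅◅ embed m                            ≡⟨ embed-◅◅ (rightPath x p) m ⟨
    embed (rightPath x p ◅◅ m)                                  ∎
    where open ⇛-Reasoning

  -- The same exchange square read backwards; 2-cells are invertible, so the common initial part
  -- `rightPath x p` can be cancelled.
  coherent-reduce : ∀ {w ŵ x x′} {p : Path (Σrow n) w ŵ} → Leftmost p → (s : Path (Σrow n) x x′) →
                    Coherent (leftPath w s) → Coherent (leftPath ŵ s)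
  coherent-reduce {w} {ŵ} {x} {x′} {p} P s A m′ m M′ M = ◅◅-cancelˡ-⇛ (embed (rightPath x p)) (begin
    embed (rightPath x p) ◅◅ embed (leftPath ŵ s) ◅◅ embed m′   ≈⟨ ident (path-exchange s p m′) ⟩
    embed (leftPath w s) ◅◅ embed (rightPath x′ p ◅◅ m′)        ≈⟨ A _ _ (leftmost-right P M′) (leftmost-right P M) ⟩
    embed (rightPath x p ◅◅ m)                                  ≡⟨ embed-◅◅ (rightPath x p) m ⟩
    embed (rightPath x p) ◅◅ embed m                            ∎)
    where open ⇛-Reasoning

  -- Whiskering by `a` on the left does not preserve leftmost paths. The whiskered filler compares
  -- `leftPath a p` with `leftPath a s` followed by `leftPath a q`, and the coherence of the two
  -- whiskered sides makes up the difference.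
  coherent-left : ∀ a {w w′ ŵ} (s : Path (Σrow n) w w′) {p : Path (Σrow n) w ŵ} {q : Path (Σrow n) w′ ŵ} →
                  Leftmost p → Leftmost q → Coherent s → Coherent (leftPath a p) → Coherent (leftPath a q) →
                  Coherent (leftPath a s)
  coherent-left a {ŵ = ŵ} s {p} {q} P Q A B C {z} q′ p′ Q′ P′
    with leftmostPath (a ++ ŵ) {z} (trans (leftmost-target P′) (nf-path (leftPath a p)))
  ... | m , M = begin
    embed (leftPath a s) ◅◅ embed q′                      ≈⟨ ◅◅-congʳ-⇛ (embed (leftPath a s)) (C m q′ M Q′) ⟨
    embed (leftPath a s) ◅◅ embed (leftPath a q) ◅◅ embed m ≡⟨ cong₂ (λ f g → f ◅◅ g ◅◅ embed m) (embed-leftPath a s) (embed-leftPath a q) ⟩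
    left a (embed s) ◅◅ left a (embed q) ◅◅ embed m       ≡⟨ ◅◅-assoc (left a (embed s)) _ _ ⟨
    (left a (embed s) ◅◅ left a (embed q)) ◅◅ embed m     ≡⟨ cong (_◅◅ embed m) (gmap-◅◅ _ _ (embed s) (embed q)) ⟨
    left a (embed s ◅◅ embed q) ◅◅ embed m                ≈⟨ ◅◅-congˡ-⇛ (embed m) (left-⇛ a (A q p Q P)) ⟩
    left a (embed p) ◅◅ embed m                           ≡⟨ cong (_◅◅ embed m) (embed-leftPath a p) ⟨
    embed (leftPath a p) ◅◅ embed m                       ≈⟨ B m p′ M P′ ⟩
    embed p′                                              ∎
    where open ⇛-Reasoning

  CoherentAt : Word → Cell → Word → Set
  CoherentAt a α b = ∀ {w w′} (e : w ≡ a ++ src α ++ b) (e′ : w′ ≡ a ++ tgt α ++ b) → Coherent (step a α b e e′ ◅ ε)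

  coherentAt : ∀ {a α b a′ b′ w w′} {e : w ≡ a ++ src α ++ b} {e′ : w′ ≡ a ++ tgt α ++ b} →
               a ≡ a′ → b ≡ b′ → Coherent (step a α b e e′ ◅ ε) → CoherentAt a′ α b′
  coherentAt {e = refl} {refl} refl refl A refl refl = A

  basic : ∀ α b → Path (Σrow n) (src α ++ b) (tgt α ++ b)
  basic α b = step [] α b refl refl ◅ ε

  coherentAt-right : ∀ {a α b} c → CoherentAt a α b → CoherentAt a α (b ++ c)
  coherentAt-right {a} {α} {b} c A = coherentAt refl refl (coherent-right c (step a α b refl refl ◅ ε) (A refl refl))

  coherentAt-unreduce : ∀ {a â α b} {p : Path (Σrow n) a â} → Leftmost p → CoherentAt â α b → CoherentAt a α b
  coherentAt-unreduce {a} {â} {α} {b} P A =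
    coherentAt (++-identityʳ a) refl (coherent-unreduce P (basic α b) (coherentAt (sym (++-identityʳ â)) refl (A refl refl) _ _))

  coherentAt-reduce : ∀ {a â α b} {p : Path (Σrow n) a â} → Leftmost p → CoherentAt a α b → CoherentAt â α b
  coherentAt-reduce {a} {â} {α} {b} P A =
    coherentAt (++-identityʳ â) refl (coherent-reduce P (basic α b) (coherentAt (sym (++-identityʳ a)) refl (A refl refl) _ _))

  -- Such a step is the first one of the leftmost path from its source, so both paths are equal.
  coherentAt-leftmost : ∀ {a α b} → Normal (a ∷ʳ proj₁ (value α)) → CoherentAt a α b
  coherentAt-leftmost l e e′ q r Q R = ≋-reflexive (cong embed (leftmost-unique (l ◅ Q) R))

  coherentAt-left : ∀ c {a α b ŵ} {p : Path (Σrow n) (a ++ src α ++ b) ŵ} {q : Path (Σrow n) (a ++ tgt α ++ b) ŵ} →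
                    Leftmost p → Leftmost q → CoherentAt a α b → Coherent (leftPath c p) → Coherent (leftPath c q) →
                    CoherentAt (c ++ a) α b
  coherentAt-left c {a} {α} {b} P Q A B C = coherentAt refl refl (coherent-left c (step a α b refl refl ◅ ε) P Q (A refl refl) B C)

  -- Exposes the first step of `normalisingPath` under its transport, with a leftmost remainder.
  normalisingPath-leftmost : ∀ {w w′} (s : Step (Σrow n) w w′) →
                             Σ[ p ∈ Path (Σrow n) w′ (nf w) ] Leftmost p × normalisingPath s ≡ s ◅ p
  normalisingPath-leftmost {w} {w′} s with Λ w′ | Λ-leftmost w′
  ... | ŵ , p , nrm | P = cast (normal-target (s ◅ p) nrm)
    where
    cast : ∀ {x} (e : ŵ ≡ x) → Σ[ q ∈ Path (Σrow n) w′ x ] Leftmost q × subst (Path (Σrow n) w) e (s ◅ p) ≡ s ◅ q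
    cast refl = p , P , refl

  -- The side `L` starts at the first pair, hence is leftmost throughout, and `R` is the given step
  -- followed by a leftmost path. The generating 3-cell, inverted, is thus the required filler.
  coherentAt-generator : ∀ {u v t} (c : 𝔱¹ (u , v , t)) → CoherentAt (u ∷ []) ((v , t) , [ proj₂ (proj₁ c) ]) []
  coherentAt-generator {u} {v} {t} c = coherentAt {e = refl} {refl} refl refl coh
    where
    τ : 𝔗¹ n
    τ = (u , v , t) , [ c ]
    sₗ : Step (Σrow n) (peak τ) _
    sₗ = step [] ((u , v) , [ proj₁ (proj₁ c) ]) (t ∷ []) refl refl
    sᵣ : Step (Σrow n) (peak τ) _
    sᵣ = step (u ∷ []) ((v , t) , [ proj₂ (proj₁ c) ]) [] refl refl
    coh : Coherent (sᵣ ◅ ε)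
    coh q r Q R with leftmost-target R
    ... | refl with normalisingPath-leftmost sₗ | normalisingPath-leftmost sᵣ
    ... | l , Lm , eₗ | r′ , Rm , eᵣ = begin
      embed (sᵣ ◅ q)    ≡⟨ cong (λ z → embed (sᵣ ◅ z)) (leftmost-unique Q Rm) ⟩
      embed (sᵣ ◅ r′)   ≡⟨ cong embed eᵣ ⟨
      embed (Defs.R τ)  ≈⟨ gen {Σrow,scoh n} τ ⟨
      embed (Defs.L τ)  ≡⟨ cong embed eₗ ⟩
      embed (sₗ ◅ l)    ≡⟨ cong embed (leftmost-unique ([-] ◅ Lm) R) ⟩
      embed r           ∎
      where open ⇛-Reasoning

-- Coherence of the row polygraph

module _ {n : ℕ} where
  open Polygraph₂ (Σrow n)

  -- Along a leftmost path starting from a small word, the first row of a word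
  -- of three rows stays to the right of x.
  Small : Fin n → Word → Set
  Small x (u ∷ _ ∷ _ ∷ [])    = x Fin.< min u
  Small x (_ ∷ _ ∷ _ ∷ _ ∷ _) = ⊥
  Small x _                    = ⊤

  letter⋪ : ∀ {x} {u : Row n} → x Fin.< min u → ¬ pre x ◁ u
  letter⋪ x<u (_ , u<x) = ℕ.<-asym x<u u<x

  cons : ∀ x (u : Row n) → x Fin.< min u → Row n
  cons x (row y ys ys↗) x<y = row x (y ∷ ys) (x<y ∷ ys↗)

  -- The letters of `x` followed by `u` spell a single row, which is its own normal form.
  consPath : ∀ x (u : Row n) (x<u : x Fin.< min u) → Σ[ p ∈ Path (Σrow n) (pre x ∷ u ∷ []) (cons x u x<u ∷ []) ] Leftmost p
  consPath x u@(row y ys ys↗) x<y = step [] ((pre x , u) , [ letter⋪ {u = u} x<y ]) [] refl e ◅ ε , [-] ◅ ε [-]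
    where
    e : cons x u x<y ∷ [] ≡ 𝓡 (N (x ∷ word u)) ++ []
    e = begin
      cons x u x<y ∷ []            ≡⟨ normal-form (cons x u x<y ∷ []) [-] ⟩
      𝓡 (N (x ∷ word u ++ []))    ≡⟨ cong (λ w → 𝓡 (N (x ∷ w))) (++-identityʳ (word u)) ⟩
      𝓡 (N (x ∷ word u))          ≡⟨ ++-identityʳ _ ⟨
      𝓡 (N (x ∷ word u)) ++ []    ∎
      where open ≡-Reasoning

  coherentAt-letter : ∀ x (α : Cell) b → CoherentAt (pre x ∷ []) α b
  coherentAt-letter x α@((u , v) , [ _ ]) b with pre x ◁? u
  ... | yes x◁u = coherentAt-leftmost (x◁u ∷ [-])
  -- The absurd pattern refutes `2 ≤ ℓ (pre x)`, which membership in 𝔰 would require.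
  ... | no  x⋪u = coherentAt-right b (coherentAt-generator {u = pre x} {u} {v} ((x⋪u , irreducible α) , λ { (_ , ℕ.s≤s () , _) }))

  coherentAt-tail◁ : ∀ {x} (u : Row n) (x<u : x Fin.< min u) {v t} (v⋪t : ¬ v ◁ t) → u ◁ v →
                     CoherentAt (cons x u x<u ∷ []) ((v , t) , [ v⋪t ]) []
  -- Exposing the constructor of `u` lets `deleteFirst` of `cons x u x<u` compute to `u`, so that
  -- `u◁v` excludes 𝔰.
  coherentAt-tail◁ {x} u@(row _ _ _) x<u {v} v⋪t u◁v with cons x u x<u ◁? v
  ... | yes ◁v = coherentAt-leftmost (◁v ∷ [-])
  ... | no  ⋪v = coherentAt-generator ((⋪v , v⋪t) , λ (_ , _ , u⋪v) → u⋪v u◁v)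

  -- The prefix x · u normalises to the row x u, which reduces the claim to `coherentAt-tail◁`.
  coherentAt-letter-row : ∀ x (u : Row n) → x Fin.< min u → (α : Cell) → u ◁ proj₁ (value α) → CoherentAt (pre x ∷ u ∷ []) α []
  coherentAt-letter-row x u x<u α u◁v =
    coherentAt-unreduce (proj₂ (consPath x u x<u)) (coherentAt-tail◁ u x<u (irreducible α) u◁v)

  small-shape : ∀ {x} {u v : Row n} {w} → Shape u v w → Small x (w ++ [])
  small-shape one         = tt
  small-shape (two _ _ _) = tt

  small-∷-shape : ∀ {x} {g u v : Row n} {w} → x Fin.< min g → Shape u v w → Small x (g ∷ w ++ [])
  small-∷-shape x<g one         = tt
  small-∷-shape x<g (two _ _ _) = x<g

  -- A new upper row consists of letters bumped from `u`, so its first letter is at least `min u`.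
  small-shape-∷ : ∀ {x} {u v : Row n} {w r} → x Fin.< min u → Shape u v w → Small x (w ++ r ∷ [])
  small-shape-∷ x<u one = tt
  small-shape-∷ {u = u} {v} x<u (two u′ to _) with ∈-bumps⁻ u (word v) (to (here refl))
  ... | y , _ , e = ℕ.<-≤-trans x<u (min-≤ u (proj₁ (bump-just y u e)))

  coherent-step-∷ : ∀ {c w w′ z} {s : Step (Σrow n) w w′} {p : Path (Σrow n) w′ z} →
                    Coherent (leftPath c (s ◅ ε)) → Coherent (leftPath c p) → Coherent (leftPath c (s ◅ p))
  coherent-step-∷ {c} {s = s} {p} = coherent-◅◅ (leftPath c (s ◅ ε)) (leftPath c p)

  -- `Small` leaves two positions for a step. At the front, x gives a branching (x , u , v). Behind
  -- a row `g`, leftmostness supplies `g ◁ u`, the hypothesis of `coherentAt-letter-row`. The shape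
  -- of row insertions maintains `Small`.
  coherent-letter : ∀ x {w ŵ} {p : Path (Σrow n) w ŵ} → Leftmost p → Small x w → Coherent (leftPath (pre x ∷ []) p)
  coherent-letter x (ε _) _ = coherent-ε
  coherent-letter x (_◅_ {s = step [] α [] refl refl} _ P) _ =
    coherent-step-∷ (coherentAt-letter x α [] _ _) (coherent-letter x P (small-shape (shape (proj₁ (value α)) (proj₂ (value α)))))
  coherent-letter x (_◅_ {s = step [] α (r ∷ []) refl refl} _ P) x<u =
    coherent-step-∷ (coherentAt-letter x α (r ∷ []) _ _) (coherent-letter x P (small-shape-∷ x<u (shape (proj₁ (value α)) (proj₂ (value α)))))
  coherent-letter x (_◅_ {s = step (g ∷ []) α [] refl refl} (g◁u ∷ _) P) x<g =
    coherent-step-∷ (coherentAt-letter-row x g x<g α g◁u _ _) (coherent-letter x P (small-∷-shape x<g (shape (proj₁ (value α)) (proj₂ (value α)))))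
  coherent-letter x (_◅_ {s = step [] α (_ ∷ _ ∷ _) refl refl} _ _) ()
  coherent-letter x (_◅_ {s = step (_ ∷ []) α (_ ∷ _) refl refl} _ _) ()
  coherent-letter x (_◅_ {s = step (_ ∷ _ ∷ []) α _ refl refl} _ _) ()
  coherent-letter x (_◅_ {s = step (_ ∷ _ ∷ _ ∷ []) α _ refl refl} _ _) ()
  coherent-letter x (_◅_ {s = step (_ ∷ _ ∷ _ ∷ _ ∷ _) α _ refl refl} _ _) ()

  -- Let u = x ∂u.  If ∂u ⋪ v, coherence is transported along x · ∂u ⇒ u: the
  -- branching at ∂u v t is coherent by induction, and the steps of its two sides
  -- remain coherent with x on the left.
  coherentAt-cons : ∀ x (∂u : Row n) (x<∂u : x Fin.< min ∂u) {v t} (v⋪t : ¬ v ◁ t) →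
                    (¬ ∂u ◁ v → CoherentAt (∂u ∷ []) ((v , t) , [ v⋪t ]) []) →
                    CoherentAt (cons x ∂u x<∂u ∷ []) ((v , t) , [ v⋪t ]) []
  coherentAt-cons x ∂u x<∂u {v} {t} v⋪t IH = by-cases (∂u ◁? v)
    where
    α : Cell
    α = (v , t) , [ v⋪t ]
    from-sides : ∀ {ŵ} → CoherentAt (∂u ∷ []) α [] → Σ[ p ∈ Path (Σrow n) (∂u ∷ v ∷ t ∷ []) ŵ ] Leftmost p →
                 Σ[ q ∈ Path (Σrow n) (∂u ∷ tgt α ++ []) ŵ ] Leftmost q → CoherentAt (cons x ∂u x<∂u ∷ []) α []
    from-sides A (_ , P) (_ , Q) = coherentAt-reduce (proj₂ (consPath x ∂u x<∂u))
      (coherentAt-left (pre x ∷ []) P Q A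
        (coherent-letter x P x<∂u) (coherent-letter x Q (small-∷-shape x<∂u (shape v t))))
    by-cases : Dec (∂u ◁ v) → CoherentAt (cons x ∂u x<∂u ∷ []) α []
    by-cases (yes ∂u◁v) = coherentAt-tail◁ ∂u x<∂u v⋪t ∂u◁v
    by-cases (no ∂u⋪v)  = from-sides (IH ∂u⋪v) (leftmostPath (∂u ∷ v ∷ t ∷ []) refl)
                            (leftmostPath (∂u ∷ tgt α ++ []) (nf-path (step (∂u ∷ []) α [] refl refl ◅ ε)))

  coherentAt-row : ∀ x ys .(u↗ : Linked Fin._<_ (x ∷ ys)) {v t} → ¬ row x ys u↗ ◁ v → (v⋪t : ¬ v ◁ t) →
                   CoherentAt (row x ys u↗ ∷ []) ((v , t) , [ v⋪t ]) []
  coherentAt-row x []       u↗ {v} {t} u⋪v v⋪t = coherentAt-generator {u = row x [] u↗} {v} {t} ((u⋪v , v⋪t) , λ { (_ , ℕ.s≤s () , _) })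
  coherentAt-row x (y ∷ ys) u↗ {v} {t} u⋪v v⋪t =
    coherentAt-cons x (row y ys (Linked.tail u↗)) (head< u↗) v⋪t
      (λ ∂u⋪v → coherentAt-row y ys (Linked.tail u↗) {v} {t} ∂u⋪v v⋪t)
    where
    head< : ∀ {x y : Fin n} {ys} → .(Linked Fin._<_ (x ∷ y ∷ ys)) → x Fin.< y
    head< {x} {y} l = recompute (x Fin.<? y) (Linked.head l)

  -- Noetherian induction

  infix 4 _↞⁺_
  _↞⁺_ : Word → Word → Set
  _↞⁺_ = Plus.TransClosure (flip (Step (Σrow n)))

  path-step : ∀ {w x y} → Path (Σrow n) w x → Step (Σrow n) x y → y ↞⁺ w
  path-step ε       s = Plus.[ s ]
  path-step (t ◅ p) s = path-step p s Plus.++ Plus.[ t ]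

  StepsCoherent : Word → Set
  StepsCoherent w = ∀ a α b → w ≡ a ++ src α ++ b → CoherentAt a α b

  coherent-below : ∀ {w} → (∀ {x} → x ↞⁺ w → StepsCoherent x) → ∀ c {y z} (p : Path (Σrow n) y z) → (c ++ y) ↞⁺ w →
                   Coherent (leftPath c p)
  coherent-below IH c ε       _ = coherent-ε
  coherent-below IH c (s@(step a α b refl refl) ◅ p) y↞w =
    coherent-step-∷ (IH y↞w (c ++ a) α b (sym (++-assoc c a _)) _ _)
                    (coherent-below IH c p (Plus.[ leftStep c s ] Plus.++ y↞w))

  -- The critical branching at t u v is coherent in the right context `b`; `coherentAt-left` then
  -- adds `c`. Of the two sides it asks for, the one through `β` starts with a step that is leftmost
  -- behind `c`, and everything else runs through words strictly below `w`.
  coherentAt-overlap : ∀ {w} → (∀ {x} → x ↞⁺ w → StepsCoherent x) → ∀ c t {u v} b → Normal (c ∷ʳ t) →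
                       ¬ t ◁ u → (u⋪v : ¬ u ◁ v) → Path (Σrow n) w ((c ∷ʳ t) ++ u ∷ v ∷ b) →
                       CoherentAt (c ∷ʳ t) ((u , v) , [ u⋪v ]) b
  coherentAt-overlap IH c t@(row x ys t↗) {u} {v} b nrm t⋪u u⋪v p =
    sides (leftmostPath (tgt β ++ v ∷ b) refl)
          (leftmostPath (t ∷ tgt α ++ b)
            (trans (sym (nf-path (step [] β (v ∷ b) refl refl ◅ ε))) (nf-path (step (t ∷ []) α b refl refl ◅ ε))))
    where
    α β : Cell
    α = (u , v) , [ u⋪v ]
    β = (t , u) , [ t⋪u ]
    below-β : (c ++ tgt β ++ v ∷ b) ↞⁺ _
    below-β = path-step p (step c β (v ∷ b) (++-assoc c (t ∷ []) _) refl)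
    below-α : (c ++ t ∷ tgt α ++ b) ↞⁺ _
    below-α = path-step p (step (c ∷ʳ t) α b refl (sym (++-assoc c (t ∷ []) _)))
    sides : ∀ {ŵ} → Σ[ p ∈ Path (Σrow n) (tgt β ++ v ∷ b) ŵ ] Leftmost p →
            Σ[ q ∈ Path (Σrow n) (t ∷ tgt α ++ b) ŵ ] Leftmost q → CoherentAt (c ∷ʳ t) α b
    sides (m , M) (q , Q) = coherentAt-left c {a = t ∷ []} {α} ([-] ◅ M) Q
      (coherentAt-right b (coherentAt-row x ys t↗ t⋪u u⋪v))
      (coherent-step-∷ {s = step [] β (v ∷ b) refl refl}
        (coherentAt-leftmost (subst (λ a → Normal (a ∷ʳ t)) (sym (++-identityʳ c)) nrm) _ _)
        (coherent-below IH c m below-β))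
      (coherent-below IH c q below-α)

  -- With `a` normal, only its last row can form a reducible pair with the source of `α`; if it does
  -- not, the step is already leftmost.
  coherentAt-normal : ∀ {w} → (∀ {x} → x ↞⁺ w → StepsCoherent x) → ∀ a → Normal a → ∀ α b →
                      Path (Σrow n) w (a ++ src α ++ b) → CoherentAt a α b
  coherentAt-normal IH a nrm α@((u , v) , [ _ ]) b p with initLast a
  ... | [] = coherentAt-leftmost [-]
  ... | c ∷ʳ′ t with t ◁? u
  ...   | yes t◁u = coherentAt-leftmost (snoc c nrm)
    where
    snoc : ∀ c → Normal (c ∷ʳ t) → Normal ((c ∷ʳ t) ∷ʳ u)
    snoc []          _           = t◁u ∷ [-]
    snoc (x ∷ [])    (x◁t ∷ nrm) = x◁t ∷ snoc [] nrm
    snoc (x ∷ y ∷ c) (x◁y ∷ nrm) = x◁y ∷ snoc (y ∷ c) nrm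
  ...   | no t⋪u  = coherentAt-overlap IH c t b nrm t⋪u (irreducible α) p

  steps-coherent : ∀ w → StepsCoherent w
  steps-coherent = All.wfRec (Plus.wellFounded _ terminating) _ StepsCoherent (λ _ → by-prefix)
    where
    from-prefix : ∀ {w} → (∀ {x} → x ↞⁺ w → StepsCoherent x) → ∀ a α b → w ≡ a ++ src α ++ b →
                  Σ[ p ∈ Path (Σrow n) a (nf a) ] Leftmost p → CoherentAt a α b
    from-prefix IH a α b refl (p , P) =
      coherentAt-unreduce P (coherentAt-normal IH (nf a) (leftmost-normal P) α b (rightPath (src α ++ b) p))
    by-prefix : ∀ {w} → (∀ {x} → x ↞⁺ w → StepsCoherent x) → StepsCoherent w
    by-prefix IH a α b e = from-prefix IH a α b e (leftmostPath a refl)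

  coherent-step : ∀ {w w′} (s : Step (Σrow n) w w′) → Coherent (s ◅ ε)
  coherent-step {w} (step a α b e e′) = steps-coherent w a α b e e e′

  -- Each zigzag is thus compared with leftmost paths determined by its endpoints alone, so parallel
  -- zigzags are filled.
  zigzag-coherent : ∀ {w w′ ŵ} (f : Zigzag (Σrow n) w w′) {p : Path (Σrow n) w ŵ} {q : Path (Σrow n) w′ ŵ} →
                    Leftmost p → Leftmost q → _≋_ {Σrow,scoh n} (f ◅◅ embed q) (embed p)
  zigzag-coherent ε P Q = coherent-ε _ _ Q P
  zigzag-coherent (fwd s ◅ f) {p} {q} P Q = go (leftmostPath _ (trans (leftmost-target P) (nf-path (s ◅ ε))))
    where
    go : Σ[ m ∈ Path (Σrow n) _ _ ] Leftmost m → _≋_ {Σrow,scoh n} (fwd s ◅ f ◅◅ embed q) (embed p)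
    go (m , M) = ◅◅-congʳ-⇛ (fwd s ◅ ε) (zigzag-coherent f M Q) ⋆₂ coherent-step s m p M P
  zigzag-coherent (bwd s ◅ f) {p} {q} P Q = go (leftmostPath _ (trans (leftmost-target P) (sym (nf-path (s ◅ ε)))))
    where
    go : Σ[ m ∈ Path (Σrow n) _ _ ] Leftmost m → _≋_ {Σrow,scoh n} (bwd s ◅ f ◅◅ embed q) (embed p)
    go (m , M) = ◅◅-cancelˡ-⇛ (fwd s ◅ ε)
      (ident (◅◅-congˡ _ (inverseʳ s)) ⋆₂ (zigzag-coherent f M Q ⋆₂ inv (coherent-step s p m P M)))

  row-fills : ∀ {w w′} (f g : Zigzag (Σrow n) w w′) → _≋_ {Σrow,scoh n} f g
  row-fills {w} {w′} f g = ◅◅-cancelʳ-⇛ (embed q) (zigzag-coherent f P Q ⋆₂ inv (zigzag-coherent g P Q))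
    where
    nf-zigzag : ∀ {w w′} → Zigzag (Σrow n) w w′ → nf w ≡ nf w′
    nf-zigzag ε           = refl
    nf-zigzag (fwd s ◅ f) = trans (nf-path (s ◅ ε)) (nf-zigzag f)
    nf-zigzag (bwd s ◅ f) = trans (sym (nf-path (s ◅ ε))) (nf-zigzag f)
    p = proj₁ (leftmostPath w refl)
    P = proj₂ (leftmostPath w refl)
    q = proj₁ (leftmostPath w′ (nf-zigzag f))
    Q = proj₂ (leftmostPath w′ (nf-zigzag f))

-- The selected row cells

module _ {A B : Set} (f : A → B) where

  lookup-injective : ∀ {xs} → AllPairs (λ x y → f x ≢ f y) xs → ∀ i j → f (lookup xs i) ≡ f (lookup xs j) → i ≡ j
  lookup-injective (_  ∷ _)  zero    zero    _ = refl
  lookup-injective (x≢ ∷ _)  zero    (suc j) e = ⊥-elim (All.lookup x≢ (∈-lookup j) e)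
  lookup-injective (x≢ ∷ _)  (suc i) zero    e = ⊥-elim (All.lookup x≢ (∈-lookup i) (sym e))
  lookup-injective (_  ∷ xs) (suc i) (suc j) e = cong suc (lookup-injective xs i j e)

module _ {A : Set} {P : List A → A → Set} (P? : ∀ kept x → Dec (P kept x)) {R : A → A → Set} where

  greedy-AllPairs : ∀ {xs} → AllPairs R xs → AllPairs R (greedy P? xs)
  greedy-AllPairs {xs} = go [] xs
    where
    drop : ∀ kept {x xs} → AllPairs R (kept ++ x ∷ xs) → AllPairs R (kept ++ xs)
    drop []         (_ ∷ rs)  = rs
    drop (k ∷ kept) (r ∷ rs) with All.++⁻ kept r
    ... | p , _ ∷ q = All.++⁺ p q ∷ drop kept rs
    go : ∀ kept xs → AllPairs R (kept ++ xs) → AllPairs R (foldl (λ kept x → if does (P? kept x) then kept ∷ʳ x else kept) kept xs)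
    go kept []       rs = subst (AllPairs R) (++-identityʳ kept) rs
    go kept (x ∷ xs) rs with P? kept x
    ... | yes _ = go (kept ∷ʳ x) xs (subst (AllPairs R) (sym (++-assoc kept (x ∷ []) xs)) rs)
    ... | no _  = go kept xs (drop kept rs)

  greedy-AllPairs-kept : (∀ kept x → P kept x → All (λ k → R k x) kept) → ∀ xs → AllPairs R (greedy P? xs)
  greedy-AllPairs-kept compatible = go [] []
    where
    go : ∀ kept → AllPairs R kept → ∀ xs → AllPairs R (foldl (λ kept x → if does (P? kept x) then kept ∷ʳ x else kept) kept xs)
    go kept rs []       = rs
    go kept rs (x ∷ xs) with P? kept x
    ... | yes p = go (kept ∷ʳ x) (AllPairs.++⁺ rs ([] ∷ []) (All.map (_∷ []) (compatible kept x p))) xs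
    ... | no _  = go kept rs xs

-- Freshness in the first scan makes the cells distinct, and the second scan only discards pairs.
-- This is the injectivity of `β` used by `reduction-coherent`.
acycPairs-cells-distinct : ∀ n → AllPairs (λ p q → cell p ≢ cell q) (acycPairs n)
acycPairs-cells-distinct n = greedy-AllPairs (λ kept p → acyclic? Dependency dependency? (kept ∷ʳ p))
  (greedy-AllPairs-kept fresh? (λ _ _ → All.map proj₂) (eligiblePairs n))

-- Exchanging the 3-cells of the selected triples

module _ {n : ℕ} where
  open Polygraph₂ (Σrow n)

  embed-bare : ∀ {β w w′} {p : Path (Σrow n) w w′} (o : OccursBare β p) →
               embed p ≡ embed (before o) ◅◅ (fwd (generator β) ◅ ε) ◅◅ embed (after o)
  embed-bare {β} (here {e = e} {e′} {g}) = split e e′ (trans e (++-identityʳ (src β))) (trans e′ (++-identityʳ (tgt β))) _ _ g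
    where
    -- `before` and `after` contain transports; generalising their equations to variables lets these
    -- be matched away.
    split : ∀ {w w′ w″ x x′} (e : w ≡ src β ++ []) (e′ : w′ ≡ tgt β ++ []) (a : w ≡ x) (b : w′ ≡ x′)
            (c : x ≡ src β ++ []) (d : x′ ≡ tgt β ++ []) (g : Path (Σrow n) w′ w″) →
            fwd (step [] β [] e e′) ◅ embed g ≡
            embed (subst (Path (Σrow n) w) a ε) ◅◅ (fwd (step [] β [] c d) ◅ ε) ◅◅ embed (subst (λ w → Path (Σrow n) w w″) b g)
    split e e′ refl refl c d g = cong (λ s → fwd s ◅ embed g) (step-irrelevant refl refl)
  embed-bare (there o) = cong (_ ◅_) (embed-bare o)

  -- With `S` in place of β, the side containing β collapses to the other side, so a 3-cell between
  -- `S` and β fills the sphere of the triple.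
  conjugate-cancel : ∀ {w x y z} (f : Zigzag (Σrow n) w x) (v : Zigzag (Σrow n) w z) (g : Zigzag (Σrow n) y z) →
                     f ◅◅ (inverse f ◅◅ v ◅◅ inverse g) ◅◅ g ≈ v
  conjugate-cancel f v g = begin
    f ◅◅ (inverse f ◅◅ v ◅◅ inverse g) ◅◅ g   ≡⟨ cong (f ◅◅_) (◅◅-assoc (inverse f) _ g) ⟩
    f ◅◅ inverse f ◅◅ (v ◅◅ inverse g) ◅◅ g   ≡⟨ ◅◅-assoc f (inverse f) _ ⟨
    (f ◅◅ inverse f) ◅◅ (v ◅◅ inverse g) ◅◅ g ≈⟨ ≈-cong (◅◅-inverseʳ f) ≈-refl ⟩
    (v ◅◅ inverse g) ◅◅ g                     ≡⟨ ◅◅-assoc v (inverse g) g ⟩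
    v ◅◅ inverse g ◅◅ g                       ≈⟨ ◅◅-congʳ v (◅◅-inverseˡ g) ⟩
    v ◅◅ ε                                    ≡⟨ ◅◅-identityʳ v ⟩
    v                                         ∎
    where open ≈-Reasoning

  Σrow,N-fills : ∀ {w w′} (f g : Zigzag (Σrow n) w w′) → _⇛_ (Σrow,N n) f g
  Σrow,N-fills f g = replace (row-fills f g)
    where
    open DecMembership {A = 𝔗¹ n} _≟ᵀ_ using (_∈?_)
    open ⇛-Reasoning {Σrow,N n}

    replaced : ∀ (p : EligiblePair n) → _⇛_ (Σrow,N n) (EligiblePair.S p) (fwd (generator (cell p)) ◅ ε) →
               _⇛_ (Σrow,N n) (embed (L (triple p))) (embed (R (triple p)))
    replaced record { triple = τ ; cell = β ; eligible = (inj₁ o , _) } A = begin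
      embed (L τ)                                                         ≡⟨ embed-bare o ⟩
      embed (before o) ◅◅ (fwd (generator β) ◅ ε) ◅◅ embed (after o)      ≈⟨ ◅◅-congʳ-⇛ (embed (before o)) (◅◅-congˡ-⇛ (embed (after o)) A) ⟨
      _                                                                   ≈⟨ ident (conjugate-cancel (embed (before o)) (embed (R τ)) (embed (after o))) ⟩
      embed (R τ)                                                         ∎
    replaced record { triple = τ ; cell = β ; eligible = (inj₂ o , _) } A = begin
      embed (L τ)                                                         ≈⟨ ident (conjugate-cancel (embed (before o)) (embed (L τ)) (embed (after o))) ⟨
      _                                                                   ≈⟨ ◅◅-congʳ-⇛ (embed (before o)) (◅◅-congˡ-⇛ (embed (after o)) A) ⟩
      embed (before o) ◅◅ (fwd (generator β) ◅ ε) ◅◅ embed (after o)      ≡⟨ embed-bare o ⟨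
      embed (R τ)                                                         ∎

    kept-filler : ∀ {τ} → ∃ (λ p → p ∈ acycPairs n × τ ≡ triple p) → _⇛_ (Σrow,N n) (embed (L τ)) (embed (R τ))
    kept-filler (_ , p∈ , refl) = subst (λ q → _⇛_ (Σrow,N n) (embed (L (triple q))) (embed (R (triple q))))
                                        (sym (lookup-index p∈)) (replaced (lookup (acycPairs n) (Any.index p∈)) (gen (𝒜 (Any.index p∈))))

    filler : ∀ τ → Dec (τ ∈ τ[𝓑ᵃᶜʸᶜ] n) → _⇛_ (Σrow,N n) (embed (L τ)) (embed (R τ))
    filler τ (no τ∉)  = gen (𝒳 (τ , [ τ∉ ]))
    filler τ (yes τ∈) = kept-filler (∈-map⁻ triple τ∈)

    replace : ∀ {w w′} {f g : Zigzag (Σrow n) w w′} → _⇛_ (Σrow,scoh n) f g → _⇛_ (Σrow,N n) f g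
    replace (gen τ)       = filler τ (τ ∈? τ[𝓑ᵃᶜʸᶜ] n)
    replace (ident p)     = ident p
    replace (inv A)       = inv (replace A)
    replace (A ⋆₂ B)      = replace A ⋆₂ replace B
    replace (A ⋆₁ B)      = replace A ⋆₁ replace B
    replace (whisk a b A) = whisk a b (replace A)

  read-zigzag : ∀ {w w′} → Zigzag (Σrow n) w w′ → read w ∼ read w′
  read-zigzag = Star.kleisliStar read λ { (fwd s) → read-step s ; (bwd s) → ∼-sym (read-step s) }

  read-singletons : ∀ (w : List (Fin n)) → read (map pre w) ≡ w
  read-singletons []      = refl
  read-singletons (x ∷ w) = cong (x ∷_) (read-singletons w)

  -- Insertion is invariant under the stylic relations, so words with congruent readings have the
  -- same normal form; one-letter rows give surjectivity.
  Σrow-presents : Presents (Σrow n) (Styl n)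
  Σrow-presents = read , record
    { isMonoidMonomorphism = record
      { isMonoidHomomorphism = record
        { isMagmaHomomorphism = record
          { isRelHomomorphism = record { cong = read-zigzag }
          ; homo              = λ u v → ∼-reflexive (concatMap-++ word u v)
          }
        ; ε-homo = ε
        }
      ; injective = λ {x} {y} p → normal-zigzag x (cong 𝓡 (N-invariant p [])) ◅◅ inverse (normal-zigzag y refl)
      }
    ; surjective = λ w → map pre w , λ p → read-zigzag p ◅◅ ∼-reflexive (read-singletons w)
    }
    where
    normal-zigzag : ∀ w {ŵ} → nf w ≡ ŵ → Zigzag (Σrow n) w ŵ
    normal-zigzag w e = embed (proj₁ (leftmostPath w (sym e)))

Σrow,N-coherent : ∀ n → IsCoherentPresentation (Σrow,N n) (Styl n)
Σrow,N-coherent n = record { presents = Σrow-presents ; fills = Σrow,N-fills }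

Σrow,red-coherent : ∀ n → IsCoherentPresentation (Σrow,red n) (Styl n)
Σrow,red-coherent n = Reduction.reduction-coherent (Σrow,N n) (Γ² n)
  (λ {i} {j} → lookup-injective cell (acycPairs-cells-distinct n) i j) collapsed? {Styl n} (Σrow,N-coherent n)
  where
  collapsed? : ∀ B → Dec (∃ λ i → 𝒜 i ≡ B)
  collapsed? (𝒳 _) = no λ ()
  collapsed? (𝒜 i) = yes (i , refl)

-- Finiteness

Listed : Set → Set
Listed A = Σ[ xs ∈ List A ] (∀ x → x ∈ xs)

-- A complete list may repeat elements; positions in the deduplicated list are unique.
listed-finite : ∀ {A : Set} → DecidableEquality A → Listed A → Finite A
listed-finite {A} _≟_ (xs , complete) = length ys , mk↔ₛ′ (λ x → Any.index (∈ys x)) (lookup ys)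
  (λ i → lookup-injective id (Unique.deduplicate-! _≟_ xs) _ _ (sym (lookup-index (∈ys (lookup ys i)))))
  (λ x → sym (lookup-index (∈ys x)))
  where
  ys : List A
  ys = deduplicate _≟_ xs
  ∈ys : ∀ x → x ∈ ys
  ∈ys x = ∈-deduplicate⁺ _≟_ (complete x)

finite-↔ : ∀ {A B : Set} → A ↔ B → Finite A → Finite B
finite-↔ A↔B (k , A↔k) = k , ↔-trans (↔-sym A↔B) A↔k

∈-mapMaybe⁺ : ∀ {A B : Set} (f : A → Maybe B) {xs x y} → x ∈ xs → f x ≡ just y → y ∈ mapMaybe f xs
∈-mapMaybe⁺ f {xs} x∈xs e = mapMaybe⁺ f xs (Any.map (λ { refl → MAny.just refl }) (subst (_∈ map f xs) e (∈-map⁺ f x∈xs)))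

refinements-listed : ∀ {A : Set} {P : A → Set} → Unary.Decidable P → Listed A → Listed [ x ∈ A ∣ P x ]
refinements-listed {A} {P} P? (xs , complete) = refinements P? xs , λ { (x , [ p ]) → ∈-mapMaybe⁺ _ (complete x) (accept x p) }
  where
  accept : ∀ x .(p : P x) → Maybe.map (λ q → x , [ q ]) (dec⇒maybe (P? x)) ≡ just (x , [ p ])
  accept x p with P? x
  ... | yes _ = refl
  ... | no ¬p = ⊥-elim-irr (¬p p)

×-listed : ∀ {A B : Set} → Listed A → Listed B → Listed (A × B)
×-listed (xs , x∈) (ys , y∈) = cartesianProduct xs ys , λ (x , y) → ∈-cartesianProduct⁺ (x∈ x) (y∈ y)

filter-∈-subwords : ∀ {A : Set} {P : A → Set} (P? : Unary.Decidable P) xs → filter P? xs ∈ subwords xs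
filter-∈-subwords P? []       = here refl
filter-∈-subwords P? (x ∷ xs) with does (P? x)
... | true  = ∈-++⁺ˡ (∈-map⁺ (x ∷_) (filter-∈-subwords P? xs))
... | false = ∈-++⁺ʳ (map (x ∷_) (subwords xs)) (filter-∈-subwords P? xs)

module _ {n : ℕ} where

  open DecMembership {A = Fin n} Fin._≟_ using (_∈?_)

  -- Selecting the letters of `u` from the increasing list of all letters gives an increasing word
  -- with the same letters, hence `word u`.
  word-∈-subwords : ∀ (u : Row n) → word u ∈ subwords (allFin n)
  word-∈-subwords u = subst (_∈ subwords (allFin n)) filter-word (filter-∈-subwords (_∈? word u) (allFin n))
    where
    filter-word : filter (_∈? word u) (allFin n) ≡ word u
    filter-word = sorted-ext (AllPairs.filter⁺ (_∈? word u) (AllPairs.tabulate⁺-< id)) (increasing u)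
      (λ i → proj₂ (∈-filter⁻ (_∈? word u) {xs = allFin n} i))
      (λ {x} i → ∈-filter⁺ (_∈? word u) (∈-allFin x) i)

  toRow-word : ∀ (u : Row n) → toRow (word u) ≡ just u
  toRow-word (row x xs xs↗) with linked? Fin._<?_ (x ∷ xs)
  ... | yes _  = refl
  ... | no ¬↗ = ⊥-elim-irr (¬↗ xs↗)

rows-listed : ∀ n → Listed (Row n)
rows-listed n = rows n , λ u → ∈-mapMaybe⁺ toRow (word-∈-subwords u) (toRow-word u)

rowCells-listed : ∀ n → Listed (RowCell n)
rowCells-listed n = refinements-listed (λ (u , v) → ¬? (u ◁? v)) (×-listed (rows-listed n) (rows-listed n))

triples-listed : ∀ n → Listed (𝔗¹ n)
triples-listed n = refinements-listed 𝔱¹? (×-listed (rows-listed n) (×-listed (rows-listed n) (rows-listed n)))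

cell-↔ : ∀ n → [ α ∈ RowCell n ∣ α ∉ 𝓑ᵃᶜʸᶜ n ] ↔ Polygraph₃.Cell (Σrow,red n)
cell-↔ n = mk↔ₛ′ (λ (α , [ α∉ ]) → α , [ (λ { (i , refl) → α∉ (∈-map⁺ cell (∈-lookup i)) }) ])
                 (λ (α , [ ¬removed ]) → α , [ (λ α∈ → ¬removed (kept (∈-map⁻ cell α∈))) ])
                 (λ _ → refl) (λ _ → refl)
  where
  kept : ∀ {α} → ∃ (λ p → p ∈ acycPairs n × α ≡ cell p) → ∃ λ i → cell (lookup (acycPairs n) i) ≡ α
  kept (p , p∈ , α≡) = Any.index p∈ , trans (cong cell (sym (lookup-index p∈))) (sym α≡)

-- Every `𝒜 i` is collapsed by its own index, so the surviving 3-cells are exactly those of the form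
-- `𝒳 τ`.
cell₃-↔ : ∀ n → [ τ ∈ 𝔗¹ n ∣ τ ∉ τ[𝓑ᵃᶜʸᶜ] n ] ↔ Polygraph₃.Cell₃ (Σrow,red n)
cell₃-↔ n = mk↔ₛ′ (λ τ → 𝒳 τ , [ (λ ()) ]) from (λ { (𝒳 _ , _) → refl ; (𝒜 i , [ ¬collapsed ]) → ⊥-elim-irr (¬collapsed (i , refl)) }) (λ _ → refl)
  where
  from : Polygraph₃.Cell₃ (Σrow,red n) → [ τ ∈ 𝔗¹ n ∣ τ ∉ τ[𝓑ᵃᶜʸᶜ] n ]
  from (𝒳 τ , _)                = τ
  from (𝒜 i , [ ¬collapsed ]) = ⊥-elim-irr (¬collapsed (i , refl))

Σrow,red-finite : ∀ n → IsFinite (Σrow,red n)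
Σrow,red-finite n = record
  { gen-finite   = listed-finite _≟ᴿ_ (rows-listed n)
  ; cell-finite  = finite-↔ (cell-↔ n)
      (listed-finite (Refinement._≟_ _≟ᶜ_) (refinements-listed (λ α → ¬? (α ∈ᶜ? 𝓑ᵃᶜʸᶜ n)) (rowCells-listed n)))
  ; cell₃-finite = finite-↔ (cell₃-↔ n)
      (listed-finite (Refinement._≟_ _≟ᵀ_) (refinements-listed (λ τ → ¬? (τ ∈ᵀ? τ[𝓑ᵃᶜʸᶜ] n)) (triples-listed n)))
  }
  where
  open DecMembership {A = RowCell n} _≟ᶜ_ renaming (_∈?_ to _∈ᶜ?_)
  open DecMembership {A = 𝔗¹ n} _≟ᵀ_ renaming (_∈?_ to _∈ᵀ?_)

theorem4p3p8 : ∀ n → 1 ≤ n →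
      IsFinite (Σrow,red n)
    × IsCoherentPresentation (Σrow,red n) (Styl n)
    × (Σ[ e ∈ ([ α ∈ RowCell n ∣ α ∉ 𝓑ᵃᶜʸᶜ n ] ↔ Polygraph₃.Cell (Σrow,red n)) ]
        (∀ α → value (Inverse.to e α) ≡ value α))
    × (Σ[ e ∈ ([ τ ∈ 𝔗¹ n ∣ τ ∉ τ[𝓑ᵃᶜʸᶜ] n ] ↔ Polygraph₃.Cell₃ (Σrow,red n)) ]
        (∀ τ → value (Inverse.to e τ) ≡ 𝒳 τ
             × Polygraph₃.∂ (Σrow,red n) (Inverse.to e τ) ≡ reducedBoundary n (Polygraph₃.∂ (Σrow,scoh n) (value τ))))
-- The boundary of `𝒳 τ` is by definition that of `τ` in `Σrow,scoh n`, so the equations on cells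
-- and boundaries hold definitionally.
theorem4p3p8 n _ = Σrow,red-finite n , Σrow,red-coherent n , (cell-↔ n , λ _ → refl) , (cell₃-↔ n , λ _ → refl , refl)
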